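{- For the single-machine algorithm $\mathcal{A}$ described in the context, the fractional weighted flow-time in $\mathcal{A}$ of the jobs not in $J^{imm}$ is $O(F^{\mathcal{O}}/\epsilon^2)$, with an absolute constant in $O(\cdot)$.
   Context: Single machine; a finite set of jobs arrives online; job $j$ has integer release time $r_j$, integer processing time $p_j>0$ and weight $w_j>0$; its density is $\rho_j=w_j/p_j$. The parameter $\epsilon$ satisfies $\epsilon^2\le 1/2$ and $1/\epsilon\in\mathbb{Z}$. For $x>0$, $\lfloor x\rfloor_2$ denotes the largest integer $i$ with $2^i\le x$; $\lfloor\rho_j\rfloor_2$ is the density class of $j$. Algorithm $\mathcal{A}$ (which may reject and preempt) works in unit time slots. A job is active at time $t$ if it has been released by $t$, has not finished by $t$ and has not been rejected; $A(t)$ is the active set. $p_j(t)$ is the remaining processing time of $j$ at time $t$ and $w_j(t)=\rho_j p_j(t)$. A set $L$ of "preemptible" jobs is maintained; once a job enters $L$ it stays there until it finishes. At each integer time $t$: (1) each job arriving at $t$ (jobs arriving simultaneously are considered one at a time in a fixed arbitrary order, steps (1)-(2) being done for each) is either immediately rejected by the rule below or added to the active set; (2) if the job $j$ processed in slot $[t-1,t]$ is not in $L$, let $t'$ be the time $\mathcal{A}$ started processing $j$ (so $j$ was processed uninterruptedly during $[t',t]$); if the total weight of jobs arriving during $(t',t]$ exceeds $w_j/\epsilon$, then $j$ is added to $L$; (3) if the job processed in $[t-1,t]$ has not finished and is not in $L$, it is processed in $[t,t+1]$; otherwise $\mathcal{A}$ processes in $[t,t+1]$ an active job of highest density. Immediate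 rejection rule. For an arriving job $j$, $A(r_j)$ denotes the jobs active at time $r_j$, excluding $j$ and excluding jobs arriving at $r_j$ that are considered after $j$. Let $D_j^+=\{j'\in A(r_j):\lfloor\rho_{j'}\rfloor_2\ge\lfloor\rho_j\rfloor_2\}$, $D_j^-=A(r_j)\setminus D_j^+$, $\alpha_j^+=w_j\sum_{j'\in D_j^+,\rho_{j'}\ge\rho_j}p_{j'}(r_j)+p_j\sum_{j'\in D_j^+,\rho_{j'}<\rho_j}w_{j'}(r_j)$, $\alpha_j^-=p_j\sum_{j'\in D_j^- }w_{j'}(r_j)$. Table $T^+$: if $\alpha_j^+\ge w_jp_j/\epsilon$, $j$ is assigned to the bucket $(\lfloor\alpha_j^+/w_j\rfloor_2,\lfloor w_j\rfloor_2)$ of $T^+$; in each bucket of $T^+$, the first job assigned to it is rejected, and then every $(1/\epsilon)$-th subsequent job. Table $T^-$: if $\alpha_j^->w_jp_j/\epsilon$, $j$ is assigned to the bucket $(\lfloor\alpha_j^-\rfloor_2,\lfloor\rho_j\rfloor_2,\lfloor p_j\rfloor_2)$ of $T^-$; in each bucket of $T^-$, every $(1/\epsilon)$-th job assigned to it is rejected (the first rejected one being the $(1/\epsilon)$-th). $J^{imm}$ is the set of jobs rejected upon arrival by this rule. For any schedule, the fractional weighted flow-time of a job $j$ is $\sum_{t\ge r_j}w_j(t)$, where $w_j(t)$ is $\rho_j$ times the remaining processing time of $j$ at time $t$ in that schedule (zero after completion). $\mathcal{O}$ denotes an optimal offline schedule that processes all jobs on the (unit speed) machine, with preemption allowed and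 no rejections, and $F^{\mathcal{O}}$ denotes its (total) fractional weighted flow-time.
   Formalization: The job weights (hence densities) are taken to be positive rational numbers instead of positive reals, and the offline schedule's amounts of processing per unit slot are likewise rational. -}

module Defs where

open import Data.Bool using (Bool; true; false; if_then_else_; _∧_; _∨_; not)
open import Data.Nat as ℕ using (ℕ; zero; suc; _∸_; _≤ᵇ_; _<ᵇ_; _≡ᵇ_)
import Data.Nat.DivMod as ℕD
open import Data.Nat.Logarithm using (⌊log₂_⌋; ⌈log₂_⌉)
open import Data.Integer as ℤ using (ℤ; +_; -[1+_])
import Data.Integer.Properties as ℤP
open import Data.Rational as ℚ using (ℚ; 0ℚ; 1ℚ)
open import Data.Fin using (Fin; toℕ)
open import Data.List using (List; []; _∷_; foldr; foldl; allFin; map; upTo)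
open import Data.Maybe using (Maybe; just; nothing)
open import Data.Product using (_×_; _,_)
open import Relation.Nullary.Decidable using (does)
open import Relation.Binary.PropositionalEquality using (_≡_)

qsum : List ℚ → ℚ
qsum = foldr ℚ._+_ 0ℚ

Σq : {A : Set} → List A → (A → ℚ) → ℚ
Σq xs f = qsum (map f xs)

ℚof : ℕ → ℚ
ℚof m = (+ m) ℚ./ 1

_<ᵇq_ : ℚ → ℚ → Bool
x <ᵇq y = not (y ℚ.≤ᵇ x)

_≡ᵇℤ_ : ℤ → ℤ → Bool
a ≡ᵇℤ b = does (a ℤP.≟ b)

-- ⌊x⌋₂ : the largest integer i with 2^i ≤ x (for x > 0; value 0 otherwise).
-- For x = a/b with a,b ≥ 1:  if b ≤ a then i = ⌊log₂ ⌊a/b⌋⌋,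
-- otherwise i = - ⌈log₂ ⌈b/a⌉⌉.
flog2 : ℚ → ℤ
flog2 q with ℚ.numerator q
... | + zero = + 0
... | -[1+ _ ] = + 0
... | + suc a' =
  let a = suc a'
      b = ℚ.denominatorℕ q
  in if b ≤ᵇ a
     then + ⌊log₂ (ℕD._/_ a b) ⌋
     else ℤ.- (+ ⌈log₂ (ℕD._/_ (b ℕ.+ a') a) ⌉)

-- reciprocal of a nonzero rational (0 ↦ 0, never used at 0)
recip : ℚ → ℚ
recip y with ℚ.numerator y
... | + zero = 0ℚ
... | + suc m = (+ ℚ.denominatorℕ y) ℚ./ suc m
... | -[1+ m ] = (ℤ.- (+ ℚ.denominatorℕ y)) ℚ./ suc m

-- Instances.  Job j : Fin n has release time r j, processing time
-- p j = suc (pm1 j) > 0, weight w j (positivity is a hypothesis of the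
-- theorem).

record Instance (n : ℕ) : Set where
  field
    r   : Fin n → ℕ
    pm1 : Fin n → ℕ
    w   : Fin n → ℚ

  p : Fin n → ℕ
  p j = suc (pm1 j)

  ρ : Fin n → ℚ
  ρ j = w j ℚ.* ((+ 1) ℚ./ suc (pm1 j))

-- Algorithm 𝒜 as a deterministic simulation.
-- k = 1/ε.  Tie-breaking among highest-density active jobs is given by an
-- arbitrary selector sel : ℕ → (Fin n → Bool) → Fin n (time, set of
-- candidates); if the selected job is not a candidate, the candidate of
-- smallest index is used.  Every possible tie-breaking behaviour of 𝒜
-- arises from some selector.  Jobs arriving simultaneously are considered
-- in increasing index order (the index order is arbitrary since the
-- instance is arbitrary).

record St (n : ℕ) : Set where
  field
    rem   : Fin n → ℕ
    rej   : Fin n → Bool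
    inL   : Fin n → Bool
    cur   : Maybe (Fin n)       -- job processed in the previous slot
    start : ℕ                   -- time 𝒜 started processing cur
    tplus : ℤ → ℤ → ℕ           -- number of jobs assigned so far to each bucket of T⁺
    tminus : ℤ → ℤ → ℤ → ℕ      -- number of jobs assigned so far to each bucket of T⁻

allB : {A : Set} → (A → Bool) → List A → Bool
allB P [] = true
allB P (x ∷ xs) = P x ∧ allB P xs

firstTrue : {n : ℕ} → (Fin n → Bool) → List (Fin n) → Maybe (Fin n)
firstTrue C [] = nothing
firstTrue C (x ∷ xs) = if C x then just x else firstTrue C xs

module Algorithm {n : ℕ} (k : ℕ) (I : Instance n) (sel : ℕ → (Fin n → Bool) → Fin n) where
  open Instance I
  open St

  kq : ℚ
  kq = ℚof k

  jobs : List (Fin n)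
  jobs = allFin n

  initial : St n
  initial = record
    { rem = p ; rej = λ _ → false ; inL = λ _ → false ; cur = nothing
    ; start = 0 ; tplus = λ _ _ → 0 ; tminus = λ _ _ _ → 0 }

  wrem : St n → Fin n → ℚ
  wrem s j = ρ j ℚ.* ℚof (rem s j)

  activeAt : ℕ → St n → Fin n → Fin n → Bool
  activeAt t s j j' =
    ((r j' <ᵇ t) ∨ ((r j' ≡ᵇ t) ∧ (toℕ j' <ᵇ toℕ j)))
    ∧ (0 <ᵇ rem s j') ∧ not (rej s j')

  arrive : ℕ → St n → Fin n → St n
  arrive t s j =
    let A  = activeAt t s j
        cj = flog2 (ρ j)
        Dp = λ j' → A j' ∧ (cj ℤ.≤ᵇ flog2 (ρ j'))
        Dm = λ j' → A j' ∧ not (cj ℤ.≤ᵇ flog2 (ρ j'))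
        αp = (w j ℚ.* Σq jobs (λ j' → if Dp j' ∧ (ρ j ℚ.≤ᵇ ρ j') then ℚof (rem s j') else 0ℚ))
             ℚ.+ (ℚof (p j) ℚ.* Σq jobs (λ j' → if Dp j' ∧ (ρ j' <ᵇq ρ j) then wrem s j' else 0ℚ))
        αm = ℚof (p j) ℚ.* Σq jobs (λ j' → if Dm j' then wrem s j' else 0ℚ)
        thr = w j ℚ.* ℚof (p j) ℚ.* kq
        inTp = thr ℚ.≤ᵇ αp
        kp1 = flog2 (αp ℚ.* recip (w j))
        kp2 = flog2 (w j)
        cntp = tplus s kp1 kp2
        rejp = inTp ∧ (ℕD._%_ cntp (suc (k ∸ 1)) ≡ᵇ 0)
        inTm = thr <ᵇq αm
        km1 = flog2 αm
        km2 = flog2 (ρ j)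
        km3 = flog2 (ℚof (p j))
        cntm = tminus s km1 km2 km3
        rejm = inTm ∧ (ℕD._%_ (suc cntm) (suc (k ∸ 1)) ≡ᵇ 0)
    in record s
      { rej = λ j' → if toℕ j' ≡ᵇ toℕ j then (rejp ∨ rejm) else rej s j'
      ; tplus = λ a b → if inTp ∧ (a ≡ᵇℤ kp1) ∧ (b ≡ᵇℤ kp2) then suc (tplus s a b) else tplus s a b
      ; tminus = λ a b c → if inTm ∧ (a ≡ᵇℤ km1) ∧ (b ≡ᵇℤ km2) ∧ (c ≡ᵇℤ km3) then suc (tminus s a b c) else tminus s a b c
      }

  arrivals : ℕ → St n → St n
  arrivals t s = foldl (λ s' j → if r j ≡ᵇ t then arrive t s' j else s') s jobs

  updateL : ℕ → St n → St n
  updateL t s with cur s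
  ... | nothing = s
  ... | just c =
    let arrivedW = Σq jobs (λ j → if (start s <ᵇ r j) ∧ (r j ≤ᵇ t) then w j else 0ℚ)
    in if not (inL s c) ∧ ((w c ℚ.* kq) <ᵇq arrivedW)
       then record s { inL = λ j → if toℕ j ≡ᵇ toℕ c then true else inL s j }
       else s

  runIn : Maybe (Fin n) → ℕ → St n → St n
  runIn nothing st s = record s { cur = nothing ; start = st }
  runIn (just c) st s = record s
    { rem = λ j → if toℕ j ≡ᵇ toℕ c then rem s j ∸ 1 else rem s j
    ; cur = just c ; start = st }

  continues : St n → Bool
  continues s with cur s
  ... | nothing = false
  ... | just c = not (inL s c) ∧ (0 <ᵇ rem s c)

  highest : ℕ → St n → Maybe (Fin n)
  highest t s =
    let act  = λ j → (r j ≤ᵇ t) ∧ (0 <ᵇ rem s j) ∧ not (rej s j)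
        cand = λ j → act j ∧ allB (λ j' → not (act j') ∨ (ρ j' ℚ.≤ᵇ ρ j)) jobs
    in if cand (sel t cand) then just (sel t cand) else firstTrue cand jobs

  process : ℕ → St n → St n
  process t s = if continues s then runIn (cur s) (start s) s else runIn (highest t s) t s

  step : ℕ → St n → St n
  step t s = process t (updateL t (arrivals t s))

  state : ℕ → St n
  state zero = initial
  state (suc t) = step t (state t)

  immRejected : Fin n → Bool
  immRejected j = rej (state (suc (r j))) j

  remA : ℕ → Fin n → ℕ
  remA t j = rem (state t) j

  -- Σ_{j ∉ J^imm} Σ_{r_j ≤ t < H} w_j(t) : fractional weighted flow-time of
  -- the jobs not in J^imm, truncated at horizon H (all terms are ≥ 0, so
  -- bounding it for every H bounds the full sum)
  flowA : ℕ → ℚ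
  flowA H = Σq (upTo H) (λ t → Σq jobs (λ j →
    if not (immRejected j) ∧ (r j ≤ᵇ t) then ρ j ℚ.* ℚof (remA t j) else 0ℚ))

-- Offline schedules on one unit-speed machine with preemption:
-- x t j = amount of job j processed during [t,t+1]; all work done by H0.

record Schedule (n : ℕ) : Set where
  field
    x  : ℕ → Fin n → ℚ
    H0 : ℕ

module _ {n : ℕ} (I : Instance n) (S : Schedule n) where
  open Instance I
  open Schedule S

  Feasible : Set
  Feasible =
    ((t : ℕ) (j : Fin n) → 0ℚ ℚ.≤ x t j)
    × ((t : ℕ) (j : Fin n) → t ℕ.< r j → x t j ≡ 0ℚ)
    × ((t : ℕ) → Σq (allFin n) (x t) ℚ.≤ 1ℚ)
    × ((t : ℕ) (j : Fin n) → H0 ℕ.≤ t → x t j ≡ 0ℚ)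
    × ((j : Fin n) → Σq (upTo H0) (λ s → x s j) ≡ ℚof (p j))

  remS : ℕ → Fin n → ℚ
  remS t j = ℚof (p j) ℚ.- Σq (upTo t) (λ s → x s j)

  -- fractional weighted flow-time of S (w_j(t) = 0 for t ≥ H0)
  flowS : ℚ
  flowS = Σq (upTo H0) (λ t → Σq (allFin n) (λ j →
    if r j ≤ᵇ t then ρ j ℚ.* remS t j else 0ℚ))

-- Let b_j be the delay Σ min(ρ_i, ρ_j) p_i(r_j) that job j meets on arrival, so that α⁺_j + α⁻_j = p_j b_j.
-- A pairwise potential pays for the flow of 𝒜: it is at most Σ p_j b_j over the accepted jobs, plus
-- O(k) Σ w_j p_j for the slots in which denser work (of weight at most k w_h) waits behind the served job h.
-- Conversely, b_j ≤ W(s) + ρ_j (s - r_j) for every s ≥ r_j, where W is the pending weight of 𝒜, so (b, W) is a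
-- feasible dual solution with Σ p_j b_j over all jobs; comparing the two, the rejected jobs satisfy
-- Σ p_j b_j ≤ F^𝒪 + O(k) Σ w_j p_j, and Σ w_j p_j ≤ 2 F^𝒪.
-- Within a bucket one job in k is rejected and all α agree up to a factor 4, so the accepted jobs in the tables
-- cost O(k) times the rejected ones, except for the first k - 1 jobs of each bucket of T⁻.  Their cost is
-- geometric in the bucket indices and sums to O(Σ_c U_c² / 2^c), where U_c bounds the weight of the classes
-- below c pending in 𝒜 when one of these jobs of class c arrives.  For each class the backlog volume of 𝒜
-- exceeds that of the offline schedule only by the volume blocked behind one sparser job h, at most k w_h / 2^c,
-- and a backlog of volume v in class c costs the offline schedule at least 2^c v² / 2, so this sum is O(k² F^𝒪).
module Submission where

-- The comparison that bounds the rejected jobs works only because the flow of the run has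
-- coefficient exactly 1 on both sides. The flow is at most the delay cost of the accepted jobs plus
-- terms in `w j * P j`, and the dual objective subtracts that same flow once; so the accepted
-- delays cancel. A constant factor larger than 1 in the first bound would leave accepted delays on
-- the wrong side.
--
-- This dictates the potential. The sum of min(ρ_i, ρ_j) x_i x_j over pairs, plus ρ_j (x_j² + x_j) /
-- 2 per job, is the exact cost of finishing integer amounts x in unit slots by highest density
-- first. A slot that serves a densest job therefore pays for the pending weight with no loss.
-- Delays count accepted jobs only, also for a rejected j, so one pair (b, W) is dual feasible for
-- all jobs at once.
--
-- The sums over density classes are quadratic, and a square of a sum cannot be split without a
-- factor above 1. The factor is affordable because consecutive classes differ by 2 in density: (a +
-- b)² ≤ (3/2) a² + 3 b², and half of 3/2 is 3/4, so every class recursion contracts.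

module CompetitiveAnalysis where

  open import Defs
  open import Data.Bool using (Bool; true; false; T; if_then_else_; _∧_; _∨_; not)
  import Data.Bool.Properties as BoolP
  open import Data.Empty using (⊥; ⊥-elim)
  open import Data.Fin using (Fin; zero; suc; toℕ; fromℕ<)
  import Data.Fin.Properties as FinP
  open import Data.Integer as ℤ using (ℤ; -[1+_])
  import Data.Integer.Properties as ℤP
  open import Data.List using (List; []; _∷_; _++_; _∷ʳ_; allFin; applyUpTo; cartesianProduct; foldl; map; tabulate; take; upTo)
  open import Data.List.Membership.Propositional using (_∈_)
  open import Data.List.Membership.Propositional.Properties using (∈-allFin)
  import Data.List.Properties as ListP
  open import Data.List.Relation.Unary.Any using (here; there)
  open import Data.Maybe using (Maybe; just; nothing)
  open import Data.Nat as ℕ using (ℕ; zero; suc; _∸_; _^_; _≤ᵇ_; _<ᵇ_; _≡ᵇ_; ⌊_/2⌋; ⌈_/2⌉)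
  import Data.Nat.DivMod as ℕD
  open import Data.Nat.Induction using (<-rec)
  open import Data.Nat.Logarithm
  import Data.Nat.Properties as ℕP
  open import Data.Product using (_×_; _,_; ∃-syntax; proj₁; proj₂)
  open import Data.Rational as ℚ using (ℚ; 0ℚ; 1ℚ; ½; mkℚ; nonNegative; positive; _+_; _*_; _-_; -_; _≤_; _<_; _⊓_)
  open import Data.Rational.Properties
  import Data.Rational.Unnormalised as ℚᵘ
  import Data.Rational.Unnormalised.Properties as ℚᵘP
  open import Data.Sum using (_⊎_; inj₁; inj₂)
  open import Function using (_∘_; id)
  open import Relation.Binary using (Tri; tri<; tri≈; tri>)
  open import Relation.Binary.PropositionalEquality
  open import Relation.Nullary using (Dec; yes; no; does)
  open import Tactic.RingSolver using (solve-∀)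
  open import Tactic.RingSolver.Core.AlmostCommutativeRing using (AlmostCommutativeRing; fromCommutativeRing)

  -- Rational arithmetic and finite sums

  ℚ-ring : AlmostCommutativeRing _ _
  ℚ-ring = fromCommutativeRing +-*-commutativeRing isZero
    where
    isZero : ∀ x → Maybe (0ℚ ≡ x)
    isZero x with 0ℚ ≟ x
    ... | yes p = just p
    ... | no _  = nothing

  2ℚ : ℚ
  2ℚ = 1ℚ + 1ℚ

  *-nonneg : ∀ {a b} → 0ℚ ≤ a → 0ℚ ≤ b → 0ℚ ≤ a * b
  *-nonneg {a} {b} 0≤a 0≤b =
    nonNegative⁻¹ (a * b) {{nonNeg*nonNeg⇒nonNeg a {{nonNegative 0≤a}} b {{nonNegative 0≤b}}}}

  *-positive : ∀ {a b} → 0ℚ < a → 0ℚ < b → 0ℚ < a * b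
  *-positive {a} {b} 0<a 0<b = positive⁻¹ (a * b) {{pos*pos⇒pos a {{positive 0<a}} b {{positive 0<b}}}}

  +-nonneg : ∀ {a b} → 0ℚ ≤ a → 0ℚ ≤ b → 0ℚ ≤ a + b
  +-nonneg 0≤a 0≤b = +-mono-≤ 0≤a 0≤b

  ≤-slack : ∀ {a b} d → 0ℚ ≤ d → b ≡ a + d → a ≤ b
  ≤-slack {a} d 0≤d refl = subst (_≤ a + d) (+-identityʳ a) (+-monoʳ-≤ a 0≤d)

  p≤q⇒0≤q-p : ∀ {a b} → a ≤ b → 0ℚ ≤ b - a
  p≤q⇒0≤q-p {a} {b} a≤b = subst (_≤ b - a) (+-inverseʳ a) (+-monoˡ-≤ (- a) a≤b)

  *-mono-≤ˡ : ∀ {a b} c → 0ℚ ≤ c → a ≤ b → c * a ≤ c * b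
  *-mono-≤ˡ c 0≤c = *-monoˡ-≤-nonNeg c {{nonNegative 0≤c}}

  *-mono-≤ʳ : ∀ {a b} c → 0ℚ ≤ c → a ≤ b → a * c ≤ b * c
  *-mono-≤ʳ c 0≤c = *-monoʳ-≤-nonNeg c {{nonNegative 0≤c}}

  *-mono-≤² : ∀ {a b c d} → 0ℚ ≤ a → 0ℚ ≤ d → a ≤ b → c ≤ d → a * c ≤ b * d
  *-mono-≤² {a} {b} {c} {d} 0≤a 0≤d a≤b c≤d = ≤-trans (*-mono-≤ˡ a 0≤a c≤d) (*-mono-≤ʳ d 0≤d a≤b)

  *-cancel-≤ : ∀ {a b} c → 0ℚ < c → c * a ≤ c * b → a ≤ b
  *-cancel-≤ c 0<c = *-cancelˡ-≤-pos c {{positive 0<c}}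

  square-nonneg : ∀ a → 0ℚ ≤ a * a
  square-nonneg a with ≤-total 0ℚ a
  ... | inj₁ 0≤a = *-nonneg 0≤a 0≤a
  ... | inj₂ a≤0 = subst (0ℚ ≤_) (identity a) (*-nonneg (neg-antimono-≤ a≤0) (neg-antimono-≤ a≤0))
    where
    identity : ∀ a → (- a) * (- a) ≡ a * a
    identity = solve-∀ ℚ-ring

  0≤1ℚ : 0ℚ ≤ 1ℚ
  0≤1ℚ = nonNegative⁻¹ 1ℚ

  0≤2ℚ : 0ℚ ≤ 2ℚ
  0≤2ℚ = nonNegative⁻¹ 2ℚ

  0≤½ : 0ℚ ≤ ½
  0≤½ = nonNegative⁻¹ ½

  ℚof-+ : ∀ m n → ℚof (m ℕ.+ n) ≡ ℚof m + ℚof n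
  ℚof-+ m n = toℚᵘ-injective (ℚᵘP.≃-trans (toℚᵘ-fromℚᵘ _)
    (ℚᵘP.≃-trans lemma (ℚᵘP.≃-sym (ℚᵘP.≃-trans (toℚᵘ-homo-+ (ℚof m) (ℚof n))
      (ℚᵘP.+-cong (toℚᵘ-fromℚᵘ (ℚᵘ.mkℚᵘ (ℤ.+ m) 0)) (toℚᵘ-fromℚᵘ (ℚᵘ.mkℚᵘ (ℤ.+ n) 0)))))))
    where
    lemma : ℚᵘ.mkℚᵘ (ℤ.+ (m ℕ.+ n)) 0 ℚᵘ.≃ (ℚᵘ.mkℚᵘ (ℤ.+ m) 0 ℚᵘ.+ ℚᵘ.mkℚᵘ (ℤ.+ n) 0)
    lemma = ℚᵘ.*≡* (cong (ℤ._* ℤ.+ 1) (trans (ℤP.pos-+ m n)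
      (sym (cong₂ ℤ._+_ (ℤP.*-identityʳ (ℤ.+ m)) (ℤP.*-identityʳ (ℤ.+ n))))))

  ℚof-* : ∀ m n → ℚof (m ℕ.* n) ≡ ℚof m * ℚof n
  ℚof-* m n = toℚᵘ-injective (ℚᵘP.≃-trans (toℚᵘ-fromℚᵘ _)
    (ℚᵘP.≃-trans lemma (ℚᵘP.≃-sym (ℚᵘP.≃-trans (toℚᵘ-homo-* (ℚof m) (ℚof n))
      (ℚᵘP.*-cong (toℚᵘ-fromℚᵘ (ℚᵘ.mkℚᵘ (ℤ.+ m) 0)) (toℚᵘ-fromℚᵘ (ℚᵘ.mkℚᵘ (ℤ.+ n) 0)))))))
    where
    lemma : ℚᵘ.mkℚᵘ (ℤ.+ (m ℕ.* n)) 0 ℚᵘ.≃ (ℚᵘ.mkℚᵘ (ℤ.+ m) 0 ℚᵘ.* ℚᵘ.mkℚᵘ (ℤ.+ n) 0)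
    lemma = ℚᵘ.*≡* (cong (ℤ._* ℤ.+ 1) (ℤP.pos-* m n))

  ℚof-suc : ∀ m → ℚof (suc m) ≡ 1ℚ + ℚof m
  ℚof-suc m = ℚof-+ 1 m

  0≤ℚof : ∀ m → 0ℚ ≤ ℚof m
  0≤ℚof zero = ≤-refl
  0≤ℚof (suc m) = subst (0ℚ ≤_) (sym (ℚof-suc m)) (+-nonneg 0≤1ℚ (0≤ℚof m))

  ℚof-mono : ∀ {m n} → m ℕ.≤ n → ℚof m ≤ ℚof n
  ℚof-mono {m} {n} m≤n = ≤-slack (ℚof (n ℕ.∸ m)) (0≤ℚof (n ℕ.∸ m))
    (trans (cong ℚof (sym (ℕP.m+[n∸m]≡n m≤n))) (ℚof-+ m (n ℕ.∸ m)))

  0<ℚof-suc : ∀ m → 0ℚ < ℚof (suc m)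
  0<ℚof-suc m = <-≤-trans (positive⁻¹ 1ℚ) (subst (_≤ ℚof (suc m)) refl (ℚof-mono {1} {suc m} (ℕ.s≤s ℕ.z≤n)))

  infixr 8 _⊙_

  -- Unfolds to the conditional used in the definitions of the algorithm and of the two flows, so
  -- their sums are already of this form by computation. The precedence is above that of `_*_`.
  _⊙_ : Bool → ℚ → ℚ
  b ⊙ x = if b then x else 0ℚ

  ⊙-nonneg : ∀ b {x} → 0ℚ ≤ x → 0ℚ ≤ b ⊙ x
  ⊙-nonneg true  h = h
  ⊙-nonneg false h = ≤-refl

  ⊙-≤ : ∀ b {x} → 0ℚ ≤ x → b ⊙ x ≤ x
  ⊙-≤ true  h = ≤-refl
  ⊙-≤ false h = h

  ⊙-mono : ∀ b {x y} → (b ≡ true → x ≤ y) → b ⊙ x ≤ b ⊙ y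
  ⊙-mono true  h = h refl
  ⊙-mono false h = ≤-refl

  ⊙-cong : ∀ b {x y} → (b ≡ true → x ≡ y) → b ⊙ x ≡ b ⊙ y
  ⊙-cong true  h = h refl
  ⊙-cong false h = refl

  ⊙-∧ : ∀ a b x → (a ∧ b) ⊙ x ≡ a ⊙ b ⊙ x
  ⊙-∧ true  b x = refl
  ⊙-∧ false b x = refl

  ⊙-*ˡ : ∀ b c x → b ⊙ (c * x) ≡ c * (b ⊙ x)
  ⊙-*ˡ true  c x = refl
  ⊙-*ˡ false c x = sym (*-zeroʳ c)

  ⊙-+ : ∀ b x y → b ⊙ (x + y) ≡ (b ⊙ x) + (b ⊙ y)
  ⊙-+ true  x y = refl
  ⊙-+ false x y = refl

  ⊙-comm : ∀ a b x → a ⊙ b ⊙ x ≡ b ⊙ a ⊙ x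
  ⊙-comm true  b x = refl
  ⊙-comm false true  x = refl
  ⊙-comm false false x = refl

  ⊙-impl : ∀ a b {x} → 0ℚ ≤ x → (a ≡ true → b ≡ true) → a ⊙ x ≤ b ⊙ x
  ⊙-impl true  b {x} h i = ≤-reflexive (cong (_⊙ x) (sym (i refl)))
  ⊙-impl false b {x} h i = ⊙-nonneg b h

  module _ {A : Set} where

    Σ-cong : ∀ (xs : List A) {f g} → (∀ x → f x ≡ g x) → Σq xs f ≡ Σq xs g
    Σ-cong [] h = refl
    Σ-cong (x ∷ xs) h = cong₂ _+_ (h x) (Σ-cong xs h)

    Σ-mono : ∀ (xs : List A) {f g} → (∀ x → f x ≤ g x) → Σq xs f ≤ Σq xs g
    Σ-mono [] h = ≤-refl
    Σ-mono (x ∷ xs) h = +-mono-≤ (h x) (Σ-mono xs h)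

    Σ-zero : ∀ (xs : List A) → Σq xs (λ _ → 0ℚ) ≡ 0ℚ
    Σ-zero [] = refl
    Σ-zero (x ∷ xs) = trans (+-identityˡ _) (Σ-zero xs)

    Σ-nonneg : ∀ (xs : List A) {f} → (∀ x → 0ℚ ≤ f x) → 0ℚ ≤ Σq xs f
    Σ-nonneg xs {f} h = subst (_≤ Σq xs f) (Σ-zero xs) (Σ-mono xs h)

    Σ-+ : ∀ (xs : List A) f g → Σq xs (λ x → f x + g x) ≡ Σq xs f + Σq xs g
    Σ-+ [] f g = refl
    Σ-+ (x ∷ xs) f g = trans (cong (f x + g x +_) (Σ-+ xs f g)) (identity (f x) (g x) (Σq xs f) (Σq xs g))
      where
      identity : ∀ a b c d → a + b + (c + d) ≡ a + c + (b + d)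
      identity = solve-∀ ℚ-ring

    Σ-*ˡ : ∀ (xs : List A) c f → Σq xs (λ x → c * f x) ≡ c * Σq xs f
    Σ-*ˡ [] c f = sym (*-zeroʳ c)
    Σ-*ˡ (x ∷ xs) c f = trans (cong (c * f x +_) (Σ-*ˡ xs c f)) (sym (*-distribˡ-+ c (f x) (Σq xs f)))

    Σ-*ʳ : ∀ (xs : List A) f c → Σq xs (λ x → f x * c) ≡ Σq xs f * c
    Σ-*ʳ xs f c = trans (Σ-cong xs (λ x → *-comm (f x) c)) (trans (Σ-*ˡ xs c f) (*-comm c _))

    Σ-neg : ∀ (xs : List A) f → Σq xs (λ x → - f x) ≡ - Σq xs f
    Σ-neg [] f = refl
    Σ-neg (x ∷ xs) f = trans (cong (- f x +_) (Σ-neg xs f)) (sym (neg-distrib-+ (f x) (Σq xs f)))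

    Σ-minus : ∀ (xs : List A) f g → Σq xs (λ x → f x - g x) ≡ Σq xs f - Σq xs g
    Σ-minus xs f g = trans (Σ-+ xs f (λ x → - g x)) (cong (Σq xs f +_) (Σ-neg xs g))

    Σ-⊙ : ∀ (xs : List A) b f → Σq xs (λ x → b ⊙ f x) ≡ b ⊙ Σq xs f
    Σ-⊙ xs true  f = refl
    Σ-⊙ xs false f = Σ-zero xs

    Σ-≤-+ : ∀ (xs : List A) {f} g h → (∀ x → f x ≤ g x + h x) → Σq xs f ≤ Σq xs g + Σq xs h
    Σ-≤-+ xs g h p = ≤-trans (Σ-mono xs p) (≤-reflexive (Σ-+ xs g h))

  Σ-swap : ∀ {A B : Set} (xs : List A) (ys : List B) (f : A → B → ℚ) →
    Σq xs (λ x → Σq ys (f x)) ≡ Σq ys (λ y → Σq xs (λ x → f x y))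
  Σ-swap [] ys f = sym (Σ-zero ys)
  Σ-swap (x ∷ xs) ys f = trans (cong (Σq ys (f x) +_) (Σ-swap xs ys f))
    (sym (Σ-+ ys (f x) (λ y → Σq xs (λ x → f x y))))

  Σ-∷ʳ : ∀ {A : Set} (xs : List A) x f → Σq (xs ∷ʳ x) f ≡ Σq xs f + f x
  Σ-∷ʳ [] x f = +-comm (f x) 0ℚ
  Σ-∷ʳ (y ∷ xs) x f = trans (cong (f y +_) (Σ-∷ʳ xs x f)) (sym (+-assoc (f y) _ _))

  Σ-upTo-suc : ∀ n f → Σq (upTo (suc n)) f ≡ Σq (upTo n) f + f n
  Σ-upTo-suc n f = trans (cong (λ xs → Σq xs f) (sym (ListP.upTo-∷ʳ n))) (Σ-∷ʳ (upTo n) n f)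

  Σ-upTo-mono : ∀ n {f g} → (∀ i → i ℕ.< n → f i ≤ g i) → Σq (upTo n) f ≤ Σq (upTo n) g
  Σ-upTo-mono zero h = ≤-refl
  Σ-upTo-mono (suc n) {f} {g} h = subst₂ _≤_ (sym (Σ-upTo-suc n f)) (sym (Σ-upTo-suc n g))
    (+-mono-≤ (Σ-upTo-mono n (λ i i<n → h i (ℕP.m<n⇒m<1+n i<n))) (h n ℕP.≤-refl))

  Σ-allFin : ∀ {n} (f : Fin n → ℚ) → Σq (allFin n) f ≡ qsum (tabulate f)
  Σ-allFin f = cong qsum (ListP.map-tabulate id f)

  Σ-allFin-suc : ∀ {n} (f : Fin (suc n) → ℚ) → Σq (allFin (suc n)) f ≡ f zero + Σq (allFin n) (λ i → f (suc i))
  Σ-allFin-suc f = trans (Σ-allFin f) (cong (f zero +_) (sym (Σ-allFin (λ i → f (suc i)))))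

  infix 5 _≡ᵇF_

  _≡ᵇF_ : ∀ {n} → Fin n → Fin n → Bool
  i ≡ᵇF j = toℕ i ≡ᵇ toℕ j

  Σ-single : ∀ {n} (h : Fin n) (f : Fin n → ℚ) → Σq (allFin n) (λ j → (j ≡ᵇF h) ⊙ f j) ≡ f h
  Σ-single {suc n} zero f = trans (Σ-allFin-suc (λ j → (j ≡ᵇF zero {n}) ⊙ f j))
    (trans (cong (f zero +_) (Σ-zero (allFin n))) (+-identityʳ _))
  Σ-single {suc n} (suc h) f = trans (Σ-allFin-suc (λ j → (j ≡ᵇF suc h) ⊙ f j))
    (trans (+-identityˡ _) (Σ-single h (λ i → f (suc i))))

  ≡ᵇ-refl : ∀ m → (m ≡ᵇ m) ≡ true
  ≡ᵇ-refl zero = refl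
  ≡ᵇ-refl (suc m) = ≡ᵇ-refl m

  Σ-upTo-single : ∀ N h (f : ℕ → ℚ) → h ℕ.< N → Σq (upTo N) (λ i → (i ≡ᵇ h) ⊙ f i) ≡ f h
  Σ-upTo-single (suc N) h f h<sN = trans (Σ-upTo-suc N _) (split (h ℕ.≟ N))
    where
    ≡ᵇ-false : ∀ m n → m ≢ n → (m ≡ᵇ n) ≡ false
    ≡ᵇ-false zero zero ne with () ← ne refl
    ≡ᵇ-false zero (suc n) ne = refl
    ≡ᵇ-false (suc m) zero ne = refl
    ≡ᵇ-false (suc m) (suc n) ne = ≡ᵇ-false m n (ne ∘ cong suc)

    small : ∀ M → M ℕ.≤ h → Σq (upTo M) (λ i → (i ≡ᵇ h) ⊙ f i) ≡ 0ℚ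
    small zero _ = refl
    small (suc M) M<h = trans (Σ-upTo-suc M _) (cong₂ _+_ (small M (ℕP.<⇒≤ M<h))
      (cong (_⊙ f M) (≡ᵇ-false M h (ℕP.<⇒≢ M<h))))

    split : Relation.Nullary.Dec (h ≡ N) → Σq (upTo N) (λ i → (i ≡ᵇ h) ⊙ f i) + (N ≡ᵇ h) ⊙ f N ≡ f h
    split (yes refl) = trans (cong₂ _+_ (small h ℕP.≤-refl) (cong (_⊙ f h) (≡ᵇ-refl h))) (+-identityˡ _)
    split (no h≢N) = trans (cong₂ _+_ (Σ-upTo-single N h f (ℕP.≤∧≢⇒< (ℕP.≤-pred h<sN) h≢N))
      (cong (_⊙ f N) (≡ᵇ-false N h (h≢N ∘ sym)))) (+-identityʳ _)

  ≤Σ : ∀ {n} (f : Fin n → ℚ) → (∀ j → 0ℚ ≤ f j) → ∀ h → f h ≤ Σq (allFin n) f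
  ≤Σ {n} f nn h = subst (_≤ Σq (allFin n) f) (Σ-single h f) (Σ-mono (allFin n) (λ j → ⊙-≤ (j ≡ᵇF h) (nn j)))

  -- The floor logarithm

  2^⌊log₂n⌋≤n : ∀ n → 1 ℕ.≤ n → 2 ^ ⌊log₂ n ⌋ ℕ.≤ n
  2^⌊log₂n⌋≤n = <-rec (λ n → 1 ℕ.≤ n → 2 ^ ⌊log₂ n ⌋ ℕ.≤ n) go
    where
    halve : ∀ l → 2 ^ l ℕ.≤ 2 ℕ.* 2 ^ (l ℕ.∸ 1)
    halve zero = ℕP.m≤m+n 1 _
    halve (suc l) = ℕP.≤-refl

    2*⌊n/2⌋≤n : ∀ n → 2 ℕ.* ⌊ n /2⌋ ℕ.≤ n
    2*⌊n/2⌋≤n n = ℕP.≤-trans (ℕP.+-monoʳ-≤ ⌊ n /2⌋ (ℕP.≤-trans (ℕP.≤-reflexive (ℕP.+-identityʳ _)) (ℕP.⌊n/2⌋≤⌈n/2⌉ n)))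
      (ℕP.≤-reflexive (ℕP.⌊n/2⌋+⌈n/2⌉≡n n))

    go : ∀ n → (∀ {m} → m ℕ.< n → 1 ℕ.≤ m → 2 ^ ⌊log₂ m ⌋ ℕ.≤ m) → 1 ℕ.≤ n → 2 ^ ⌊log₂ n ⌋ ℕ.≤ n
    go (suc zero) rec _ = ℕP.≤-refl
    go n@(suc (suc n')) rec _ = ℕP.≤-trans (halve ⌊log₂ n ⌋)
      (ℕP.≤-trans (ℕP.*-monoʳ-≤ 2 (subst (λ l → 2 ^ l ℕ.≤ ⌊ n /2⌋) (⌊log₂⌊n/2⌋⌋≡⌊log₂n⌋∸1 n)
        (rec (ℕP.⌊n/2⌋<n (suc n')) (ℕ.s≤s ℕ.z≤n)))) (2*⌊n/2⌋≤n n))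

  n<2^[1+⌊log₂n⌋] : ∀ n → n ℕ.< 2 ^ suc ⌊log₂ n ⌋
  n<2^[1+⌊log₂n⌋] n = ℕP.≰⇒> (λ h → ℕP.1+n≰n (ℕP.≤-trans
    (ℕP.≤-reflexive (sym (⌊log₂[2^n]⌋≡n (suc ⌊log₂ n ⌋)))) (⌊log₂⌋-mono-≤ h)))

  n≤2^⌈log₂n⌉ : ∀ n → n ℕ.≤ 2 ^ ⌈log₂ n ⌉
  n≤2^⌈log₂n⌉ = <-rec (λ n → n ℕ.≤ 2 ^ ⌈log₂ n ⌉) go
    where
    n≤2*⌈n/2⌉ : ∀ n → n ℕ.≤ 2 ℕ.* ⌈ n /2⌉
    n≤2*⌈n/2⌉ n = ℕP.≤-trans (ℕP.≤-reflexive (sym (ℕP.⌊n/2⌋+⌈n/2⌉≡n n)))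
      (ℕP.≤-trans (ℕP.+-monoˡ-≤ _ (ℕP.⌊n/2⌋≤⌈n/2⌉ n)) (ℕP.+-monoʳ-≤ ⌈ n /2⌉ (ℕP.≤-reflexive (sym (ℕP.+-identityʳ _)))))

    double : ∀ l → 1 ℕ.≤ l → 2 ℕ.* 2 ^ (l ℕ.∸ 1) ℕ.≤ 2 ^ l
    double (suc l) _ = ℕP.≤-refl

    go : ∀ n → (∀ {m} → m ℕ.< n → m ℕ.≤ 2 ^ ⌈log₂ m ⌉) → n ℕ.≤ 2 ^ ⌈log₂ n ⌉
    go zero rec = ℕ.z≤n
    go (suc zero) rec = ℕP.≤-refl
    go n@(suc (suc n')) rec = ℕP.≤-trans (n≤2*⌈n/2⌉ n) (ℕP.≤-trans
      (ℕP.*-monoʳ-≤ 2 (subst (λ l → ⌈ n /2⌉ ℕ.≤ 2 ^ l) (⌈log₂⌈n/2⌉⌉≡⌈log₂n⌉∸1 n) (rec (ℕP.⌈n/2⌉<n n'))))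
      (double ⌈log₂ n ⌉ (⌈log₂⌉-mono-≤ {2} {n} (ℕ.s≤s (ℕ.s≤s ℕ.z≤n)))))

  2^m<n : ∀ n m → ⌈log₂ n ⌉ ≡ suc m → 2 ^ m ℕ.< n
  2^m<n n m eq = ℕP.≰⇒> (λ h → ℕP.1+n≰n (ℕP.≤-trans (ℕP.≤-reflexive (sym eq))
    (ℕP.≤-trans (⌈log₂⌉-mono-≤ h) (ℕP.≤-reflexive (⌈log₂2^n⌉≡n m)))))

  -- Powers of two with integer exponents, and the bounds that define the floor logarithm

  pow : ℚ → ℕ → ℚ
  pow x zero    = 1ℚ
  pow x (suc n) = x * pow x n

  pow2 : ℤ → ℚ
  pow2 (ℤ.+ n)  = pow 2ℚ n
  pow2 -[1+ n ] = pow ½ (suc n)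

  pow-positive : ∀ x → 0ℚ < x → ∀ n → 0ℚ < pow x n
  pow-positive x 0<x zero = positive⁻¹ 1ℚ
  pow-positive x 0<x (suc n) = *-positive 0<x (pow-positive x 0<x n)

  pow2-positive : ∀ z → 0ℚ < pow2 z
  pow2-positive (ℤ.+ n)  = pow-positive 2ℚ (positive⁻¹ 2ℚ) n
  pow2-positive -[1+ n ] = pow-positive ½ (positive⁻¹ ½) (suc n)

  2*½* : ∀ x → 2ℚ * (½ * x) ≡ x
  2*½* x = trans (sym (*-assoc 2ℚ ½ x)) (*-identityˡ x)

  pow2-suc : ∀ z → pow2 (ℤ.suc z) ≡ 2ℚ * pow2 z
  pow2-suc (ℤ.+ n) = refl
  pow2-suc -[1+ zero ] = refl
  pow2-suc -[1+ suc n ] = sym (2*½* (pow ½ (suc n)))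

  pow-2ℚ : ∀ n → pow 2ℚ n ≡ ℚof (2 ^ n)
  pow-2ℚ zero = refl
  pow-2ℚ (suc n) = trans (cong (2ℚ *_) (pow-2ℚ n)) (sym (ℚof-* 2 (2 ^ n)))

  pow-½-2^ : ∀ n → pow ½ n * ℚof (2 ^ n) ≡ 1ℚ
  pow-½-2^ n = trans (cong (pow ½ n *_) (sym (pow-2ℚ n))) (go n)
    where
    identity : ∀ x y → ½ * x * (2ℚ * y) ≡ x * y
    identity = solve-∀ ℚ-ring

    go : ∀ n → pow ½ n * pow 2ℚ n ≡ 1ℚ
    go zero = refl
    go (suc n) = trans (identity (pow ½ n) (pow 2ℚ n)) (go n)

  q*↧≡↥ : ∀ q a → ℚ.numerator q ≡ ℤ.+ a → q * ℚof (ℚ.denominatorℕ q) ≡ ℚof a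
  q*↧≡↥ (mkℚ _ b-1 c) a refl = toℚᵘ-injective (ℚᵘP.≃-trans (toℚᵘ-homo-* (mkℚ (ℤ.+ a) b-1 c) (ℚof (suc b-1)))
    (ℚᵘP.≃-trans (ℚᵘP.*-cong (ℚᵘP.≃-refl {ℚᵘ.mkℚᵘ (ℤ.+ a) b-1}) (toℚᵘ-fromℚᵘ (ℚᵘ.mkℚᵘ (ℤ.+ suc b-1) 0)))
      (ℚᵘP.≃-trans (ℚᵘ.*≡* lemma) (ℚᵘP.≃-sym (toℚᵘ-fromℚᵘ (ℚᵘ.mkℚᵘ (ℤ.+ a) 0))))))
    where
    lemma : (ℤ.+ a ℤ.* ℤ.+ suc b-1) ℤ.* ℤ.+ 1 ≡ ℤ.+ a ℤ.* (ℤ.+ (suc b-1 ℕ.* 1))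
    lemma = trans (ℤP.*-identityʳ _) (cong (λ m → ℤ.+ a ℤ.* ℤ.+ m) (sym (ℕP.*-identityʳ (suc b-1))))

  0<⇒numerator : ∀ q → 0ℚ < q → ∃[ a ] ℚ.numerator q ≡ ℤ.+ suc a
  0<⇒numerator (mkℚ (ℤ.+ suc a) d c) _ = a , refl
  0<⇒numerator (mkℚ (ℤ.+ zero) d c) h with ℤ.+<+ () ← subst (λ z → ℤ.+ 0 ℤ.< z) (ℤP.*-identityʳ (ℤ.+ 0)) (drop-*<* h)
  0<⇒numerator (mkℚ -[1+ a ] d c) h with () ← subst (λ z → ℤ.+ 0 ℤ.< z) (ℤP.*-identityʳ -[1+ a ]) (drop-*<* h)

  recip-inverse : ∀ q → 0ℚ < q → recip q * q ≡ 1ℚ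
  recip-inverse (mkℚ (ℤ.+ suc m) d c) _ = toℚᵘ-injective (ℚᵘP.≃-trans
    (toℚᵘ-homo-* (recip (mkℚ (ℤ.+ suc m) d c)) (mkℚ (ℤ.+ suc m) d c))
    (ℚᵘP.≃-trans (ℚᵘP.*-cong (toℚᵘ-fromℚᵘ (ℚᵘ.mkℚᵘ (ℤ.+ suc d) m)) (ℚᵘP.≃-refl {ℚᵘ.mkℚᵘ (ℤ.+ suc m) d}))
      (ℚᵘ.*≡* (trans (ℤP.*-identityʳ _) (trans (ℤP.*-comm (ℤ.+ suc d) (ℤ.+ suc m)) (sym (ℤP.*-identityˡ _)))))))
  recip-inverse q@(mkℚ (ℤ.+ zero) d c) h with () ← proj₂ (0<⇒numerator q h)
  recip-inverse q@(mkℚ -[1+ a ] d c) h with () ← proj₂ (0<⇒numerator q h)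

  -- Rounding the quotient to an integer before taking the logarithm loses nothing: a power of two
  -- with natural exponent is an integer, so it lies below a/b exactly when it lies below the floor
  -- of a/b, and above b/a exactly when it lies above the ceiling of b/a.
  flog2-bounds : ∀ q → 0ℚ < q → pow2 (flog2 q) ≤ q × q < 2ℚ * pow2 (flog2 q)
  flog2-bounds q@(mkℚ (ℤ.+ zero) d c) h with () ← proj₂ (0<⇒numerator q h)
  flog2-bounds q@(mkℚ -[1+ a ] d c) h with () ← proj₂ (0<⇒numerator q h)
  flog2-bounds q@(mkℚ (ℤ.+ suc a') b-1 c) _ with suc b-1 ≤ᵇ suc a' in b≤ᵇa
  ... | true = lower , upper
    where
    a b d m : ℕ
    a = suc a'
    b = suc b-1
    d = a ℕD./ b
    m = ⌊log₂ d ⌋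

    1≤d : 1 ℕ.≤ d
    1≤d = ℕD.m≥n⇒m/n>0 (ℕP.≤ᵇ⇒≤ b a (subst T (sym b≤ᵇa) _))

    lower : pow 2ℚ m ≤ q
    lower = *-cancelʳ-≤-pos (ℚof b) {{positive (0<ℚof-suc b-1)}} (subst₂ _≤_
      (trans (ℚof-* (2 ^ m) b) (cong (_* ℚof b) (sym (pow-2ℚ m)))) (sym (q*↧≡↥ q a refl))
      (ℚof-mono (ℕP.≤-trans (ℕP.*-monoˡ-≤ b (2^⌊log₂n⌋≤n d 1≤d)) (ℕD.m/n*n≤m a b))))

    a<2^[1+m]*b : a ℕ.< 2 ^ suc m ℕ.* b
    a<2^[1+m]*b = ℕP.≤-trans (ℕ.s≤s (ℕP.≤-reflexive (ℕD.m≡m%n+[m/n]*n a b)))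
      (ℕP.≤-trans (ℕP.+-monoˡ-< (d ℕ.* b) (ℕD.m%n<n a b)) (ℕP.*-monoˡ-≤ b (n<2^[1+⌊log₂n⌋] d)))

    upper : q < 2ℚ * pow 2ℚ m
    upper = *-cancelʳ-<-nonNeg (ℚof b) {{nonNegative (0≤ℚof b)}} (subst₂ _<_
      (sym (q*↧≡↥ q a refl)) (trans (ℚof-* (2 ^ suc m) b) (cong (_* ℚof b) (sym (pow-2ℚ (suc m)))))
      (<-≤-trans (ℚof-< a) (ℚof-mono a<2^[1+m]*b)))
      where
      ℚof-< : ∀ m → ℚof m < ℚof (suc m)
      ℚof-< m = subst₂ _<_ (+-identityˡ (ℚof m)) (sym (ℚof-suc m)) (+-monoˡ-< (ℚof m) (positive⁻¹ 1ℚ))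
  ... | false = go ⌈log₂ d ⌉ refl
    where
    a b d : ℕ
    a = suc a'
    b = suc b-1
    d = (b ℕ.+ a') ℕD./ a

    a<b : a ℕ.< b
    a<b = ℕP.≰⇒> (λ b≤a → subst T b≤ᵇa (ℕP.≤⇒≤ᵇ b≤a))

    b≤d*a : b ℕ.≤ d ℕ.* a
    b≤d*a = ℕP.+-cancelʳ-≤ a' b (d ℕ.* a) (subst (ℕ._≤ d ℕ.* a ℕ.+ a') refl
      (ℕP.≤-trans (ℕP.≤-reflexive (ℕD.m≡m%n+[m/n]*n (b ℕ.+ a') a))
      (ℕP.≤-trans (ℕP.+-monoˡ-≤ (d ℕ.* a) (ℕP.≤-pred (ℕD.m%n<n (b ℕ.+ a') a))) (ℕP.≤-reflexive (ℕP.+-comm a' (d ℕ.* a))))))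

    2≤d : 2 ℕ.≤ d
    2≤d = ℕP.≰⇒> (λ d≤1 → ℕP.<⇒≱ a<b (ℕP.≤-trans b≤d*a
      (ℕP.≤-trans (ℕP.*-monoˡ-≤ a d≤1) (ℕP.≤-reflexive (ℕP.*-identityˡ a)))))

    go : ∀ m → ⌈log₂ d ⌉ ≡ m → pow2 (ℤ.- (ℤ.+ m)) ≤ q × q < 2ℚ * pow2 (ℤ.- (ℤ.+ m))
    -- Since a < b, the rounded-up quotient `d` is at least 2, so the exponent is strictly negative.
    go zero eq = ⊥-elim (ℕP.1+n≰n (ℕP.≤-trans (⌈log₂⌉-mono-≤ 2≤d) (ℕP.≤-reflexive eq)))
    go (suc m) eq = lower , upper
      where
      b≤2^[1+m]*a : b ℕ.≤ a ℕ.* 2 ^ suc m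
      b≤2^[1+m]*a = ℕP.≤-trans b≤d*a (ℕP.≤-trans (ℕP.*-monoˡ-≤ a
        (ℕP.≤-trans (n≤2^⌈log₂n⌉ d) (ℕP.≤-reflexive (cong (2 ^_) eq)))) (ℕP.≤-reflexive (ℕP.*-comm (2 ^ suc m) a)))

      -- From 2^m + 1 ≤ d and d * a ≤ b + a'. The strictness comes from `a'` being a - 1.
      2^m*a<b : 2 ^ m ℕ.* a ℕ.< b
      2^m*a<b = ℕP.+-cancelʳ-< a' _ b (ℕP.≤-trans (ℕP.≤-reflexive (lemma (2 ^ m ℕ.* a)))
        (ℕP.≤-trans (ℕP.*-monoˡ-≤ a (2^m<n d m eq)) (ℕD.m/n*n≤m (b ℕ.+ a') a)))
        where
        lemma : ∀ x → suc (x ℕ.+ a') ≡ a ℕ.+ x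
        lemma x = cong suc (ℕP.+-comm x a')

      swap : ∀ x y z → x * y * z ≡ x * z * y
      swap = solve-∀ ℚ-ring

      P = ℚof (2 ^ suc m)

      0<P*b : 0ℚ < P * ℚof b
      0<P*b = *-positive (subst (0ℚ <_) (pow-2ℚ (suc m)) (pow2-positive (ℤ.+ suc m))) (0<ℚof-suc b-1)

      left : pow ½ (suc m) * (P * ℚof b) ≡ ℚof b
      left = trans (sym (*-assoc (pow ½ (suc m)) P (ℚof b)))
        (trans (cong (_* ℚof b) (pow-½-2^ (suc m))) (*-identityˡ (ℚof b)))

      right : q * (P * ℚof b) ≡ ℚof (a ℕ.* 2 ^ suc m)
      right = trans (sym (*-assoc q P (ℚof b))) (trans (swap q P (ℚof b))
        (trans (cong (_* P) (q*↧≡↥ q a refl)) (sym (ℚof-* a (2 ^ suc m)))))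

      lower : pow ½ (suc m) ≤ q
      lower = *-cancelʳ-≤-pos (P * ℚof b) {{positive 0<P*b}} (subst₂ _≤_ (sym left) (sym right) (ℚof-mono b≤2^[1+m]*a))

      a*2^[1+m]<2b : suc (a ℕ.* 2 ^ suc m) ℕ.≤ 2 ℕ.* b
      a*2^[1+m]<2b = ℕP.≤-trans (ℕ.s≤s (ℕP.≤-reflexive
        (trans (ℕP.*-comm a (2 ^ suc m)) (ℕP.*-assoc 2 (2 ^ m) a)))) (ℕP.*-monoʳ-< 2 2^m*a<b)

      upper : q < 2ℚ * pow ½ (suc m)
      upper = *-cancelʳ-<-nonNeg (P * ℚof b) {{nonNegative (<⇒≤ 0<P*b)}} (subst₂ _<_ (sym right)
        (trans (ℚof-* 2 b) (sym (trans (*-assoc 2ℚ (pow ½ (suc m)) (P * ℚof b)) (cong (2ℚ *_) left))))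
        (<-≤-trans (subst₂ _<_ (+-identityˡ (ℚof N)) (sym (ℚof-suc N)) (+-monoˡ-< (ℚof N) (positive⁻¹ 1ℚ)))
          (ℚof-mono a*2^[1+m]<2b)))
        where
        N = a ℕ.* 2 ^ suc m

  -- Bucket keys are integers, while sums run over `upTo`. Shifting by a bound M on all absolute
  -- values that occur turns keys into natural indices; `level` and `index` are the two directions
  -- of the shift.
  level : ℕ → ℕ → ℤ
  level M i = i ℤ.⊖ M

  pow2-level-suc : ∀ M i → pow2 (level M (suc i)) ≡ 2ℚ * pow2 (level M i)
  pow2-level-suc M i = trans (cong pow2 (sym (ℤP.distribʳ-⊖-+-pos 1 i M))) (pow2-suc (level M i))

  index : ℕ → ℤ → ℕ
  index M (ℤ.+ n)  = n ℕ.+ M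
  index M -[1+ n ] = M ℕ.∸ suc n

  level-index : ∀ M z → ℤ.∣ z ∣ ℕ.≤ M → level M (index M z) ≡ z
  level-index M (ℤ.+ n)  _ = trans (ℤP.⊖-≥ (ℕP.m≤n+m M n)) (cong ℤ.+_ (ℕP.m+n∸n≡m n M))
  level-index M -[1+ n ] h = trans (ℤP.⊖-≤ (ℕP.m∸n≤m M (suc n))) (cong (λ m → ℤ.- ℤ.+ m) (ℕP.m∸[m∸n]≡n h))

  index-< : ∀ M z → ℤ.∣ z ∣ ℕ.≤ M → index M z ℕ.< suc (M ℕ.+ M)
  index-< M (ℤ.+ n)  h = ℕ.s≤s (ℕP.+-monoˡ-≤ M h)
  index-< M -[1+ n ] h = ℕ.s≤s (ℕP.≤-trans (ℕP.m∸n≤m M (suc n)) (ℕP.m≤m+n M M))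

  index-mono-≤ : ∀ M {z z'} → ℤ.∣ z ∣ ℕ.≤ M → ℤ.∣ z' ∣ ℕ.≤ M → z ℤ.≤ z' → index M z ℕ.≤ index M z'
  index-mono-≤ M {z} {z'} h h' z≤z' = ℕP.≮⇒≥ (λ lt → ℤP.<⇒≱
    (subst₂ ℤ._<_ (level-index M z' h') (level-index M z h) (ℤP.⊖-monoˡ-< M lt)) z≤z')

  index-mono-< : ∀ M {z z'} → ℤ.∣ z ∣ ℕ.≤ M → ℤ.∣ z' ∣ ℕ.≤ M → z ℤ.< z' → index M z ℕ.< index M z'
  index-mono-< M {z} {z'} h h' z<z' = ℕP.≰⇒> (λ le → ℤP.<⇒≱ z<z'
    (subst₂ ℤ._≤_ (level-index M z' h') (level-index M z h) (ℤP.⊖-monoˡ-≤ M le)))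

  level-≡ᵇ : ∀ M i z → ℤ.∣ z ∣ ℕ.≤ M → (level M i ≡ᵇℤ z) ≡ (i ℕ.≡ᵇ index M z)
  level-≡ᵇ M i z h with level M i ℤP.≟ z | i ℕ.≟ index M z
  ... | yes p | yes q = sym (trans (cong (ℕ._≡ᵇ index M z) q) (≡ᵇ-refl (index M z)))
  ... | no ¬p | yes q = ⊥-elim (¬p (trans (cong (level M) q) (level-index M z h)))
  ... | no ¬p | no ¬q = sym (¬T⇒false (λ t → ¬q (ℕP.≡ᵇ⇒≡ i (index M z) t)))
    where
    ¬T⇒false : ∀ {b} → (T b → Data.Empty.⊥) → b ≡ false
    ¬T⇒false {false} f = refl
    ¬T⇒false {true}  f = ⊥-elim (f _)
  ... | yes p | no ¬q with ℕP.<-cmp i (index M z)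
  ...   | tri< lt _ _ = ⊥-elim (ℤP.<-irrefl refl (subst₂ ℤ._<_ p (level-index M z h) (ℤP.⊖-monoˡ-< M lt)))
  ...   | tri≈ _ eq _ = ⊥-elim (¬q eq)
  ...   | tri> _ _ gt = ⊥-elim (ℤP.<-irrefl refl (subst₂ ℤ._<_ (level-index M z h) p (ℤP.⊖-monoˡ-< M gt)))

  -- Arrivals and rejections in the simulation

  T⇒true : ∀ {b} → T b → b ≡ true
  T⇒true {true} _ = refl

  ¬T⇒false : ∀ {b} → (T b → ⊥) → b ≡ false
  ¬T⇒false {false} f = refl
  ¬T⇒false {true}  f = ⊥-elim (f _)

  true⇒T : ∀ {b} → b ≡ true → T b
  true⇒T refl = _

  false⇒¬T : ∀ {b} → b ≡ false → T b → ⊥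
  false⇒¬T refl ()

  ∧-true : ∀ {a b} → a ∧ b ≡ true → a ≡ true × b ≡ true
  ∧-true {true} {true} refl = refl , refl

  not-true : ∀ {b} → not b ≡ true → b ≡ false
  not-true {false} refl = refl

  not-false : ∀ {b} → not b ≡ false → b ≡ true
  not-false {true} refl = refl

  <ᵇ-true : ∀ {m n} → m ℕ.< n → (m <ᵇ n) ≡ true
  <ᵇ-true h = T⇒true (ℕP.<⇒<ᵇ h)

  <ᵇ-false : ∀ {m n} → n ℕ.≤ m → (m <ᵇ n) ≡ false
  <ᵇ-false {m} {n} h = ¬T⇒false (λ t → ℕP.<⇒≱ (ℕP.<ᵇ⇒< m n t) h)

  <ᵇ-true⁻¹ : ∀ {m n} → (m <ᵇ n) ≡ true → m ℕ.< n
  <ᵇ-true⁻¹ {m} {n} e = ℕP.<ᵇ⇒< m n (true⇒T e)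

  ≤ᵇ-true : ∀ {m n} → m ℕ.≤ n → (m ≤ᵇ n) ≡ true
  ≤ᵇ-true h = T⇒true (ℕP.≤⇒≤ᵇ h)

  ≤ᵇ-false : ∀ {m n} → n ℕ.< m → (m ≤ᵇ n) ≡ false
  ≤ᵇ-false {m} {n} h = ¬T⇒false (λ t → ℕP.<⇒≱ h (ℕP.≤ᵇ⇒≤ m n t))

  ≤ᵇ-true⁻¹ : ∀ {m n} → (m ≤ᵇ n) ≡ true → m ℕ.≤ n
  ≤ᵇ-true⁻¹ {m} {n} e = ℕP.≤ᵇ⇒≤ m n (true⇒T e)

  ≤ᵇ-false⁻¹ : ∀ {m n} → (m ≤ᵇ n) ≡ false → n ℕ.< m
  ≤ᵇ-false⁻¹ e = ℕP.≰⇒> (λ h → false⇒¬T e (ℕP.≤⇒≤ᵇ h))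

  ≡ᵇ-true⁻¹ : ∀ {m n} → (m ≡ᵇ n) ≡ true → m ≡ n
  ≡ᵇ-true⁻¹ {m} {n} e = ℕP.≡ᵇ⇒≡ m n (true⇒T e)

  ≡ᵇ-false : ∀ {m n} → m ≢ n → (m ≡ᵇ n) ≡ false
  ≡ᵇ-false {m} {n} ne = ¬T⇒false (ne ∘ ℕP.≡ᵇ⇒≡ m n)

  ≡ᵇ-false⁻¹ : ∀ {m n} → (m ≡ᵇ n) ≡ false → m ≢ n
  ≡ᵇ-false⁻¹ {m} e refl with () ← trans (sym e) (≡ᵇ-refl m)

  ≤ᵇq-true : ∀ {x y} → x ≤ y → (x ℚ.≤ᵇ y) ≡ true
  ≤ᵇq-true h = T⇒true (≤⇒≤ᵇ h)

  ≤ᵇq-true⁻¹ : ∀ {x y} → (x ℚ.≤ᵇ y) ≡ true → x ≤ y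
  ≤ᵇq-true⁻¹ e = ≤ᵇ⇒≤ (true⇒T e)

  ≤ᵇq-false⁻¹ : ∀ {x y} → (x ℚ.≤ᵇ y) ≡ false → y < x
  ≤ᵇq-false⁻¹ e = ≰⇒> (λ h → false⇒¬T e (≤⇒≤ᵇ h))

  <ᵇq-true⁻¹ : ∀ {x y} → (x <ᵇq y) ≡ true → x < y
  <ᵇq-true⁻¹ e = ≤ᵇq-false⁻¹ (not-true e)

  <ᵇq-false⁻¹ : ∀ {x y} → (x <ᵇq y) ≡ false → y ≤ x
  <ᵇq-false⁻¹ e = ≤ᵇq-true⁻¹ (not-false e)

  allB-true : ∀ {A : Set} (P : A → Bool) {xs} → (∀ x → x ∈ xs → P x ≡ true) → allB P xs ≡ true
  allB-true P {[]} h = refl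
  allB-true P {x ∷ xs} h rewrite h x (here refl) = allB-true P (λ y y∈ → h y (there y∈))

  allB-true⁻¹ : ∀ {A : Set} (P : A → Bool) {xs} → allB P xs ≡ true → ∀ x → x ∈ xs → P x ≡ true
  allB-true⁻¹ P e x (here refl) = proj₁ (∧-true e)
  allB-true⁻¹ P {y ∷ _} e x (there x∈) = allB-true⁻¹ P (proj₂ (∧-true {P y} e)) x x∈

  firstTrue-just : ∀ {n} (C : Fin n → Bool) xs {x} → firstTrue C xs ≡ just x → C x ≡ true
  firstTrue-just C (y ∷ xs) e with C y in Cy
  firstTrue-just C (y ∷ xs) refl | true = Cy
  ... | false = firstTrue-just C xs e

  firstTrue-nothing : ∀ {n} (C : Fin n → Bool) xs → firstTrue C xs ≡ nothing → ∀ x → x ∈ xs → C x ≡ false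
  firstTrue-nothing C (y ∷ xs) e x x∈ with C y in Cy
  firstTrue-nothing C (y ∷ xs) e x (here refl) | false = Cy
  firstTrue-nothing C (y ∷ xs) e x (there x∈)  | false = firstTrue-nothing C xs e x x∈

  argmax : ∀ {A : Set} (act : A → Bool) (f : A → ℚ) xs →
    (∀ x → x ∈ xs → act x ≡ false) ⊎
    ∃[ h ] (act h ≡ true × (∀ x → x ∈ xs → act x ≡ true → f x ≤ f h))
  argmax act f [] = inj₁ (λ x ())
  argmax act f (y ∷ xs) with argmax act f xs | act y in Ay
  ... | inj₁ none | false = inj₁ (λ { x (here refl) → Ay ; x (there x∈) → none x x∈ })
  ... | inj₁ none | true = inj₂ (y , Ay , λ { x (here refl) _ → ≤-refl ; x (there x∈) Ax → ⊥-elim (false⇒¬T (none x x∈) (true⇒T Ax)) })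
  ... | inj₂ (h , Ah , max) | false = inj₂ (h , Ah , λ { x (here refl) Ax → ⊥-elim (false⇒¬T Ay (true⇒T Ax)) ; x (there x∈) Ax → max x x∈ Ax })
  ... | inj₂ (h , Ah , max) | true with ≤-total (f y) (f h)
  ...   | inj₁ y≤h = inj₂ (h , Ah , λ { x (here refl) _ → y≤h ; x (there x∈) Ax → max x x∈ Ax })
  ...   | inj₂ h≤y = inj₂ (y , Ay , λ { x (here refl) _ → ≤-refl ; x (there x∈) Ax → ≤-trans (max x x∈ Ax) h≤y })

  ≤ᵇ≡<ᵇsuc : ∀ m t → (m ≤ᵇ t) ≡ (m <ᵇ suc t)
  ≤ᵇ≡<ᵇsuc zero t = refl
  ≤ᵇ≡<ᵇsuc (suc m) t = refl

  if-elim : ∀ {A : Set} (P : A → Set) b {x y} → P x → P y → P (if b then x else y)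
  if-elim P true  px py = px
  if-elim P false px py = py

  module Simulation {n : ℕ} (k : ℕ) (I : Instance n) (sel : ℕ → (Fin n → Bool) → Fin n) where
    open Instance I public
    open Algorithm k I sel public
    open St public

    -- The pair (t , m) names a stage of the simulation: the jobs released before t, and those
    -- released at t with index below m, have been considered. Stage (t , n) and stage (suc t , 0)
    -- agree, which is `bef-next`.
    bef : ℕ → ℕ → Fin n → Bool
    bef t m i = (r i <ᵇ t) ∨ ((r i ≡ᵇ t) ∧ (toℕ i <ᵇ m))

    bef-< : ∀ {t} m i → r i ℕ.< t → bef t m i ≡ true
    bef-< {t} m i h rewrite <ᵇ-true {r i} {t} h = refl

    bef-≡ : ∀ {t} m i → r i ≡ t → bef t m i ≡ (toℕ i <ᵇ m)
    bef-≡ m i refl rewrite <ᵇ-false {r i} {r i} ℕP.≤-refl | ≡ᵇ-refl (r i) = refl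

    bef-> : ∀ {t} m i → t ℕ.< r i → bef t m i ≡ false
    bef-> {t} m i h rewrite <ᵇ-false {r i} {t} (ℕP.<⇒≤ h) | ≡ᵇ-false {r i} {t} (λ e → ℕP.<⇒≢ h (sym e)) = refl

    bef-step-≢ : ∀ t (j i : Fin n) → toℕ i ≢ toℕ j → bef t (suc (toℕ j)) i ≡ bef t (toℕ j) i
    bef-step-≢ t j i i≢j = cong (λ b → (r i <ᵇ t) ∨ ((r i ≡ᵇ t) ∧ b)) (lemma (ℕP.<-cmp (toℕ i) (toℕ j)))
      where
      lemma : Relation.Binary.Tri (toℕ i ℕ.< toℕ j) (toℕ i ≡ toℕ j) (toℕ j ℕ.< toℕ i) → (toℕ i <ᵇ suc (toℕ j)) ≡ (toℕ i <ᵇ toℕ j)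
      lemma (tri< lt _ _) = trans (<ᵇ-true (ℕP.m<n⇒m<1+n lt)) (sym (<ᵇ-true lt))
      lemma (tri≈ _ eq _) = ⊥-elim (i≢j eq)
      lemma (tri> _ _ gt) = trans (<ᵇ-false gt) (sym (<ᵇ-false (ℕP.<⇒≤ gt)))

    bef-step-idle : ∀ t j i → (r j ≡ᵇ t) ≡ false → bef t (suc (toℕ j)) i ≡ bef t (toℕ j) i
    bef-step-idle t j i e with toℕ i ℕ.≟ toℕ j
    ... | no i≢j = bef-step-≢ t j i i≢j
    ... | yes i≡j with refl ← FinP.toℕ-injective {i = i} {j} i≡j rewrite e = refl

    bef-self-before : ∀ j → bef (r j) (toℕ j) j ≡ false
    bef-self-before j = trans (bef-≡ (toℕ j) j refl) (<ᵇ-false {toℕ j} {toℕ j} ℕP.≤-refl)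

    bef-self-after : ∀ j → bef (r j) (suc (toℕ j)) j ≡ true
    bef-self-after j = trans (bef-≡ (suc (toℕ j)) j refl) (<ᵇ-true {toℕ j} {suc (toℕ j)} ℕP.≤-refl)

    bef-zero : ∀ t i → bef t 0 i ≡ (r i <ᵇ t)
    bef-zero t i with ℕP.<-cmp (r i) t
    ... | tri< lt _ _ = trans (bef-< 0 i lt) (sym (<ᵇ-true lt))
    ... | tri≈ _ eq _ = trans (bef-≡ 0 i eq) (sym (<ᵇ-false (ℕP.≤-reflexive (sym eq))))
    ... | tri> _ _ gt = trans (bef-> 0 i gt) (sym (<ᵇ-false (ℕP.<⇒≤ gt)))

    bef-end : ∀ t i → bef t n i ≡ (r i ≤ᵇ t)
    bef-end t i with ℕP.<-cmp (r i) t
    ... | tri< lt _ _ = trans (bef-< n i lt) (sym (≤ᵇ-true (ℕP.<⇒≤ lt)))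
    ... | tri≈ _ eq _ = trans (bef-≡ n i eq) (trans (<ᵇ-true (FinP.toℕ<n i)) (sym (≤ᵇ-true (ℕP.≤-reflexive eq))))
    ... | tri> _ _ gt = trans (bef-> n i gt) (sym (≤ᵇ-false gt))

    bef-next : ∀ t i → bef t n i ≡ bef (suc t) 0 i
    bef-next t i = trans (bef-end t i) (trans (≤ᵇ≡<ᵇsuc (r i) t) (sym (bef-zero (suc t) i)))

    astep : ℕ → St n → Fin n → St n
    astep t s j = if r j ≡ᵇ t then arrive t s j else s

    abstract
      mid : ℕ → ℕ → St n
      mid t m = foldl (astep t) (state t) (take m jobs)

      mid-zero : ∀ t → mid t 0 ≡ state t
      mid-zero t = refl

      mid-suc : ∀ t j → mid t (suc (toℕ j)) ≡ astep t (mid t (toℕ j)) j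
      mid-suc t j = trans (cong (foldl (astep t) (state t)) (ListP.take-suc-tabulate id j))
        (ListP.foldl-∷ʳ (astep t) (state t) j (take (toℕ j) jobs))

      mid-n : ∀ t → mid t n ≡ arrivals t (state t)
      mid-n t = cong (foldl (astep t) (state t)) (ListP.take-all n jobs (ℕP.≤-reflexive (ListP.length-tabulate id)))

    -- Rejection flags and bucket counters change only when a job is considered, so their invariants
    -- are proved stage by stage; passing from (t , n) to (suc t , 0) runs the update of L and the
    -- slot itself, which leave them alone.
    arrival-induction : (P : ℕ → ℕ → Set) → P 0 0 → (∀ t j → P t (toℕ j) → P t (suc (toℕ j))) →
      (∀ t → P t n → P (suc t) 0) → ∀ t m → m ℕ.≤ n → P t m
    arrival-induction P base stepA stepT = go
      where
      go : ∀ t m → m ℕ.≤ n → P t m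
      go zero zero _ = base
      go (suc t) zero _ = stepT t (go t n ℕP.≤-refl)
      go t (suc m) m<n = subst (λ m → P t (suc m)) (FinP.toℕ-fromℕ< m<n)
        (stepA t (fromℕ< m<n) (subst (P t) (sym (FinP.toℕ-fromℕ< m<n)) (go t m (ℕP.<⇒≤ m<n))))

    foldl-invariant : ∀ {X : Set} (f : St n → X) t → (∀ s j → f (arrive t s j) ≡ f s) →
      ∀ s xs → f (foldl (astep t) s xs) ≡ f s
    foldl-invariant f t h s [] = refl
    foldl-invariant f t h s (j ∷ xs) with r j ≡ᵇ t
    ... | true  = trans (foldl-invariant f t h (arrive t s j) xs) (h s j)
    ... | false = foldl-invariant f t h s xs

    abstract
      rem-mid : ∀ t m → rem (mid t m) ≡ rem (state t)
      rem-mid t m = foldl-invariant rem t (λ _ _ → refl) (state t) (take m jobs)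

    -- The state that the rejection rule reads for j: every job considered earlier at the same
    -- release time has already been handled.
    sAt : Fin n → St n
    sAt j = mid (r j) (toℕ j)

    module Arrival (t : ℕ) (s : St n) (j : Fin n) where

      D⁺ D⁻ : Fin n → Bool
      D⁺ i = activeAt t s j i ∧ (flog2 (ρ j) ℤ.≤ᵇ flog2 (ρ i))
      D⁻ i = activeAt t s j i ∧ not (flog2 (ρ j) ℤ.≤ᵇ flog2 (ρ i))

      thr : ℚ
      thr = w j * ℚof (p j) * kq

      -- Unfolded, these terms make conversion checking infeasible.
      abstract
        α⁺ α⁻ : ℚ
        α⁺ = (w j * Σq jobs (λ i → (D⁺ i ∧ (ρ j ℚ.≤ᵇ ρ i)) ⊙ ℚof (rem s i)))
           + (ℚof (p j) * Σq jobs (λ i → (D⁺ i ∧ (ρ i <ᵇq ρ j)) ⊙ wrem s i))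
        α⁻ = ℚof (p j) * Σq jobs (λ i → D⁻ i ⊙ wrem s i)

        α⁺-def : α⁺ ≡ (w j * Σq jobs (λ i → (D⁺ i ∧ (ρ j ℚ.≤ᵇ ρ i)) ⊙ ℚof (rem s i)))
           + (ℚof (p j) * Σq jobs (λ i → (D⁺ i ∧ (ρ i <ᵇq ρ j)) ⊙ wrem s i))
        α⁺-def = refl

        α⁻-def : α⁻ ≡ ℚof (p j) * Σq jobs (λ i → D⁻ i ⊙ wrem s i)
        α⁻-def = refl

        inT⁺ inT⁻ : Bool
        inT⁺ = thr ℚ.≤ᵇ α⁺
        inT⁻ = thr <ᵇq α⁻

        inT⁺-def : inT⁺ ≡ (thr ℚ.≤ᵇ α⁺)
        inT⁺-def = refl

        inT⁻-def : inT⁻ ≡ (thr <ᵇq α⁻)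
        inT⁻-def = refl

      key⁺₁ key⁺₂ key⁻₁ key⁻₂ key⁻₃ : ℤ
      key⁺₁ = flog2 (α⁺ * recip (w j))
      key⁺₂ = flog2 (w j)
      key⁻₁ = flog2 α⁻
      key⁻₂ = flog2 (ρ j)
      key⁻₃ = flog2 (ℚof (p j))

      abstract
        rej⁺ rej⁻ : Bool
        rej⁺ = inT⁺ ∧ (ℕD._%_ (tplus s key⁺₁ key⁺₂) (suc (k ∸ 1)) ≡ᵇ 0)
        rej⁻ = inT⁻ ∧ (ℕD._%_ (suc (tminus s key⁻₁ key⁻₂ key⁻₃)) (suc (k ∸ 1)) ≡ᵇ 0)

        rej⁺-def : rej⁺ ≡ inT⁺ ∧ (ℕD._%_ (tplus s key⁺₁ key⁺₂) (suc (k ∸ 1)) ≡ᵇ 0)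
        rej⁺-def = refl

        rej⁻-def : rej⁻ ≡ inT⁻ ∧ (ℕD._%_ (suc (tminus s key⁻₁ key⁻₂ key⁻₃)) (suc (k ∸ 1)) ≡ᵇ 0)
        rej⁻-def = refl

        arrive-rej : ∀ i → rej (arrive t s j) i ≡ (if toℕ i ≡ᵇ toℕ j then rej⁺ ∨ rej⁻ else rej s i)
        arrive-rej i = refl

        arrive-tplus : ∀ a b → tplus (arrive t s j) a b
          ≡ (if inT⁺ ∧ (a ≡ᵇℤ key⁺₁) ∧ (b ≡ᵇℤ key⁺₂) then suc (tplus s a b) else tplus s a b)
        arrive-tplus a b = refl

        arrive-tminus : ∀ a b c → tminus (arrive t s j) a b c
          ≡ (if inT⁻ ∧ (a ≡ᵇℤ key⁻₁) ∧ (b ≡ᵇℤ key⁻₂) ∧ (c ≡ᵇℤ key⁻₃) then suc (tminus s a b c) else tminus s a b c)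
        arrive-tminus a b c = refl

    rejectedIn : ℕ → St n → Fin n → Bool
    rejectedIn t s j = Arrival.rej⁺ t s j ∨ Arrival.rej⁻ t s j

    astep-rej : ∀ t s j i → rej (astep t s j) i ≡
      (if r j ≡ᵇ t then (if toℕ i ≡ᵇ toℕ j then rejectedIn t s j else rej s i) else rej s i)
    astep-rej t s j i = go (r j ≡ᵇ t)
      where
      go : ∀ b → rej (if b then arrive t s j else s) i ≡
        (if b then (if toℕ i ≡ᵇ toℕ j then rejectedIn t s j else rej s i) else rej s i)
      go true  = Arrival.arrive-rej t s j i
      go false = refl

    rejected : Fin n → Bool
    rejected j = rejectedIn (r j) (sAt j) j

    updateL-only-inL : ∀ t s → ∃[ L ] updateL t s ≡ record s { inL = L }
    updateL-only-inL t s with cur s in eq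
    ... | nothing = inL s , cong (λ c → record s { cur = c }) eq
    ... | just c with not (inL s c) ∧ ((w c ℚ.* kq) <ᵇq Σq jobs (λ j → if (start s <ᵇ r j) ∧ (r j ≤ᵇ t) then w j else 0ℚ))
    ...   | true  = _ , cong (λ d → record s { inL = λ j → if toℕ j ≡ᵇ toℕ c then true else inL s j ; cur = d }) eq
    ...   | false = inL s , cong (λ d → record s { cur = d }) eq

    updated : ℕ → St n
    updated t = updateL t (arrivals t (state t))

    updated-other : ∀ {X : Set} (f : St n → X) → (∀ s L → f (record s { inL = L }) ≡ f s) →
      (∀ t s j → f (arrive t s j) ≡ f s) → ∀ t → f (updated t) ≡ f (state t)
    updated-other f fL fA t = trans (update (arrivals t (state t))) (foldl-invariant f t (fA t) (state t) jobs)
      where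
      update : ∀ s → f (updateL t s) ≡ f s
      update s = trans (cong f (proj₂ (updateL-only-inL t s))) (fL s (proj₁ (updateL-only-inL t s)))

    rem-updated : ∀ t → rem (updated t) ≡ rem (state t)
    rem-updated = updated-other rem (λ _ _ → refl) (λ _ _ _ → refl)

    cur-updated : ∀ t → cur (updated t) ≡ cur (state t)
    cur-updated = updated-other cur (λ _ _ → refl) (λ _ _ _ → refl)

    start-updated : ∀ t → start (updated t) ≡ start (state t)
    start-updated = updated-other start (λ _ _ → refl) (λ _ _ _ → refl)

    runIn-other : ∀ {X : Set} (f : St n → X) →
      (∀ s m c t → f (record s { rem = m ; cur = c ; start = t }) ≡ f s) → ∀ c t s → f (runIn c t s) ≡ f s
    runIn-other f h nothing t s = h s (rem s) nothing t
    runIn-other f h (just c) t s = h s _ (just c) t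

    process-other : ∀ {X : Set} (f : St n → X) →
      (∀ s m c t → f (record s { rem = m ; cur = c ; start = t }) ≡ f s) → ∀ t s → f (process t s) ≡ f s
    process-other f h t s = if-elim (λ s' → f s' ≡ f s) (continues s)
      (runIn-other f h (cur s) (start s) s) (runIn-other f h (highest t s) t s)

    step-other : ∀ {X : Set} (f : St n → X) →
      (∀ s L m c t → f (record s { inL = L ; rem = m ; cur = c ; start = t }) ≡ f s) →
      ∀ t s → f (process t (updateL t s)) ≡ f s
    step-other f h t s = trans (process-other f (λ s m c t → h s (inL s) m c t) t (updateL t s))
      (trans (cong f (proj₂ (updateL-only-inL t s))) (h s (proj₁ (updateL-only-inL t s)) (rem s) (cur s) (start s)))

    state-suc-rej : ∀ t i → rej (state (suc t)) i ≡ rej (mid t n) i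
    state-suc-rej t i = trans (step-other (λ s → rej s i) (λ _ _ _ _ _ → refl) t (arrivals t (state t)))
      (cong (λ s → rej s i) (sym (mid-n t)))

    -- The flag of i is written only at the stage where i is considered, with the verdict computed
    -- from `sAt i`. This replaces the mutable flag by the time-independent predicate `rejected`, on
    -- which the whole analysis rests.
    rej-mid : ∀ t m → m ℕ.≤ n → ∀ i → rej (mid t m) i ≡ bef t m i ∧ rejected i
    rej-mid = arrival-induction P base arriving next
      where
      P : ℕ → ℕ → Set
      P t m = ∀ i → rej (mid t m) i ≡ bef t m i ∧ rejected i

      base : P 0 0
      base i = trans (cong (λ s → rej s i) (mid-zero 0)) (sym (cong (_∧ rejected i) (bef-zero 0 i)))

      next : ∀ t → P t n → P (suc t) 0
      next t ih i = trans (cong (λ s → rej s i) (mid-zero (suc t))) (trans (state-suc-rej t i)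
        (trans (ih i) (cong (_∧ rejected i) (bef-next t i))))

      arriving : ∀ t j → P t (toℕ j) → P t (suc (toℕ j))
      arriving t j ih i = trans (cong (λ s → rej s i) (mid-suc t j))
        (trans (astep-rej t (mid t (toℕ j)) j i) (arrived (r j ≡ᵇ t) refl (toℕ i ≡ᵇ toℕ j) refl))
        where
        arrived : ∀ b → (r j ≡ᵇ t) ≡ b → ∀ b' → (toℕ i ≡ᵇ toℕ j) ≡ b' →
          (if b then (if b' then rejectedIn t (mid t (toℕ j)) j else rej (mid t (toℕ j)) i) else rej (mid t (toℕ j)) i)
            ≡ bef t (suc (toℕ j)) i ∧ rejected i
        arrived false e b' _ = trans (ih i) (cong (_∧ rejected i) (sym (bef-step-idle t j i e)))
        arrived true e false e' = trans (ih i) (cong (_∧ rejected i) (sym (bef-step-≢ t j i (≡ᵇ-false⁻¹ {toℕ i} {toℕ j} e'))))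
        arrived true e true e' with refl ← FinP.toℕ-injective {i = i} {j} (≡ᵇ-true⁻¹ e') | refl ← ≡ᵇ-true⁻¹ {r j} {t} e =
          sym (cong (_∧ rejected i) (bef-self-after i))

    immRejected≡rejected : ∀ i → immRejected i ≡ rejected i
    immRejected≡rejected i = trans (cong (λ s → rej s i) (sym (mid-zero (suc (r i))))) (trans (rej-mid (suc (r i)) 0 ℕ.z≤n i)
      (cong (_∧ rejected i) (bef-< 0 i ℕP.≤-refl)))

    rej-updated : ∀ t i → rej (updated t) i ≡ (r i ≤ᵇ t) ∧ rejected i
    rej-updated t i = trans (update (arrivals t (state t)))
      (trans (cong (λ s → rej s i) (sym (mid-n t))) (trans (rej-mid t n ℕP.≤-refl i) (cong (_∧ rejected i) (bef-end t i))))
      where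
      update : ∀ s → rej (updateL t s) i ≡ rej s i
      update s = cong (λ s → rej s i) (proj₂ (updateL-only-inL t s))

  -- What happens in a time slot

  module Choice {n} (ρ : Fin n → ℚ) (act : Fin n → Bool) (σ : (Fin n → Bool) → Fin n) where

    cand : Fin n → Bool
    cand j = act j ∧ allB (λ j' → not (act j') ∨ (ρ j' ℚ.≤ᵇ ρ j)) (allFin n)

    choice : Maybe (Fin n)
    choice = if cand (σ cand) then just (σ cand) else firstTrue cand (allFin n)

    cand-true : ∀ {j} → cand j ≡ true → act j ≡ true × (∀ i → act i ≡ true → ρ i ≤ ρ j)
    cand-true {j} e = proj₁ (∧-true {act j} {allB (λ j' → not (act j') ∨ (ρ j' ℚ.≤ᵇ ρ j)) (allFin n)} e) , λ i Ai → ≤ᵇq-true⁻¹ (trans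
      (sym (cong (λ b → not b ∨ (ρ i ℚ.≤ᵇ ρ j)) Ai))
      (allB-true⁻¹ (λ j' → not (act j') ∨ (ρ j' ℚ.≤ᵇ ρ j)) {allFin n} (proj₂ (∧-true {act j} {allB (λ j' → not (act j') ∨ (ρ j' ℚ.≤ᵇ ρ j)) (allFin n)} e)) i (∈-allFin i)))

    cand-intro : ∀ {j} → act j ≡ true → (∀ i → act i ≡ true → ρ i ≤ ρ j) → cand j ≡ true
    cand-intro {j} Aj max = cong₂ _∧_ Aj (allB-true (λ j' → not (act j') ∨ (ρ j' ℚ.≤ᵇ ρ j)) {allFin n} (λ i _ → lemma i (act i) refl))
      where
      lemma : ∀ i b → act i ≡ b → not b ∨ (ρ i ℚ.≤ᵇ ρ j) ≡ true
      lemma i false _ = refl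
      lemma i true Ai = ≤ᵇq-true (max i Ai)

    choice-just : ∀ {h} → choice ≡ just h → act h ≡ true × (∀ i → act i ≡ true → ρ i ≤ ρ h)
    choice-just {h} e = cand-true (lemma (cand (σ cand)) refl e)
      where
      lemma : ∀ b → cand (σ cand) ≡ b → (if b then just (σ cand) else firstTrue cand (allFin n)) ≡ just h → cand h ≡ true
      lemma true C refl = C
      lemma false _ e = firstTrue-just cand (allFin n) e

    -- If some job were active, an active job of maximal density would exist by `argmax`; it would
    -- be a candidate, and the fallback search would find a candidate.
    choice-nothing : choice ≡ nothing → ∀ i → act i ≡ false
    choice-nothing e i = lemma (cand (σ cand)) e
      where
      lemma : ∀ b → (if b then just (σ cand) else firstTrue cand (allFin n)) ≡ nothing → act i ≡ false
      lemma false e with argmax act ρ (allFin n)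
      ... | inj₁ none = none i (∈-allFin i)
      ... | inj₂ (h , Ah , max) = ⊥-elim (false⇒¬T (firstTrue-nothing cand (allFin n) e h (∈-allFin h))
            (true⇒T (cand-intro Ah (λ j → max j (∈-allFin j)))))

  module Scheduling {n : ℕ} (k : ℕ) (I : Instance n) (sel : ℕ → (Fin n → Bool) → Fin n) where
    open Simulation k I sel

    act : ℕ → St n → Fin n → Bool
    act t s j = (r j ≤ᵇ t) ∧ (0 <ᵇ rem s j) ∧ not (rej s j)

    module C (t : ℕ) (s : St n) = Choice ρ (act t s) (sel t)

    decision : ℕ → St n → Maybe (Fin n)
    decision t s = if continues s then cur s else highest t s

    served : Maybe (Fin n) → (Fin n → ℕ) → Fin n → ℕ
    served nothing  m i = m i
    served (just c) m i = if toℕ i ≡ᵇ toℕ c then m i ∸ 1 else m i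

    rem-process : ∀ t s i → rem (process t s) i ≡ served (decision t s) (rem s) i
    rem-process t s i = go (continues s)
      where
      run : ∀ d u → rem (runIn d u s) i ≡ served d (rem s) i
      run nothing u = refl
      run (just c) u = refl

      go : ∀ b → rem (if b then runIn (cur s) (start s) s else runIn (highest t s) t s) i
        ≡ served (if b then cur s else highest t s) (rem s) i
      go true  = run (cur s) (start s)
      go false = run (highest t s) t

    cur-runIn : ∀ d u (s : St n) → cur (runIn d u s) ≡ d
    cur-runIn nothing u s = refl
    cur-runIn (just c) u s = refl

    start-runIn : ∀ d u (s : St n) → start (runIn d u s) ≡ u
    start-runIn nothing u s = refl
    start-runIn (just c) u s = refl

    cur-process : ∀ t s → cur (process t s) ≡ decision t s
    cur-process t s = go (continues s)
      where
      go : ∀ b → cur (if b then runIn (cur s) (start s) s else runIn (highest t s) t s)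
        ≡ (if b then cur s else highest t s)
      go true  = cur-runIn (cur s) (start s) s
      go false = cur-runIn (highest t s) t s

    start-process : ∀ t s → start (process t s) ≡ (if continues s then start s else t)
    start-process t s = go (continues s)
      where
      go : ∀ b → start (if b then runIn (cur s) (start s) s else runIn (highest t s) t s)
        ≡ (if b then start s else t)
      go true  = start-runIn (cur s) (start s) s
      go false = start-runIn (highest t s) t s

    continues-true : ∀ s → continues s ≡ true → ∃[ c ] (cur s ≡ just c × inL s c ≡ false × 0 ℕ.< rem s c)
    continues-true s e with cur s
    ... | just c = c , refl , not-true (proj₁ (∧-true {not (inL s c)} e)) , <ᵇ-true⁻¹ (proj₂ (∧-true {not (inL s c)} e))

    arrivedWeight : ℕ → ℕ → ℚ
    arrivedWeight u t = Σq jobs (λ j → ((u <ᵇ r j) ∧ (r j ≤ᵇ t)) ⊙ w j)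

    -- Contrapositive of rule (2): had the weight arrived since the start exceeded `w c * kq`, the
    -- update would have put c into L.
    updateL-keeps-out : ∀ t s c → cur s ≡ just c → inL (updateL t s) c ≡ false →
      arrivedWeight (start s) t ≤ w c * kq
    updateL-keeps-out t s c eq out with cur s
    updateL-keeps-out t s c refl out | just c = lemma
      (not (inL s c) ∧ ((w c ℚ.* kq) <ᵇq arrivedWeight (start s) t)) refl out
      where
      marked : St n
      marked = record s { inL = λ j → if toℕ j ≡ᵇ toℕ c then true else inL s j }

      lemma : ∀ b → not (inL s c) ∧ ((w c ℚ.* kq) <ᵇq arrivedWeight (start s) t) ≡ b →
        inL (if b then marked else s) c ≡ false → arrivedWeight (start s) t ≤ w c * kq
      lemma true _ out with () ← trans (sym out) (cong (λ b → if b then true else inL s c) (≡ᵇ-refl (toℕ c)))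
      lemma false e out = <ᵇq-false⁻¹ (trans (sym (cong (λ b → not b ∧ ((w c ℚ.* kq) <ᵇq arrivedWeight (start s) t)) out)) e)

    -- Opaque copies of the simulation states, for the same reason.
    abstract
      S V : ℕ → St n
      S = state
      V = updated

      S≡state : ∀ t → S t ≡ state t
      S≡state t = refl

      S-suc : ∀ t → S (suc t) ≡ process t (V t)
      S-suc t = refl

      rem-S-zero : ∀ i → rem (S 0) i ≡ p i
      rem-S-zero i = refl

      cur-S-zero : cur (S 0) ≡ nothing
      cur-S-zero = refl

      rem-V : ∀ t → rem (V t) ≡ rem (S t)
      rem-V = rem-updated

      cur-V : ∀ t → cur (V t) ≡ cur (S t)
      cur-V = cur-updated

      start-V : ∀ t → start (V t) ≡ start (S t)
      start-V = start-updated

      rej-V : ∀ t i → rej (V t) i ≡ (r i ≤ᵇ t) ∧ rejected i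
      rej-V = rej-updated

      light-V : ∀ t c → cur (S t) ≡ just c → inL (V t) c ≡ false → arrivedWeight (start (S t)) t ≤ w c * kq
      light-V t c eq out = subst (λ u → arrivedWeight u t ≤ w c * kq)
        (foldl-invariant start t (λ _ _ → refl) (state t) jobs)
        (updateL-keeps-out t (arrivals t (state t)) c
          (trans (foldl-invariant cur t (λ _ _ → refl) (state t) jobs) eq) out)

    -- Two times are needed: t for the remaining amounts and u for the releases. A job that runs
    -- uninterrupted was compared only with the jobs released by its start u; denser ones may have
    -- arrived since.
    Dominates : ℕ → ℕ → Fin n → Set
    Dominates t u h = ∀ i → r i ℕ.≤ u → rejected i ≡ false → 0 ℕ.< rem (S t) i → ρ i ≤ ρ h

    record Running (t : ℕ) (c : Fin n) : Set where
      field
        released   : r c ℕ.≤ start (S t)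
        started    : start (S t) ℕ.≤ t
        accepted   : rejected c ≡ false
        dominates  : Dominates t (start (S t)) c

    data Slot (t : ℕ) : Set where
      idle : (∀ i → r i ℕ.≤ t → rejected i ≡ false → rem (S t) i ≡ 0) →
        (∀ i → rem (S (suc t)) i ≡ rem (S t) i) → Slot t
      busy : ∀ h → r h ℕ.≤ t → rejected h ≡ false → 0 ℕ.< rem (S t) h →
        (∀ i → rem (S (suc t)) i ≡ (if toℕ i ≡ᵇ toℕ h then rem (S t) i ∸ 1 else rem (S t) i)) →
        Dominates t t h ⊎ (∃[ u ] (Dominates t u h × arrivedWeight u t ≤ w h * kq)) → Slot t

    rem-suc : ∀ t i → rem (S (suc t)) i ≡ served (decision t (V t)) (rem (S t)) i
    rem-suc t i = trans (cong (λ s → rem s i) (S-suc t)) (trans (rem-process t (V t) i)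
      (cong (λ m → served (decision t (V t)) m i) (rem-V t)))

    cur-suc : ∀ t → cur (S (suc t)) ≡ decision t (V t)
    cur-suc t = trans (cong cur (S-suc t)) (cur-process t (V t))

    start-suc : ∀ t → start (S (suc t)) ≡ (if continues (V t) then start (V t) else t)
    start-suc t = trans (cong start (S-suc t)) (start-process t (V t))

    rem-decreases : ∀ t i → rem (S (suc t)) i ℕ.≤ rem (S t) i
    rem-decreases t i = ℕP.≤-trans (ℕP.≤-reflexive (rem-suc t i)) (lemma (decision t (V t)) (rem (S t)))
      where
      lemma : ∀ d m → served d m i ℕ.≤ m i
      lemma nothing m = ℕP.≤-refl
      lemma (just c) m = if-elim (ℕ._≤ m i) (toℕ i ≡ᵇ toℕ c) (ℕP.m∸n≤m (m i) 1) ℕP.≤-refl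

    act-updated : ∀ t i → r i ℕ.≤ t → rejected i ≡ false → 0 ℕ.< rem (S t) i → act t (V t) i ≡ true
    act-updated t i ri acc 0<rem = cong₂ _∧_ (≤ᵇ-true ri) (cong₂ _∧_
      (<ᵇ-true (subst (λ m → 0 ℕ.< m i) (sym (rem-V t)) 0<rem))
      (cong not (trans (rej-V t i) (trans (cong ((r i ≤ᵇ t) ∧_) acc) (∧-false (r i ≤ᵇ t))))))
      where
      ∧-false : ∀ b → b ∧ false ≡ false
      ∧-false true  = refl
      ∧-false false = refl

    act-updated⁻¹ : ∀ t i → act t (V t) i ≡ true →
      r i ℕ.≤ t × rejected i ≡ false × 0 ℕ.< rem (S t) i
    act-updated⁻¹ t i e = ri , acc , subst (λ m → 0 ℕ.< m i) (rem-V t) (<ᵇ-true⁻¹ (proj₁ parts))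
      where
      ri : r i ℕ.≤ t
      ri = ≤ᵇ-true⁻¹ (proj₁ (∧-true {r i ≤ᵇ t} e))

      parts : (0 <ᵇ rem (V t) i) ≡ true × not (rej (V t) i) ≡ true
      parts = ∧-true {0 <ᵇ rem (V t) i} (proj₂ (∧-true {r i ≤ᵇ t} e))

      acc : rejected i ≡ false
      acc = trans (sym (trans (rej-V t i) (cong (_∧ rejected i) (≤ᵇ-true ri)))) (not-true (proj₂ parts))

    data Decision (t : ℕ) : Maybe (Fin n) → ℕ → Set where
      none     : (∀ i → act t (V t) i ≡ false) → Decision t nothing t
      chosen   : ∀ h → act t (V t) h ≡ true → (∀ i → act t (V t) i ≡ true → ρ i ≤ ρ h) → Decision t (just h) t
      continue : ∀ h → cur (S t) ≡ just h → 0 ℕ.< rem (S t) h →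
        arrivedWeight (start (S t)) t ≤ w h * kq → Decision t (just h) (start (S t))

    decide : ∀ t → Decision t (decision t (V t)) (if continues (V t) then start (V t) else t)
    decide t = go (continues (V t)) refl
      where
      s = V t

      choose : ∀ d → highest t s ≡ d → Decision t d t
      choose nothing e = none (C.choice-nothing t s e)
      choose (just h) e = chosen h (proj₁ (C.choice-just t s e)) (proj₂ (C.choice-just t s e))

      go : ∀ b → continues s ≡ b → Decision t (if b then cur s else highest t s) (if b then start s else t)
      go false e = choose (highest t s) refl
      go true e with continues-true s e
      ... | c , eq , out , 0<rem = subst₂ (Decision t) (sym eq) (sym (start-V t))
        (continue c curₜ (subst (λ m → 0 ℕ.< m c) (rem-V t) 0<rem) (light-V t c curₜ out))
        where
        curₜ : cur (S t) ≡ just c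
        curₜ = trans (sym (cur-V t)) eq

    dominates-next : ∀ t u h → Dominates t u h → Dominates (suc t) u h
    dominates-next t u h dom i ri acc 0<rem = dom i ri acc (ℕP.≤-trans 0<rem (rem-decreases t i))

    -- The current job was densest among the accepted pending jobs when it was chosen. Afterwards
    -- remaining amounts only shrink, so no job released by then can become a denser competitor, and
    -- the comparison made at the start stays valid.
    running : ∀ t c → cur (S t) ≡ just c → Running t c
    running zero c eq with () ← trans (sym cur-S-zero) eq
    running (suc t) c eq = go (decide t) (trans (sym (cur-suc t)) eq) (start-suc t)
      where
      build : ∀ u → start (S (suc t)) ≡ u → r c ℕ.≤ u → u ℕ.≤ t → rejected c ≡ false → Dominates t u c → Running (suc t) c
      build u refl rc ut acc dom = record
        { released = rc ; started = ℕP.m≤n⇒m≤1+n ut ; accepted = acc ; dominates = dominates-next t _ c dom }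

      go : ∀ {d u} → Decision t d u → d ≡ just c → start (S (suc t)) ≡ u → Running (suc t) c
      go (chosen h Ah max) refl e with act-updated⁻¹ t h Ah
      ... | rh , acc , _ = build t e rh ℕP.≤-refl acc (λ i ri ai 0<rem → max i (act-updated t i ri ai 0<rem))
      go (continue h eq' 0<rem light) refl e = build (start (S t)) e released started accepted dominates
        where open Running (running t h eq')

    slot-from : ∀ t {d u} → Decision t d u → (∀ i → rem (S (suc t)) i ≡ served d (rem (S t)) i) → Slot t
    slot-from t (none h) next = idle (λ i ri acc → ℕP.n≤0⇒n≡0 (ℕP.≮⇒≥ (λ 0<rem →
      false⇒¬T (h i) (true⇒T (act-updated t i ri acc 0<rem))))) next
    slot-from t (chosen h Ah max) next = busy h (proj₁ facts) (proj₁ (proj₂ facts)) (proj₂ (proj₂ facts)) next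
      (inj₁ (λ i ri ai 0<rem → max i (act-updated t i ri ai 0<rem)))
      where
      facts : r h ℕ.≤ t × rejected h ≡ false × 0 ℕ.< rem (S t) h
      facts = act-updated⁻¹ t h Ah
    slot-from t (continue h eq 0<rem light) next = busy h (ℕP.≤-trans released started) accepted 0<rem next
      (inj₂ (start (S t) , dominates , light))
      where open Running (running t h eq)

    slot : ∀ t → Slot t
    slot t = slot-from t (decide t) (rem-suc t)

    rem-unreleased : ∀ t i → t ℕ.≤ r i → rem (S t) i ≡ p i
    rem-unreleased zero i _ = rem-S-zero i
    rem-unreleased (suc t) i t<r = trans (same (slot t)) (rem-unreleased t i (ℕP.<⇒≤ t<r))
      where
      same : Slot t → rem (S (suc t)) i ≡ rem (S t) i
      same (idle _ next) = next i
      same (busy h rh _ _ next _) = trans (next i)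
        (cong (λ b → if b then rem (S t) i ∸ 1 else rem (S t) i) (≡ᵇ-false i≢h))
        where
        i≢h : toℕ i ≢ toℕ h
        i≢h e = ℕP.<⇒≱ t<r (subst (λ i → r i ℕ.≤ t) (sym (FinP.toℕ-injective {i = i} {h} e)) rh)

    rem≤p : ∀ t i → rem (S t) i ℕ.≤ p i
    rem≤p zero i = ℕP.≤-reflexive (rem-S-zero i)
    rem≤p (suc t) i = ℕP.≤-trans (rem-decreases t i) (rem≤p t i)

  -- Potential-function bound on the flow of a run

  module Order {n} (r : Fin n → ℕ) where

    -- The order in which jobs are considered. It agrees by computation with `bef (r j) (toℕ j) i`,
    -- so the delays defined from it range over the same jobs as the rejection rule does.
    before : Fin n → Fin n → Bool
    before i j = (r i <ᵇ r j) ∨ ((r i ≡ᵇ r j) ∧ (toℕ i <ᵇ toℕ j))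

    before-< : ∀ {i j} → r i ℕ.< r j → before i j ≡ true
    before-< {i} {j} h rewrite <ᵇ-true {r i} {r j} h = refl

    before-≡ : ∀ {i j} → r i ≡ r j → before i j ≡ (toℕ i <ᵇ toℕ j)
    before-≡ {i} {j} e rewrite <ᵇ-false {r i} {r j} (ℕP.≤-reflexive (sym e)) | e | ≡ᵇ-refl (r j) = refl

    before-> : ∀ {i j} → r j ℕ.< r i → before i j ≡ false
    before-> {i} {j} h rewrite <ᵇ-false {r i} {r j} (ℕP.<⇒≤ h) | ≡ᵇ-false {r i} {r j} (λ e → ℕP.<⇒≢ h (sym e)) = refl

    before-irrefl : ∀ i → before i i ≡ false
    before-irrefl i = trans (before-≡ {i} {i} refl) (<ᵇ-false {toℕ i} {toℕ i} ℕP.≤-refl)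

    before⇒≤ : ∀ {i j} → before i j ≡ true → r i ℕ.≤ r j
    before⇒≤ {i} {j} e = ℕP.≮⇒≥ (λ h → false⇒¬T (before-> {i} {j} h) (true⇒T e))

    before-total : ∀ i j (x : ℚ) → before i j ⊙ x + before j i ⊙ x + (i ≡ᵇF j) ⊙ x ≡ x
    before-total i j x = go (ℕP.<-cmp (r i) (r j))
      where
      combine : ∀ {a b c} → before i j ≡ a → before j i ≡ b → (i ≡ᵇF j) ≡ c →
        before i j ⊙ x + before j i ⊙ x + (i ≡ᵇF j) ⊙ x ≡ a ⊙ x + b ⊙ x + c ⊙ x
      combine refl refl refl = refl

      1st : x + 0ℚ + 0ℚ ≡ x
      1st = trans (+-identityʳ _) (+-identityʳ x)

      2nd : 0ℚ + x + 0ℚ ≡ x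
      2nd = trans (+-identityʳ _) (+-identityˡ x)

      3rd : 0ℚ + 0ℚ + x ≡ x
      3rd = +-identityˡ x

      distinct : r i ≢ r j → toℕ i ≢ toℕ j
      distinct ne e = ne (cong r (FinP.toℕ-injective {i = i} {j} e))

      go : _ → _
      go (tri< lt ne _) = trans (combine (before-< {i} {j} lt) (before-> {j} {i} lt) (≡ᵇ-false (distinct ne))) 1st
      go (tri> _ ne gt) = trans (combine (before-> {i} {j} gt) (before-< {j} {i} gt) (≡ᵇ-false (distinct ne))) 2nd
      go (tri≈ _ eq _) = tie (ℕP.<-cmp (toℕ i) (toℕ j))
        where
        tie : _ → _
        tie (tri< lt ne _) = trans (combine (trans (before-≡ {i} {j} eq) (<ᵇ-true lt))
          (trans (before-≡ {j} {i} (sym eq)) (<ᵇ-false (ℕP.<⇒≤ lt))) (≡ᵇ-false ne)) 1st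
        tie (tri> _ ne gt) = trans (combine (trans (before-≡ {i} {j} eq) (<ᵇ-false (ℕP.<⇒≤ gt)))
          (trans (before-≡ {j} {i} (sym eq)) (<ᵇ-true gt)) (≡ᵇ-false ne)) 2nd
        tie (tri≈ _ e _) = trans (combine (trans (before-≡ {i} {j} eq) (<ᵇ-false (ℕP.≤-reflexive (sym e))))
          (trans (before-≡ {j} {i} (sym eq)) (<ᵇ-false (ℕP.≤-reflexive e)))
          (trans (cong (_≡ᵇ toℕ j) e) (≡ᵇ-refl (toℕ j)))) 3rd

  -- One slot of a single-machine run with remaining processing times q: the machine idles only if no accepted
  -- job is pending, and the denser work pending behind the served job h weighs at most K * w h.
  data RunSlot {n : ℕ} (r : Fin n → ℕ) (ρ w : Fin n → ℚ) (K : ℚ) (acc : Fin n → Bool) (q : ℕ → Fin n → ℚ) (t : ℕ) : Set where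
    idle : (∀ i → r i ℕ.≤ t → acc i ≡ true → q t i ≡ 0ℚ) → (∀ i → q (suc t) i ≡ q t i) → RunSlot r ρ w K acc q t
    busy : ∀ h → r h ℕ.≤ t → acc h ≡ true →
      (∀ i → q (suc t) i ≡ q t i - (i ≡ᵇF h) ⊙ 1ℚ) →
      Σq (allFin n) (λ i → (acc i ∧ (r i ≤ᵇ t)) ⊙ (ρ h <ᵇq ρ i) ⊙ (ρ i * q t i)) ≤ K * w h →
      RunSlot r ρ w K acc q t

  -- All that the potential and the backlog arguments need from the algorithm. The rejection rule is
  -- present only as an arbitrary predicate `acc`, and the set L only through the bound K * w h of
  -- `RunSlot`.
  record Run {n : ℕ} (r : Fin n → ℕ) (ρ P w : Fin n → ℚ) (K : ℚ) (acc : Fin n → Bool) (q : ℕ → Fin n → ℚ) : Set where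
    field
      0<ρ          : ∀ i → 0ℚ < ρ i
      1≤P          : ∀ i → 1ℚ ≤ P i
      w≡ρP         : ∀ i → w i ≡ ρ i * P i
      0≤K          : 0ℚ ≤ K
      q-nonneg     : ∀ t i → 0ℚ ≤ q t i
      q-unreleased : ∀ t i → t ℕ.≤ r i → q t i ≡ P i
      slot         : ∀ t → RunSlot r ρ w K acc q t

  module RunBounds {n : ℕ} {r : Fin n → ℕ} {ρ P w : Fin n → ℚ} {K : ℚ} {acc : Fin n → Bool} {q : ℕ → Fin n → ℚ}
    (run : Run r ρ P w K acc q) where
    open Run run public
    open Order r public

    jobs : List (Fin n)
    jobs = allFin n

    0≤ρ : ∀ i → 0ℚ ≤ ρ i
    0≤ρ i = <⇒≤ (0<ρ i)

    0≤P : ∀ i → 0ℚ ≤ P i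
    0≤P i = ≤-trans 0≤1ℚ (1≤P i)

    0≤w : ∀ i → 0ℚ ≤ w i
    0≤w i = subst (0ℚ ≤_) (sym (w≡ρP i)) (*-nonneg (0≤ρ i) (0≤P i))

    m : Fin n → Fin n → ℚ
    m i j = ρ i ⊓ ρ j

    m≤ρˡ : ∀ i j → m i j ≤ ρ i
    m≤ρˡ i j = p⊓q≤p (ρ i) (ρ j)

    m≤ρʳ : ∀ i j → m i j ≤ ρ j
    m≤ρʳ i j = p⊓q≤q (ρ i) (ρ j)

    0≤m : ∀ i j → 0ℚ ≤ m i j
    0≤m i j = ⊓-glb (0≤ρ i) (0≤ρ j)

    W : ℕ → ℚ
    W t = Σq jobs (λ i → (acc i ∧ (r i ≤ᵇ t)) ⊙ (ρ i * q t i))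

    delay : Fin n → ℚ
    delay j = Σq jobs (λ i → (before i j ∧ acc i) ⊙ (m i j * q (r j) i))

    Ahead : (Fin n → ℚ) → Fin n → ℚ
    Ahead x j = Σq jobs (λ i → before i j ⊙ (m i j * x i))

    -- Each pair is charged to its later member, so an arrival adds a single new term. The second
    -- summand is ρ_j (1 + ... + x_j), the cost of the job running alone; its linear part makes one
    -- served unit lower it by exactly ρ_j x_j.
    cost : (Fin n → ℚ) → Fin n → ℚ
    cost x j = x j * Ahead x j + ½ * ρ j * (x j * x j + x j)

    Φ : (Fin n → ℚ) → ℚ
    Φ x = Σq jobs (cost x)

    -- Remaining amounts of the accepted jobs at time t, just before (`u`) and just after (`v`) the
    -- arrivals of that time.
    u v : ℕ → Fin n → ℚ
    u t i = (acc i ∧ (r i <ᵇ t)) ⊙ q t i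
    v t i = (acc i ∧ (r i ≤ᵇ t)) ⊙ q t i

    Φ-nonneg : ∀ x → (∀ i → 0ℚ ≤ x i) → 0ℚ ≤ Φ x
    Φ-nonneg x 0≤x = Σ-nonneg jobs (λ j → +-nonneg
      (*-nonneg (0≤x j) (Σ-nonneg jobs (λ i → ⊙-nonneg (before i j) (*-nonneg (0≤m i j) (0≤x i)))))
      (*-nonneg (*-nonneg 0≤½ (0≤ρ j)) (+-nonneg (*-nonneg (0≤x j) (0≤x j)) (0≤x j))))

    charge : Fin n → ℚ
    charge j = P j * delay j + w j * P j

    delay-nonneg : ∀ j → 0ℚ ≤ delay j
    delay-nonneg j = Σ-nonneg jobs (λ i → ⊙-nonneg (before i j ∧ acc i) (*-nonneg (0≤m i j) (q-nonneg (r j) i)))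

    charge-nonneg : ∀ j → 0ℚ ≤ charge j
    charge-nonneg j = +-nonneg (*-nonneg (0≤P j) (delay-nonneg j)) (*-nonneg (0≤w j) (0≤P j))

    cost-zero : ∀ x j → x j ≡ 0ℚ → cost x j ≡ 0ℚ
    cost-zero x j e = trans (cong (λ y → y * Ahead x j + ½ * ρ j * (y * y + y)) e) (identity (Ahead x j) (½ * ρ j))
      where
      identity : ∀ a b → 0ℚ * a + b * (0ℚ * 0ℚ + 0ℚ) ≡ 0ℚ
      identity = solve-∀ ℚ-ring

    Φ-cong : ∀ {x y} → (∀ i → x i ≡ y i) → Φ x ≡ Φ y
    Φ-cong h = Σ-cong jobs (λ j → cong₂ (λ a b → a * b + ½ * ρ j * (a * a + a)) (h j)
      (Σ-cong jobs (λ i → cong (λ a → before i j ⊙ (m i j * a)) (h i))))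

    released-now : ∀ t → ℚ
    released-now t = Σq jobs (λ j → (r j ≡ᵇ t) ⊙ (acc j ⊙ charge j))

    -- The terms of older jobs look only at their predecessors, which are older still, and do not
    -- change. A newcomer adds P_j times its delay plus ρ_j (P_j² + P_j) / 2, and the latter is at
    -- most w_j P_j because 1 ≤ P_j.
    Φ-arrival : ∀ t → Φ (v t) ≤ Φ (u t) + released-now t
    Φ-arrival t = Σ-≤-+ jobs (cost (u t)) (λ j → (r j ≡ᵇ t) ⊙ (acc j ⊙ charge j)) bound
      where
      same : ∀ i → r i ℕ.< t → v t i ≡ u t i
      same i h = cong (λ b → (acc i ∧ b) ⊙ q t i) (trans (≤ᵇ-true (ℕP.<⇒≤ h)) (sym (<ᵇ-true h)))

      at-most : ∀ j c → cost (v t) j ≤ cost (u t) j → 0ℚ ≤ c → cost (v t) j ≤ cost (u t) j + c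
      at-most j c h 0≤c = ≤-trans h (≤-slack c 0≤c refl)

      0≤extra : ∀ j → 0ℚ ≤ (r j ≡ᵇ t) ⊙ (acc j ⊙ charge j)
      0≤extra j = ⊙-nonneg (r j ≡ᵇ t) (⊙-nonneg (acc j) (charge-nonneg j))

      u-zero : ∀ j → t ℕ.≤ r j → u t j ≡ 0ℚ
      u-zero j h = trans (cong (λ b → (acc j ∧ b) ⊙ q t j) (<ᵇ-false h)) (lemma (acc j))
        where
        lemma : ∀ b → (b ∧ false) ⊙ q t j ≡ 0ℚ
        lemma true  = refl
        lemma false = refl

      both-zero : ∀ j → v t j ≡ 0ℚ → u t j ≡ 0ℚ → cost (v t) j ≤ cost (u t) j
      both-zero j ev eu = ≤-reflexive (trans (cost-zero (v t) j ev) (sym (cost-zero (u t) j eu)))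

      bound : ∀ j → cost (v t) j ≤ cost (u t) j + (r j ≡ᵇ t) ⊙ (acc j ⊙ charge j)
      bound j = go (ℕP.<-cmp (r j) t)
        where
        arriving : ∀ a → acc j ≡ a → r j ≡ t → cost (v t) j ≤ a ⊙ charge j
        arriving false e _ = ≤-reflexive (cost-zero (v t) j (cong (λ b → (b ∧ (r j ≤ᵇ t)) ⊙ q t j) e))
        arriving true e refl = subst₂ _≤_
            (sym (cong₂ (λ a b → a * b + ½ * ρ j * (a * a + a)) full ahead)) (cong (P j * delay j +_) (cong (_* P j) (sym (w≡ρP j))))
            (≤-slack (½ * ρ j * P j * (P j - 1ℚ))
              (*-nonneg (*-nonneg (*-nonneg 0≤½ (0≤ρ j)) (0≤P j)) (p≤q⇒0≤q-p (1≤P j)))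
              (trans (cong (λ z → P j * delay j + z) (sym (*-identityˡ (ρ j * P j * P j)))) (identity (P j) (delay j) (ρ j))))
          where
          full : v (r j) j ≡ P j
          full = trans (cong₂ (λ a b → (a ∧ b) ⊙ q (r j) j) e (≤ᵇ-true (ℕP.≤-refl {r j}))) (q-unreleased (r j) j ℕP.≤-refl)

          ahead : Ahead (v (r j)) j ≡ delay j
          ahead = Σ-cong jobs (λ i → trans (⊙-cong (before i j) (λ e' →
            trans (cong (λ b → m i j * (acc i ∧ b) ⊙ q (r j) i) (≤ᵇ-true (before⇒≤ {i} {j} e')))
              (shift (acc i) (m i j) (q (r j) i)))) (sym (⊙-∧ (before i j) (acc i) _)))
            where
            shift : ∀ a x y → x * (a ∧ true) ⊙ y ≡ a ⊙ (x * y)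
            shift true  x y = refl
            shift false x y = *-zeroʳ x

          identity : ∀ a d s → a * d + (½ + ½) * (s * a * a) ≡ a * d + ½ * s * (a * a + a) + ½ * s * a * (a - 1ℚ)
          identity = solve-∀ ℚ-ring

        go : _ → _
        go (tri< lt _ _) = at-most j _ (≤-reflexive (cong₂ (λ a b → a * b + ½ * ρ j * (a * a + a)) (same j lt)
          (Σ-cong jobs (λ i → ⊙-cong (before i j) (λ e → cong (m i j *_) (same i (ℕP.≤-<-trans (before⇒≤ {i} {j} e) lt))))))) (0≤extra j)
        go (tri> _ _ gt) = at-most j _ (both-zero j (v-zero (acc j)) (u-zero j (ℕP.<⇒≤ gt))) (0≤extra j)
          where
          v-zero : ∀ a → (a ∧ (r j ≤ᵇ t)) ⊙ q t j ≡ 0ℚ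
          v-zero true  = cong (_⊙ q t j) (≤ᵇ-false gt)
          v-zero false = refl
        go (tri≈ _ eq _) = ≤-trans (arriving (acc j) refl eq) (≤-reflexive
          (trans (cong (_⊙ (acc j ⊙ charge j)) (sym (trans (cong (_≡ᵇ t) eq) (≡ᵇ-refl t))))
            (trans (sym (+-identityˡ _)) (cong (_+ (r j ≡ᵇ t) ⊙ (acc j ⊙ charge j))
              (sym (cost-zero (u t) j (u-zero j (ℕP.≤-reflexive (sym eq)))))))))

    -- An exact identity, since Φ is quadratic: removing one unit of h costs row and column of h in
    -- the matrix `m`, and the diagonal contributes exactly ρ_h x_h.
    Φ-serve : ∀ x h → Φ (λ i → x i - (i ≡ᵇF h) ⊙ 1ℚ) + Σq jobs (λ i → m i h * x i) ≡ Φ x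
    Φ-serve x h = trans (cong (_+ Σq jobs (λ i → m i h * x i)) (trans (Σ-cong jobs expand)
        (trans (Σ-minus jobs (cost x) loss) (cong (λ z → Φ x - z) total))))
        (cancel (Φ x) (Σq jobs (λ i → m i h * x i)))
      where
      δ : Fin n → ℚ
      δ i = (i ≡ᵇF h) ⊙ 1ℚ

      cancel : ∀ a b → a - b + b ≡ a
      cancel = solve-∀ ℚ-ring

      gap : Fin n → ℚ
      gap j = before h j ⊙ m h j

      -- The summands are the jobs before h, the jobs after h, and h itself; `before-total` merges
      -- the three into one sum over all jobs.
      loss : Fin n → ℚ
      loss j = (j ≡ᵇF h) ⊙ Ahead x j + x j * gap j + (j ≡ᵇF h) ⊙ (ρ j * x j)

      ahead-δ : ∀ j → Ahead (λ i → x i - δ i) j ≡ Ahead x j - gap j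
      ahead-δ j = trans (Σ-cong jobs (λ i → pointwise i (i ≡ᵇF h) (before i j)))
        (trans (Σ-minus jobs (λ i → before i j ⊙ (m i j * x i)) (λ i → (i ≡ᵇF h) ⊙ (before i j ⊙ m i j)))
          (cong (λ z → Ahead x j - z) (Σ-single h (λ i → before i j ⊙ m i j))))
        where
        id₁ : ∀ a b → a * (b - 1ℚ) ≡ a * b - a
        id₁ = solve-∀ ℚ-ring
        id₂ : ∀ a b → a * (b - 0ℚ) ≡ a * b - 0ℚ
        id₂ = solve-∀ ℚ-ring

        pointwise : ∀ i d b → b ⊙ (m i j * (x i - d ⊙ 1ℚ)) ≡ b ⊙ (m i j * x i) - d ⊙ (b ⊙ m i j)
        pointwise i true  true  = id₁ (m i j) (x i)
        pointwise i false true  = id₂ (m i j) (x i)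
        pointwise i true  false = refl
        pointwise i false false = refl

      expand : ∀ j → cost (λ i → x i - δ i) j ≡ cost x j - loss j
      expand j = trans (cong (λ a → (x j - δ j) * a + ½ * ρ j * ((x j - δ j) * (x j - δ j) + (x j - δ j))) (ahead-δ j))
        (go (j ≡ᵇF h) refl)
        where
        id₁ : ∀ y a s → (y - 1ℚ) * (a - 0ℚ) + ½ * s * ((y - 1ℚ) * (y - 1ℚ) + (y - 1ℚ))
          ≡ y * a + ½ * s * (y * y + y) - (a + y * 0ℚ + s * y)
        id₁ = solve-∀ ℚ-ring
        id₂ : ∀ y a s g → (y - 0ℚ) * (a - g) + ½ * s * ((y - 0ℚ) * (y - 0ℚ) + (y - 0ℚ))
          ≡ y * a + ½ * s * (y * y + y) - (0ℚ + y * g + 0ℚ)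
        id₂ = solve-∀ ℚ-ring

        no-gap : (j ≡ᵇF h) ≡ true → gap j ≡ 0ℚ
        no-gap e = cong (_⊙ m h j) (trans (cong (before h) (FinP.toℕ-injective {i = j} {h} (≡ᵇ-true⁻¹ e))) (before-irrefl h))

        go : ∀ b → (j ≡ᵇF h) ≡ b →
          (x j - b ⊙ 1ℚ) * (Ahead x j - gap j) + ½ * ρ j * ((x j - b ⊙ 1ℚ) * (x j - b ⊙ 1ℚ) + (x j - b ⊙ 1ℚ))
            ≡ cost x j - (b ⊙ Ahead x j + x j * gap j + b ⊙ (ρ j * x j))
        go false e = id₂ (x j) (Ahead x j) (ρ j) (gap j)
        go true e = trans (cong (λ g → (x j - 1ℚ) * (Ahead x j - g) + ½ * ρ j * ((x j - 1ℚ) * (x j - 1ℚ) + (x j - 1ℚ))) (no-gap e))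
          (trans (id₁ (x j) (Ahead x j) (ρ j)) (cong (λ g → cost x j - (Ahead x j + x j * g + ρ j * x j)) (sym (no-gap e))))

      total : Σq jobs loss ≡ Σq jobs (λ i → m i h * x i)
      total = trans (Σ-+ jobs (λ j → (j ≡ᵇF h) ⊙ Ahead x j + x j * gap j) (λ j → (j ≡ᵇF h) ⊙ (ρ j * x j)))
        (trans (cong (_+ Σq jobs (λ j → (j ≡ᵇF h) ⊙ (ρ j * x j)))
          (trans (Σ-+ jobs (λ j → (j ≡ᵇF h) ⊙ Ahead x j) (λ j → x j * gap j))
            (cong (_+ Σq jobs (λ j → x j * gap j)) (Σ-single h (Ahead x)))))
        (trans (cong (_+ Σq jobs (λ j → (j ≡ᵇF h) ⊙ (ρ j * x j))) (sym (Σ-+ jobs _ _)))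
        (trans (sym (Σ-+ jobs _ _)) (Σ-cong jobs (λ i → trans
          (cong₂ (λ a b → before i h ⊙ (m i h * x i) + a + b) (swap i) (diagonal i))
          (before-total i h (m i h * x i)))))))
        where
        shift : ∀ b x y z → y ≡ z → x * b ⊙ y ≡ b ⊙ (z * x)
        shift true  x y z e = trans (cong (x *_) e) (*-comm x z)
        shift false x y z e = *-zeroʳ x

        swap : ∀ i → x i * gap i ≡ before h i ⊙ (m i h * x i)
        swap i = shift (before h i) (x i) (m h i) (m i h) (⊓-comm (ρ h) (ρ i))

        diagonal : ∀ i → (i ≡ᵇF h) ⊙ (ρ i * x i) ≡ (i ≡ᵇF h) ⊙ (m i h * x i)
        diagonal i = ⊙-cong (i ≡ᵇF h) (λ e → cong (_* x i)
          (sym (trans (cong (λ j → ρ i ⊓ ρ j) (sym (FinP.toℕ-injective {i = i} {h} (≡ᵇ-true⁻¹ e)))) (⊓-idem (ρ i)))))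

    -- A reserve of K * w h for every unit of h still to be processed. The slot that processes the
    -- unit releases exactly the amount by which denser work waiting behind h may outweigh what Φ
    -- pays.
    Ω : ℕ → ℚ
    Ω t = K * Σq jobs (λ i → w i * q t i)

    Ω-nonneg : ∀ t → 0ℚ ≤ Ω t
    Ω-nonneg t = *-nonneg 0≤K (Σ-nonneg jobs (λ i → *-nonneg (0≤w i) (q-nonneg t i)))

    u-next : ∀ t h → r h ℕ.≤ t → acc h ≡ true → (∀ i → q (suc t) i ≡ q t i - (i ≡ᵇF h) ⊙ 1ℚ) →
      ∀ i → u (suc t) i ≡ v t i - (i ≡ᵇF h) ⊙ 1ℚ
    u-next t h rh acch next i = trans (cong (λ b → (acc i ∧ b) ⊙ q (suc t) i) (sym (≤ᵇ≡<ᵇsuc (r i) t)))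
      (go (acc i ∧ (r i ≤ᵇ t)) (i ≡ᵇF h) refl refl)
      where
      go : ∀ b d → (acc i ∧ (r i ≤ᵇ t)) ≡ b → (i ≡ᵇF h) ≡ d → b ⊙ q (suc t) i ≡ b ⊙ q t i - d ⊙ 1ℚ
      go true d _ e = trans (next i) (cong (λ d → q t i - d ⊙ 1ℚ) e)
      go false false _ _ = refl
      go false true e e' with () ← trans (sym e) (trans (cong (λ j → acc j ∧ (r j ≤ᵇ t))
        (FinP.toℕ-injective {i = i} {h} (≡ᵇ-true⁻¹ e'))) (cong₂ _∧_ acch (≤ᵇ-true rh)))

    -- For a job not denser than h the minimum of the densities is its own, so the drop of Φ covers
    -- its whole pending weight. Only the strictly denser jobs have to be added.
    W-≤ : ∀ t h → W t ≤ Σq jobs (λ i → m i h * v t i)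
      + Σq jobs (λ i → (acc i ∧ (r i ≤ᵇ t)) ⊙ (ρ h <ᵇq ρ i) ⊙ (ρ i * q t i))
    W-≤ t h = Σ-≤-+ jobs _ _ (λ i → pointwise i (acc i ∧ (r i ≤ᵇ t)) (ρ h <ᵇq ρ i) refl)
      where
      pointwise : ∀ i b d → (ρ h <ᵇq ρ i) ≡ d → b ⊙ (ρ i * q t i) ≤ m i h * b ⊙ q t i + b ⊙ d ⊙ (ρ i * q t i)
      pointwise i false d _ = ≤-reflexive (sym (trans (+-identityʳ _) (*-zeroʳ (m i h))))
      pointwise i true true _ = ≤-slack (m i h * q t i) (*-nonneg (0≤m i h) (q-nonneg t i)) (+-comm (m i h * q t i) _)
      pointwise i true false e = ≤-reflexive (trans (cong (_* q t i) (sym (p≤q⇒p⊓q≡p {ρ i} {ρ h} (<ᵇq-false⁻¹ {ρ h} {ρ i} e)))) (sym (+-identityʳ (m i h * q t i))))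

    Φ-slot : ∀ t → Φ (u (suc t)) + W t + Ω (suc t) ≤ Φ (v t) + Ω t
    Φ-slot t = go (slot t)
      where
      go : RunSlot r ρ w K acc q t → Φ (u (suc t)) + W t + Ω (suc t) ≤ Φ (v t) + Ω t
      go (idle done next) = ≤-reflexive (cong₂ _+_
        (trans (cong₂ _+_ (Φ-cong {u (suc t)} {v t} (λ i → cong₂ (λ b x → (acc i ∧ b) ⊙ x) (sym (≤ᵇ≡<ᵇsuc (r i) t)) (next i))) W-zero) (+-identityʳ (Φ (v t))))
        (cong (K *_) (Σ-cong jobs (λ i → cong (w i *_) (next i)))))
        where
        W-zero : W t ≡ 0ℚ
        W-zero = trans (Σ-cong jobs (λ i → ⊙-zero (acc i ∧ (r i ≤ᵇ t)) (λ e →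
          trans (cong (ρ i *_) (done i (≤ᵇ-true⁻¹ (proj₂ (∧-true {acc i} e))) (proj₁ (∧-true {acc i} e)))) (*-zeroʳ (ρ i)))))
          (Σ-zero jobs)
          where
          ⊙-zero : ∀ b {x} → (b ≡ true → x ≡ 0ℚ) → b ⊙ x ≡ 0ℚ
          ⊙-zero true  h = h refl
          ⊙-zero false h = refl
      go (busy h rh acch next late) = ≤-trans
        (+-monoˡ-≤ (Ω (suc t)) (+-monoʳ-≤ (Φ (u (suc t))) (≤-trans (W-≤ t h) (+-monoʳ-≤ M late))))
        (≤-reflexive (trans (cong₂ (λ a b → a + (M + K * w h) + b) (Φ-cong (u-next t h rh acch next)) Ω-next)
          (trans (rearrange (Φ (λ i → v t i - (i ≡ᵇF h) ⊙ 1ℚ)) M (K * w h) (Ω t)) (cong (_+ Ω t) (Φ-serve (v t) h)))))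
        where
        M : ℚ
        M = Σq jobs (λ i → m i h * v t i)

        rearrange : ∀ a b c d → a + (b + c) + (d - c) ≡ a + b + d
        rearrange = solve-∀ ℚ-ring

        Ω-next : Ω (suc t) ≡ Ω t - K * w h
        Ω-next = trans (cong (K *_) (trans (Σ-cong jobs (λ i → trans (cong (w i *_) (next i)) (shift (w i) (q t i) (i ≡ᵇF h))))
            (trans (Σ-minus jobs (λ i → w i * q t i) (λ i → (i ≡ᵇF h) ⊙ w i)) (cong (λ z → Σq jobs (λ i → w i * q t i) - z) (Σ-single h w)))))
          (distrib K (Σq jobs (λ i → w i * q t i)) (w h))
          where
          distrib : ∀ k a b → k * (a - b) ≡ k * a - k * b
          distrib = solve-∀ ℚ-ring
          id₁ : ∀ a b → a * (b - 1ℚ) ≡ a * b - a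
          id₁ = solve-∀ ℚ-ring
          id₂ : ∀ a b → a * (b - 0ℚ) ≡ a * b - 0ℚ
          id₂ = solve-∀ ℚ-ring
          shift : ∀ a b d → a * (b - d ⊙ 1ℚ) ≡ a * b - d ⊙ a
          shift a b true  = id₁ a b
          shift a b false = id₂ a b

    Φ-history : ∀ H → Φ (u H) + Ω H + Σq (upTo H) W ≤ Ω 0 + Σq (upTo H) released-now
    Φ-history zero = +-monoˡ-≤ 0ℚ (≤-reflexive (trans (cong (_+ Ω 0) (trans (Σ-cong jobs (λ j → cost-zero (u 0) j (u-zero j (acc j))))
      (Σ-zero jobs))) (+-identityˡ (Ω 0))))
      where
      u-zero : ∀ j a → (a ∧ false) ⊙ q 0 j ≡ 0ℚ
      u-zero j true  = refl
      u-zero j false = refl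
    Φ-history (suc H) = begin
      Φ (u (suc H)) + Ω (suc H) + Σq (upTo (suc H)) W ≡⟨ cong (Φ (u (suc H)) + Ω (suc H) +_) (Σ-upTo-suc H W) ⟩
      Φ (u (suc H)) + Ω (suc H) + (Σq (upTo H) W + W H) ≡⟨ id₁ (Φ (u (suc H))) (Ω (suc H)) (Σq (upTo H) W) (W H) ⟩
      Φ (u (suc H)) + W H + Ω (suc H) + Σq (upTo H) W ≤⟨ +-monoˡ-≤ (Σq (upTo H) W) (Φ-slot H) ⟩
      Φ (v H) + Ω H + Σq (upTo H) W ≤⟨ +-monoˡ-≤ (Σq (upTo H) W) (+-monoˡ-≤ (Ω H) (Φ-arrival H)) ⟩
      Φ (u H) + released-now H + Ω H + Σq (upTo H) W ≡⟨ id₂ (Φ (u H)) (released-now H) (Ω H) (Σq (upTo H) W) ⟩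
      Φ (u H) + Ω H + Σq (upTo H) W + released-now H ≤⟨ +-monoˡ-≤ (released-now H) (Φ-history H) ⟩
      Ω 0 + Σq (upTo H) released-now + released-now H ≡⟨ +-assoc (Ω 0) _ _ ⟩
      Ω 0 + (Σq (upTo H) released-now + released-now H) ≡⟨ cong (Ω 0 +_) (sym (Σ-upTo-suc H released-now)) ⟩
      Ω 0 + Σq (upTo (suc H)) released-now ∎
      where
      open ≤-Reasoning
      id₁ : ∀ a b c d → a + b + (c + d) ≡ a + d + b + c
      id₁ = solve-∀ ℚ-ring
      id₂ : ∀ a b c d → a + b + c + d ≡ a + c + d + b
      id₂ = solve-∀ ℚ-ring

    flow-≤-charges : ∀ H → Σq (upTo H) W ≤ K * Σq jobs (λ i → w i * P i) + Σq jobs (λ j → acc j ⊙ charge j)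
    flow-≤-charges H = begin
      Σq (upTo H) W ≤⟨ ≤-slack (Φ (u H) + Ω H) (+-nonneg (Φ-nonneg (u H) (λ i → ⊙-nonneg (acc i ∧ (r i <ᵇ H)) (q-nonneg H i))) (Ω-nonneg H)) (+-comm (Φ (u H) + Ω H) (Σq (upTo H) W)) ⟩
      Φ (u H) + Ω H + Σq (upTo H) W ≤⟨ Φ-history H ⟩
      Ω 0 + Σq (upTo H) released-now ≤⟨ +-mono-≤
        (≤-reflexive (cong (K *_) (Σ-cong jobs (λ i → cong (w i *_) (q-unreleased 0 i ℕ.z≤n)))))
        (≤-trans (≤-reflexive (Σ-swap (upTo H) jobs (λ t j → (r j ≡ᵇ t) ⊙ (acc j ⊙ charge j)))) (Σ-mono jobs (λ j → once j (⊙-nonneg (acc j) (charge-nonneg j))))) ⟩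
      K * Σq jobs (λ i → w i * P i) + Σq jobs (λ j → acc j ⊙ charge j) ∎
      where
      open ≤-Reasoning
      once : ∀ j {c} → 0ℚ ≤ c → Σq (upTo H) (λ t → (r j ≡ᵇ t) ⊙ c) ≤ c
      once j {c} 0≤c = proj₂ (both H)
        where
        both : ∀ H → (H ℕ.≤ r j → Σq (upTo H) (λ t → (r j ≡ᵇ t) ⊙ c) ≤ 0ℚ) × Σq (upTo H) (λ t → (r j ≡ᵇ t) ⊙ c) ≤ c
        both zero = (λ _ → ≤-refl) , 0≤c
        both (suc H) = (λ h → sum-≤ (proj₁ (both H) (ℕP.<⇒≤ h)) (≤-reflexive (cong (_⊙ c) (≡ᵇ-false (λ e → ℕP.<⇒≢ h (sym e)))))) ,
          go (r j ≡ᵇ H) refl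
          where
          sum-≤ : ∀ {a b} → Σq (upTo H) (λ t → (r j ≡ᵇ t) ⊙ c) ≤ a → (r j ≡ᵇ H) ⊙ c ≤ b → Σq (upTo (suc H)) (λ t → (r j ≡ᵇ t) ⊙ c) ≤ a + b
          sum-≤ h₁ h₂ = ≤-trans (≤-reflexive (Σ-upTo-suc H (λ t → (r j ≡ᵇ t) ⊙ c))) (+-mono-≤ h₁ h₂)

          go : ∀ b → (r j ≡ᵇ H) ≡ b → Σq (upTo (suc H)) (λ t → (r j ≡ᵇ t) ⊙ c) ≤ c
          go true e = ≤-trans (sum-≤ (proj₁ (both H) (ℕP.≤-reflexive (sym (≡ᵇ-true⁻¹ {r j} e)))) (⊙-≤ (r j ≡ᵇ H) 0≤c)) (≤-reflexive (+-identityˡ c))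
          go false e = ≤-trans (sum-≤ (proj₂ (both H)) (≤-reflexive (cong (_⊙ c) e))) (≤-reflexive (+-identityʳ c))

  -- Lower bounds on the offline flow

  module DelayBound {n : ℕ} {r : Fin n → ℕ} {ρ P w : Fin n → ℚ} {K : ℚ} {acc : Fin n → Bool} {q : ℕ → Fin n → ℚ}
    (run : Run r ρ P w K acc q) where
    open RunBounds run

    ahead : Fin n → ℕ → ℚ
    ahead j s = Σq jobs (λ i → (before i j ∧ acc i) ⊙ (m i j * q s i))

    -- One slot removes one unit of a single job, and the coefficient of that unit is at most ρ_j.
    ahead-served : ∀ j s → ahead j s ≤ ahead j (suc s) + ρ j
    ahead-served j s = go (slot s)
      where
      go : RunSlot r ρ w K acc q s → ahead j s ≤ ahead j (suc s) + ρ j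
      go (idle _ next) = ≤-slack (ρ j) (0≤ρ j) (cong (_+ ρ j)
        (Σ-cong jobs (λ i → cong (λ z → (before i j ∧ acc i) ⊙ (m i j * z)) (next i))))
      go (busy h _ _ next _) = ≤-trans (Σ-≤-+ jobs (λ i → (before i j ∧ acc i) ⊙ (m i j * q (suc s) i))
          (λ i → (i ≡ᵇF h) ⊙ m i j) (λ i → pointwise i (before i j ∧ acc i) (i ≡ᵇF h) (next i)))
        (+-monoʳ-≤ (ahead j (suc s)) (≤-trans (≤-reflexive (Σ-single h (λ i → m i j))) (m≤ρʳ h j)))
        where
        id₁ : ∀ a b → a * b ≡ a * (b - 1ℚ) + a
        id₁ = solve-∀ ℚ-ring
        id₂ : ∀ a b → a * b ≡ a * (b - 0ℚ) + 0ℚ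
        id₂ = solve-∀ ℚ-ring

        pointwise : ∀ i b d → q (suc s) i ≡ q s i - d ⊙ 1ℚ → b ⊙ (m i j * q s i) ≤ b ⊙ (m i j * q (suc s) i) + d ⊙ m i j
        pointwise i true true e = ≤-reflexive (trans (id₁ (m i j) (q s i)) (cong (λ z → m i j * z + m i j) (sym e)))
        pointwise i true false e = ≤-reflexive (trans (id₂ (m i j) (q s i)) (cong (λ z → m i j * z + 0ℚ) (sym e)))
        pointwise i false d e = +-mono-≤ (≤-refl {0ℚ}) (⊙-nonneg d (0≤m i j))

    ahead-after : ∀ j d → delay j ≤ ahead j (d ℕ.+ r j) + ρ j * ℚof d
    ahead-after j zero = ≤-reflexive (sym (trans (cong (ahead j (r j) +_) (*-zeroʳ (ρ j))) (+-identityʳ (ahead j (r j)))))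
    ahead-after j (suc d) = ≤-trans (ahead-after j d) (≤-trans
      (+-monoˡ-≤ (ρ j * ℚof d) (ahead-served j (d ℕ.+ r j)))
      (≤-reflexive (trans (identity (ahead j (suc d ℕ.+ r j)) (ρ j) (ℚof d))
        (cong (λ z → ahead j (suc d ℕ.+ r j) + ρ j * z) (sym (ℚof-suc d))))))
      where
      identity : ∀ a b c → a + b + b * c ≡ a + b * (1ℚ + c)
      identity = solve-∀ ℚ-ring

    ahead-≤-W : ∀ j s → r j ℕ.≤ s → ahead j s ≤ W s
    ahead-≤-W j s rj = Σ-mono jobs (λ i → ≤-trans
      (⊙-mono (before i j ∧ acc i) (λ _ → *-mono-≤ʳ (q s i) (q-nonneg s i) (m≤ρˡ i j)))
      (⊙-impl (before i j ∧ acc i) (acc i ∧ (r i ≤ᵇ s)) (*-nonneg (0≤ρ i) (q-nonneg s i))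
        (λ e → cong₂ _∧_ (proj₂ (∧-true {before i j} e))
          (≤ᵇ-true (ℕP.≤-trans (before⇒≤ {i} {j} (proj₁ (∧-true {before i j} e))) rj)))))

    delay-≤ : ∀ j s → r j ℕ.≤ s → delay j ≤ W s + ρ j * ℚof (s ∸ r j)
    delay-≤ j s rj = ≤-trans (subst (λ u → delay j ≤ ahead j u + ρ j * ℚof (s ∸ r j)) (ℕP.m∸n+n≡m rj) (ahead-after j (s ∸ r j)))
      (+-monoˡ-≤ (ρ j * ℚof (s ∸ r j)) (ahead-≤-W j s rj))

  record Offline {n : ℕ} (r : Fin n → ℕ) (P : Fin n → ℚ) (x : ℕ → Fin n → ℚ) (T : ℕ) : Set where
    field
      x-nonneg     : ∀ t j → 0ℚ ≤ x t j
      x-unreleased : ∀ t j → t ℕ.< r j → x t j ≡ 0ℚ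
      x-rate       : ∀ t → Σq (allFin n) (x t) ≤ 1ℚ
      x-finished   : ∀ t j → T ℕ.≤ t → x t j ≡ 0ℚ
      x-total      : ∀ j → Σq (upTo T) (λ s → x s j) ≡ P j

  module OfflineBounds {n : ℕ} {r : Fin n → ℕ} {ρ P : Fin n → ℚ} {x : ℕ → Fin n → ℚ} {T : ℕ}
    (0≤ρ : ∀ i → 0ℚ ≤ ρ i) (offline : Offline r P x T) where
    open Offline offline

    private
      jobs : List (Fin n)
      jobs = allFin n

    left : ℕ → Fin n → ℚ
    left t j = P j - Σq (upTo t) (λ s → x s j)

    flow : ℚ
    flow = Σq (upTo T) (λ t → Σq jobs (λ j → (r j ≤ᵇ t) ⊙ (ρ j * left t j)))

    left-suc : ∀ t j → left (suc t) j ≡ left t j - x t j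
    left-suc t j = trans (cong (λ z → P j - z) (Σ-upTo-suc t (λ s → x s j))) (identity (P j) (Σq (upTo t) (λ s → x s j)) (x t j))
      where
      identity : ∀ a b c → a - (b + c) ≡ a - b - c
      identity = solve-∀ ℚ-ring

    left-suc-≤ : ∀ t j → left (suc t) j ≤ left t j
    left-suc-≤ t j = ≤-slack (x t j) (x-nonneg t j) (trans (identity (left t j) (x t j)) (cong (_+ x t j) (sym (left-suc t j))))
      where
      identity : ∀ a b → a ≡ a - b + b
      identity = solve-∀ ℚ-ring

    left-finished : ∀ t j → T ℕ.≤ t → left t j ≡ 0ℚ
    left-finished t j T≤t = trans (cong (λ u → left u j) (sym (ℕP.m∸n+n≡m T≤t))) (go (t ∸ T))
      where
      go : ∀ d → left (d ℕ.+ T) j ≡ 0ℚ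
      go zero = trans (cong (λ z → P j - z) (x-total j)) (+-inverseʳ (P j))
      go (suc d) = trans (left-suc (d ℕ.+ T) j) (cong₂ _-_ (go d) (x-finished (d ℕ.+ T) j (ℕP.m≤n+m T d)))

    left-nonneg : ∀ t j → 0ℚ ≤ left t j
    left-nonneg t j = ≤-trans (≤-reflexive (sym (left-finished (T ℕ.+ t) j (ℕP.m≤m+n T t)))) (go T)
      where
      go : ∀ d → left (d ℕ.+ t) j ≤ left t j
      go zero = ≤-refl
      go (suc d) = ≤-trans (left-suc-≤ (d ℕ.+ t) j) (go d)

    left-unreleased : ∀ t j → t ℕ.≤ r j → left t j ≡ P j
    left-unreleased zero j _ = +-identityʳ (P j)
    left-unreleased (suc t) j t<r = trans (left-suc t j)
      (trans (cong₂ _-_ (left-unreleased t j (ℕP.<⇒≤ t<r)) (x-unreleased t j t<r)) (+-identityʳ (P j)))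

    -- Summation by parts: the work done on j, weighted by its age, is at most the area under left.
    age-≤-left : ∀ j → Σq (upTo T) (λ s → (r j ≤ᵇ s) ⊙ (x s j * ℚof (s ∸ r j))) ≤ Σq (upTo T) (λ s → (r j ≤ᵇ s) ⊙ left s j)
    age-≤-left j = ≤-trans (≤-slack (ℚof (T ∸ r j) * left T j) (*-nonneg (0≤ℚof (T ∸ r j)) (left-nonneg T j)) refl) (go T)
      where
      age area : ℕ → ℚ
      age s = (r j ≤ᵇ s) ⊙ (x s j * ℚof (s ∸ r j))
      area s = (r j ≤ᵇ s) ⊙ left s j

      step : ∀ b s → (r j ≤ᵇ s) ≡ b →
        b ⊙ (x s j * ℚof (s ∸ r j)) + ℚof (suc s ∸ r j) * left (suc s) j ≤ ℚof (s ∸ r j) * left s j + b ⊙ left s j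
      step true s e = ≤-slack (x s j) (x-nonneg s j) (trans (identity (ℚof (s ∸ r j)) (left s j) (x s j))
        (cong (_+ x s j) (cong₂ (λ y z → x s j * ℚof (s ∸ r j) + y * z)
          (sym (trans (cong ℚof (ℕP.+-∸-assoc 1 (≤ᵇ-true⁻¹ {r j} e))) (ℚof-suc (s ∸ r j)))) (sym (left-suc s j)))))
        where
        identity : ∀ a l y → a * l + l ≡ y * a + (1ℚ + a) * (l - y) + y
        identity = solve-∀ ℚ-ring
      step false s e = ≤-reflexive (trans (+-identityˡ _) (trans
        (trans (cong (λ z → ℚof z * left (suc s) j) (ℕP.m≤n⇒m∸n≡0 (≤ᵇ-false⁻¹ {r j} e))) (*-zeroˡ (left (suc s) j)))
        (sym (trans (+-identityʳ _) (trans (cong (λ z → ℚof z * left s j) (ℕP.m≤n⇒m∸n≡0 (ℕP.<⇒≤ (≤ᵇ-false⁻¹ {r j} e)))) (*-zeroˡ (left s j)))))))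

      go : ∀ t → Σq (upTo t) age + ℚof (t ∸ r j) * left t j ≤ Σq (upTo t) area
      go zero = ≤-reflexive (trans (+-identityˡ _) (trans (cong (λ z → ℚof z * left 0 j) (ℕP.0∸n≡0 (r j))) (*-zeroˡ (left 0 j))))
      go (suc t) = begin
        Σq (upTo (suc t)) age + ℚof (suc t ∸ r j) * left (suc t) j ≡⟨ cong (_+ ℚof (suc t ∸ r j) * left (suc t) j) (Σ-upTo-suc t age) ⟩
        Σq (upTo t) age + age t + ℚof (suc t ∸ r j) * left (suc t) j ≡⟨ +-assoc (Σq (upTo t) age) (age t) _ ⟩
        Σq (upTo t) age + (age t + ℚof (suc t ∸ r j) * left (suc t) j) ≤⟨ +-monoʳ-≤ (Σq (upTo t) age) (step (r j ≤ᵇ t) t refl) ⟩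
        Σq (upTo t) age + (ℚof (t ∸ r j) * left t j + area t) ≡⟨ sym (+-assoc (Σq (upTo t) age) _ (area t)) ⟩
        Σq (upTo t) age + ℚof (t ∸ r j) * left t j + area t ≤⟨ +-monoˡ-≤ (area t) (go t) ⟩
        Σq (upTo t) area + area t ≡⟨ sym (Σ-upTo-suc t area) ⟩
        Σq (upTo (suc t)) area ∎
        where open ≤-Reasoning

    flow-by-job : flow ≡ Σq jobs (λ j → ρ j * Σq (upTo T) (λ s → (r j ≤ᵇ s) ⊙ left s j))
    flow-by-job = trans (Σ-swap (upTo T) jobs (λ t j → (r j ≤ᵇ t) ⊙ (ρ j * left t j)))
      (Σ-cong jobs (λ j → trans (Σ-cong (upTo T) (λ s → ⊙-*ˡ (r j ≤ᵇ s) (ρ j) (left s j))) (Σ-*ˡ (upTo T) (ρ j) (λ s → (r j ≤ᵇ s) ⊙ left s j))))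

    -- The linear program in the background minimises the work done on each j weighted by ρ_j (s -
    -- r_j), subject to total work P_j and unit rate. Here b and W are the multipliers of these two
    -- constraints, and `age-≤-left` bounds the objective of the schedule by its flow.
    weak-duality : (b : Fin n → ℚ) (W : ℕ → ℚ) → (∀ s → 0ℚ ≤ W s) →
      (∀ j s → r j ℕ.≤ s → b j ≤ W s + ρ j * ℚof (s ∸ r j)) →
      Σq jobs (λ j → P j * b j) ≤ flow + Σq (upTo T) W
    weak-duality b W 0≤W feasible = begin
      Σq jobs (λ j → P j * b j) ≡⟨ Σ-cong jobs (λ j → trans (cong (_* b j) (sym (x-total j))) (sym (Σ-*ʳ (upTo T) (λ s → x s j) (b j)))) ⟩
      Σq jobs (λ j → Σq (upTo T) (λ s → x s j * b j)) ≤⟨ Σ-mono jobs (λ j → Σ-≤-+ (upTo T) (λ s → ρ j * age s j) (λ s → x s j * W s) (λ s → pointwise j s (r j ≤ᵇ s) refl)) ⟩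
      Σq jobs (λ j → Σq (upTo T) (λ s → ρ j * age s j) + Σq (upTo T) (λ s → x s j * W s)) ≡⟨ Σ-+ jobs _ _ ⟩
      Σq jobs (λ j → Σq (upTo T) (λ s → ρ j * age s j)) + Σq jobs (λ j → Σq (upTo T) (λ s → x s j * W s)) ≤⟨ +-mono-≤
        (Σ-mono jobs (λ j → ≤-trans (≤-reflexive (Σ-*ˡ (upTo T) (ρ j) (λ s → age s j))) (*-mono-≤ˡ (ρ j) (0≤ρ j) (age-≤-left j))))
        (≤-trans (≤-reflexive (Σ-swap jobs (upTo T) (λ j s → x s j * W s))) (Σ-mono (upTo T) (λ s →
          ≤-trans (≤-reflexive (Σ-*ʳ jobs (x s) (W s))) (≤-trans (*-mono-≤ʳ (W s) (0≤W s) (x-rate s)) (≤-reflexive (*-identityˡ (W s))))))) ⟩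
      Σq jobs (λ j → ρ j * Σq (upTo T) (λ s → (r j ≤ᵇ s) ⊙ left s j)) + Σq (upTo T) W ≡⟨ cong (_+ Σq (upTo T) W) (sym flow-by-job) ⟩
      flow + Σq (upTo T) W ∎
      where
      open ≤-Reasoning
      age : ℕ → Fin n → ℚ
      age s j = (r j ≤ᵇ s) ⊙ (x s j * ℚof (s ∸ r j))

      pointwise : ∀ j s d → (r j ≤ᵇ s) ≡ d → x s j * b j ≤ ρ j * d ⊙ (x s j * ℚof (s ∸ r j)) + x s j * W s
      pointwise j s true e = ≤-trans (*-mono-≤ˡ (x s j) (x-nonneg s j) (feasible j s (≤ᵇ-true⁻¹ {r j} e)))
        (≤-reflexive (identity (x s j) (W s) (ρ j) (ℚof (s ∸ r j))))
        where
        identity : ∀ a b c d → a * (b + c * d) ≡ c * (a * d) + a * b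
        identity = solve-∀ ℚ-ring
      pointwise j s false e = ≤-reflexive (trans (vanish (b j)) (sym (trans (cong₂ _+_ (*-zeroʳ (ρ j)) (vanish (W s))) refl)))
        where
        vanish : ∀ y → x s j * y ≡ 0ℚ
        vanish y = trans (cong (_* y) (x-unreleased s j (≤ᵇ-false⁻¹ {r j} e))) (*-zeroˡ y)

    pending : (Fin n → Bool) → ℕ → ℚ
    pending c t = Σq jobs (λ j → c j ⊙ (r j ≤ᵇ t) ⊙ left t j)

    pending-nonneg : ∀ c t → 0ℚ ≤ pending c t
    pending-nonneg c t = Σ-nonneg jobs (λ j → ⊙-nonneg (c j) (⊙-nonneg (r j ≤ᵇ t) (left-nonneg t j)))

    pending-served : ∀ c t → pending c t ≤ pending c (suc t) + 1ℚ
    pending-served c t = ≤-trans (Σ-≤-+ jobs (λ j → c j ⊙ (r j ≤ᵇ suc t) ⊙ left (suc t) j) (x t) pointwise)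
      (+-monoʳ-≤ (pending c (suc t)) (x-rate t))
      where
      identity : ∀ a b → a ≡ a - b + b
      identity = solve-∀ ℚ-ring

      pointwise : ∀ j → c j ⊙ (r j ≤ᵇ t) ⊙ left t j ≤ c j ⊙ (r j ≤ᵇ suc t) ⊙ left (suc t) j + x t j
      pointwise j = go (c j) (r j ≤ᵇ t) refl
        where
        nonneg : ∀ a b → 0ℚ ≤ a ⊙ b ⊙ left (suc t) j + x t j
        nonneg a b = +-nonneg (⊙-nonneg a (⊙-nonneg b (left-nonneg (suc t) j))) (x-nonneg t j)

        go : ∀ a b → (r j ≤ᵇ t) ≡ b → a ⊙ b ⊙ left t j ≤ a ⊙ (r j ≤ᵇ suc t) ⊙ left (suc t) j + x t j
        go false b _ = nonneg false true
        go true false _ = nonneg true (r j ≤ᵇ suc t)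
        go true true e = ≤-reflexive (trans (identity (left t j) (x t j)) (cong (_+ x t j)
          (trans (sym (left-suc t j)) (cong (_⊙ left (suc t) j) (sym (≤ᵇ-true (ℕP.m≤n⇒m≤1+n (≤ᵇ-true⁻¹ {r j} e))))))))

    -- A backlog drains at unit rate, so its area is at least half its square.
    pending² : ∀ c t → pending c t * pending c t ≤ 2ℚ * Σq (upTo T) (pending c)
    pending² c t = by-time (ℕP.≤-total T t)
      where
      V : ℕ → ℚ
      V = pending c

      total-nonneg : 0ℚ ≤ 2ℚ * Σq (upTo T) V
      total-nonneg = *-nonneg 0≤2ℚ (Σ-nonneg (upTo T) (pending-nonneg c))

      V-finished : ∀ t → T ℕ.≤ t → V t ≡ 0ℚ
      V-finished t h = trans (Σ-cong jobs (λ j → trans (cong (λ z → c j ⊙ (r j ≤ᵇ t) ⊙ z) (left-finished t j h)) (zero₂ (c j) (r j ≤ᵇ t))))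
        (Σ-zero jobs)
        where
        zero₂ : ∀ a b → a ⊙ b ⊙ 0ℚ ≡ 0ℚ
        zero₂ true  true  = refl
        zero₂ true  false = refl
        zero₂ false b     = refl

      square-step : ∀ a b → 0ℚ ≤ a → a ≤ b + 1ℚ → a * a ≤ b * b + 2ℚ * a
      square-step a b 0≤a h = ≤-slack ((a - b) * (a - b) + 2ℚ * (a * (b + 1ℚ - a)))
        (+-nonneg (square-nonneg (a - b)) (*-nonneg 0≤2ℚ (*-nonneg 0≤a (p≤q⇒0≤q-p h)))) (identity a b)
        where
        identity : ∀ a b → b * b + 2ℚ * a ≡ a * a + ((a - b) * (a - b) + 2ℚ * (a * (b + 1ℚ - a)))
        identity = solve-∀ ℚ-ring

      go : ∀ d t → d ℕ.+ t ≡ T → V t * V t + 2ℚ * Σq (upTo t) V ≤ 2ℚ * Σq (upTo T) V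
      go zero t refl = ≤-reflexive (trans (cong (λ z → z * z + 2ℚ * Σq (upTo t) V) (V-finished t ℕP.≤-refl)) (+-identityˡ _))
      go (suc d) t e = ≤-trans (+-monoˡ-≤ (2ℚ * Σq (upTo t) V) (square-step (V t) (V (suc t)) (pending-nonneg c t) (pending-served c t)))
        (≤-trans (≤-reflexive (trans (identity (V (suc t) * V (suc t)) (V t) (Σq (upTo t) V))
          (cong (λ z → V (suc t) * V (suc t) + 2ℚ * z) (sym (Σ-upTo-suc t V))))) (go d (suc t) (trans (ℕP.+-suc d t) e)))
        where
        identity : ∀ a b c → a + 2ℚ * b + 2ℚ * c ≡ a + 2ℚ * (c + b)
        identity = solve-∀ ℚ-ring

      by-time : _ → _
      by-time (inj₁ T≤t) = ≤-trans (≤-reflexive (trans (cong (λ z → z * z) (V-finished t T≤t)) refl)) total-nonneg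
      by-time (inj₂ t≤T) = ≤-trans (≤-slack (2ℚ * Σq (upTo t) V) (*-nonneg 0≤2ℚ (Σ-nonneg (upTo t) (pending-nonneg c))) refl)
        (go (T ∸ t) t (ℕP.m∸n+n≡m t≤T))

    -- The backlog bound applied to the class consisting of j alone at its release, where the
    -- backlog is P_j: then P_j² is at most twice the area under its remaining work.
    ΣwP≤2flow : (w : Fin n → ℚ) → (∀ i → w i ≡ ρ i * P i) → Σq jobs (λ j → w j * P j) ≤ 2ℚ * flow
    ΣwP≤2flow w w≡ρP = ≤-trans (Σ-mono jobs each) (≤-reflexive (trans (Σ-*ˡ jobs 2ℚ _) (cong (2ℚ *_) (sym flow-by-job))))
      where
      single : ∀ j t → pending (_≡ᵇF j) t ≡ (r j ≤ᵇ t) ⊙ left t j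
      single j t = Σ-single j (λ i → (r i ≤ᵇ t) ⊙ left t i)

      at-release : ∀ j → pending (_≡ᵇF j) (r j) ≡ P j
      at-release j = trans (single j (r j)) (trans (cong (_⊙ left (r j) j) (≤ᵇ-true (ℕP.≤-refl {r j}))) (left-unreleased (r j) j ℕP.≤-refl))

      identity : ∀ a b → a * (2ℚ * b) ≡ 2ℚ * (a * b)
      identity = solve-∀ ℚ-ring

      each : ∀ j → w j * P j ≤ 2ℚ * (ρ j * Σq (upTo T) (λ s → (r j ≤ᵇ s) ⊙ left s j))
      each j = ≤-trans (≤-reflexive (trans (cong (_* P j) (w≡ρP j)) (*-assoc (ρ j) (P j) (P j))))
        (≤-trans (*-mono-≤ˡ (ρ j) (0≤ρ j) (subst₂ _≤_ (cong (λ z → z * z) (at-release j))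
          (cong (2ℚ *_) (Σ-cong (upTo T) (single j))) (pending² (_≡ᵇF j) (r j))))
          (≤-reflexive (identity (ρ j) (Σq (upTo T) (λ s → (r j ≤ᵇ s) ⊙ left s j)))))

  -- Backlog of the lower density classes

  Σ-applyUpTo : ∀ N (f : ℕ → ℚ) (h : ℕ → ℕ) → Σq (applyUpTo h N) f ≡ Σq (upTo N) (f ∘ h)
  Σ-applyUpTo zero f h = refl
  Σ-applyUpTo (suc N) f h = cong (f (h 0) +_) (trans (Σ-applyUpTo N f (h ∘ suc)) (sym (Σ-applyUpTo N (f ∘ h) suc)))

  Σ-upTo-head : ∀ N (f : ℕ → ℚ) → Σq (upTo (suc N)) f ≡ f 0 + Σq (upTo N) (f ∘ suc)
  Σ-upTo-head N f = cong (f 0 +_) (Σ-applyUpTo N f suc)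

  Σ-upTo-reverse : ∀ N (f : ℕ → ℚ) → Σq (upTo N) (λ d → f (N ∸ suc d)) ≡ Σq (upTo N) f
  Σ-upTo-reverse zero f = refl
  Σ-upTo-reverse (suc N) f = trans (Σ-upTo-head N (λ d → f (N ∸ d)))
    (trans (+-comm (f N) _) (trans (cong (_+ f N) (Σ-upTo-reverse N f)) (sym (Σ-upTo-suc N f))))

  ¾ : ℚ
  ¾ = ½ + ½ * ½

  3ℚ 4ℚ 12ℚ : ℚ
  3ℚ = 1ℚ + 2ℚ
  4ℚ = 2ℚ + 2ℚ
  12ℚ = 3ℚ * 4ℚ

  module Contraction (y : ℕ → ℚ) where

    seq : ℕ → ℚ
    seq zero    = 0ℚ
    seq (suc i) = ¾ * seq i + y i

    seq-nonneg : (∀ i → 0ℚ ≤ y i) → ∀ i → 0ℚ ≤ seq i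
    seq-nonneg 0≤y zero = ≤-refl
    seq-nonneg 0≤y (suc i) = +-nonneg (*-nonneg (nonNegative⁻¹ ¾) (seq-nonneg 0≤y i)) (0≤y i)

    -- The factor 4 is 1 / (1 - 3/4). The part of the geometric series not yet spent is kept as
    -- `4ℚ * seq M`, which makes this an equality and the induction immediate.
    Σseq : ∀ M → Σq (upTo M) seq + 4ℚ * seq M ≡ 4ℚ * Σq (upTo M) y
    Σseq zero = refl
    Σseq (suc M) = trans (cong (_+ 4ℚ * seq (suc M)) (Σ-upTo-suc M seq))
      (trans (identity (Σq (upTo M) seq) (seq M) (y M)) (trans (cong (_+ 4ℚ * y M) (Σseq M))
      (trans (sym (*-distribˡ-+ 4ℚ (Σq (upTo M) y) (y M))) (cong (4ℚ *_) (sym (Σ-upTo-suc M y))))))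
      where
      identity : ∀ a b c → a + b + 4ℚ * (¾ * b + c) ≡ a + 4ℚ * b + 4ℚ * c
      identity = solve-∀ ℚ-ring

    Σseq-≤ : (∀ i → 0ℚ ≤ y i) → ∀ M → Σq (upTo M) seq ≤ 4ℚ * Σq (upTo M) y
    Σseq-≤ 0≤y M = ≤-slack (4ℚ * seq M) (*-nonneg (nonNegative⁻¹ 4ℚ) (seq-nonneg 0≤y M)) (sym (Σseq M))

    -- Shifting the summation by one adds the term `seq M`, which the unspent `4ℚ * seq M` covers,
    -- so the constant does not grow.
    Σseq-suc-≤ : (∀ i → 0ℚ ≤ y i) → ∀ M → Σq (upTo M) (seq ∘ suc) ≤ 4ℚ * Σq (upTo M) y
    Σseq-suc-≤ 0≤y M = ≤-slack (3ℚ * seq M) (*-nonneg (nonNegative⁻¹ 3ℚ) (seq-nonneg 0≤y M))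
      (trans (sym (Σseq M)) (trans (split (Σq (upTo M) seq) (seq M))
        (cong (_+ 3ℚ * seq M) (trans (sym (Σ-upTo-suc M seq)) (trans (Σ-upTo-head M seq) (+-identityˡ (Σq (upTo M) (seq ∘ suc))))))))
      where
      split : ∀ a b → a + 4ℚ * b ≡ a + b + 3ℚ * b
      split = solve-∀ ℚ-ring

  -- The weights are unequal on purpose: 3/2 is below 2, so after division by the factor 2 between
  -- neighbouring classes the accumulated part shrinks by 3/4. The symmetric split of `square-sum₂`
  -- would give factor 1 and no contraction.
  square-sum : ∀ a b → (a + b) * (a + b) ≤ (1ℚ + ½) * (a * a) + 3ℚ * (b * b)
  square-sum a b = ≤-slack (½ * ((a - 2ℚ * b) * (a - 2ℚ * b))) (*-nonneg 0≤½ (square-nonneg (a - 2ℚ * b))) (identity a b)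
    where
    identity : ∀ a b → (1ℚ + ½) * (a * a) + 3ℚ * (b * b) ≡ (a + b) * (a + b) + ½ * ((a - 2ℚ * b) * (a - 2ℚ * b))
    identity = solve-∀ ℚ-ring

  square-sum₂ : ∀ a b → (a + b) * (a + b) ≤ 2ℚ * (a * a) + 2ℚ * (b * b)
  square-sum₂ a b = ≤-slack ((a - b) * (a - b)) (square-nonneg (a - b)) (identity a b)
    where
    identity : ∀ a b → 2ℚ * (a * a) + 2ℚ * (b * b) ≡ (a + b) * (a + b) + (a - b) * (a - b)
    identity = solve-∀ ℚ-ring

  ≤ᵇ-split : ∀ c d (x : ℚ) → (c ≤ᵇ d) ⊙ x ≡ (suc c ≤ᵇ d) ⊙ x + (c ≡ᵇ d) ⊙ x
  ≤ᵇ-split c d x = go (ℕP.<-cmp c d)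
    where
    go : Tri (c ℕ.< d) (c ≡ d) (d ℕ.< c) → (c ≤ᵇ d) ⊙ x ≡ (suc c ≤ᵇ d) ⊙ x + (c ≡ᵇ d) ⊙ x
    go (tri< lt ne _) rewrite ≤ᵇ-true (ℕP.<⇒≤ lt) | <ᵇ-true lt | ≡ᵇ-false ne = sym (+-identityʳ x)
    go (tri≈ _ refl _) rewrite ≤ᵇ-true (ℕP.≤-refl {c}) | <ᵇ-false (ℕP.≤-refl {c}) | ≡ᵇ-refl c = sym (+-identityˡ x)
    go (tri> _ ne gt) rewrite ≤ᵇ-false gt | <ᵇ-false (ℕP.<⇒≤ gt) | ≡ᵇ-false ne = refl

  <ᵇ-split : ∀ d c (x : ℚ) → (d <ᵇ suc c) ⊙ x ≡ (d <ᵇ c) ⊙ x + (c ≡ᵇ d) ⊙ x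
  <ᵇ-split d c x = go (ℕP.<-cmp c d)
    where
    go : Tri (c ℕ.< d) (c ≡ d) (d ℕ.< c) → (d <ᵇ suc c) ⊙ x ≡ (d <ᵇ c) ⊙ x + (c ≡ᵇ d) ⊙ x
    go (tri< lt ne _) rewrite <ᵇ-false lt | <ᵇ-false (ℕP.<⇒≤ lt) | ≡ᵇ-false ne = refl
    go (tri≈ _ refl _) rewrite <ᵇ-true (ℕP.≤-refl {suc c}) | <ᵇ-false (ℕP.≤-refl {c}) | ≡ᵇ-refl c = sym (+-identityˡ x)
    go (tri> _ ne gt) rewrite <ᵇ-true (ℕP.m<n⇒m<1+n gt) | <ᵇ-true gt | ≡ᵇ-false ne = sym (+-identityʳ x)

  module Backlog {n : ℕ} {r : Fin n → ℕ} {ρ P w : Fin n → ℚ} {K : ℚ} {acc : Fin n → Bool} {q : ℕ → Fin n → ℚ}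
    (run : Run r ρ P w K acc q) {x : ℕ → Fin n → ℚ} {T : ℕ} (offline : Offline r P x T)
    (N : ℕ) (cl : Fin n → ℕ) (cl<N : ∀ j → cl j ℕ.< N)
    (g g⁻¹ : ℕ → ℚ) (0<g : ∀ i → 0ℚ < g i) (0≤g⁻¹ : ∀ i → 0ℚ ≤ g⁻¹ i)
    (g⁻¹*g≡1 : ∀ i → g⁻¹ i * g i ≡ 1ℚ) (g-suc : ∀ i → g (suc i) ≡ 2ℚ * g i)
    (g≤ρ : ∀ j → g (cl j) ≤ ρ j) (ρ<2g : ∀ j → ρ j < 2ℚ * g (cl j))
    where
    open RunBounds run
    open OfflineBounds {ρ = ρ} 0≤ρ offline

    0≤g : ∀ i → 0ℚ ≤ g i
    0≤g i = <⇒≤ (0<g i)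

    g-mono : ∀ {a b} → a ℕ.≤ b → g a ≤ g b
    g-mono {a} {b} a≤b = subst (λ b → g a ≤ g b) (ℕP.m∸n+n≡m a≤b) (go (b ∸ a))
      where
      identity : ∀ y → 2ℚ * y ≡ y + y
      identity = solve-∀ ℚ-ring

      go : ∀ d → g a ≤ g (d ℕ.+ a)
      go zero = ≤-refl
      go (suc d) = ≤-trans (go d) (≤-slack (g (d ℕ.+ a)) (0≤g (d ℕ.+ a)) (trans (g-suc (d ℕ.+ a)) (identity (g (d ℕ.+ a)))))

    class-< : ∀ h j → cl h ℕ.< cl j → ρ h < ρ j
    class-< h j lt = <-≤-trans (ρ<2g h) (≤-trans (≤-reflexive (sym (g-suc (cl h)))) (≤-trans (g-mono lt) (g≤ρ j)))

    on : ℕ → Fin n → Bool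
    on t j = acc j ∧ (r j ≤ᵇ t)

    dense : ℕ → ℕ → ℚ
    dense t c = Σq jobs (λ j → on t j ⊙ (c ≤ᵇ cl j) ⊙ q t j)

    denseO : ℕ → ℕ → ℚ
    denseO t c = pending (λ j → c ≤ᵇ cl j) t

    sparse : ℕ → ℕ → ℚ
    sparse t c = Σq jobs (λ j → on t j ⊙ (cl j <ᵇ c) ⊙ (ρ j * q t j))

    -- The square of a blocked volume K w_h / g_c, weighted by g_c. At any time only one h blocks,
    -- but which one depends on time; summing over all sparser h gives a bound free of time that is
    -- still geometric in c.
    blocking : ℕ → ℚ
    blocking c = Σq jobs (λ h → (cl h <ᵇ c) ⊙ (K * K * (w h * w h) * g⁻¹ c))

    blocking-nonneg : ∀ c → 0ℚ ≤ blocking c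
    blocking-nonneg c = Σ-nonneg jobs (λ h → ⊙-nonneg (cl h <ᵇ c)
      (*-nonneg (*-nonneg (*-nonneg 0≤K 0≤K) (*-nonneg (0≤w h) (0≤w h))) (0≤g⁻¹ c)))

    -- The superscript marks the backlog before the arrivals of time t. The arrivals are counted in
    -- full, accepted or not, because the offline schedule receives all of them.
    dense⁻ denseO⁻ arrived : ℕ → ℕ → ℚ
    dense⁻ t c  = Σq jobs (λ j → (acc j ∧ (r j <ᵇ t)) ⊙ (c ≤ᵇ cl j) ⊙ q t j)
    denseO⁻ t c = Σq jobs (λ j → (c ≤ᵇ cl j) ⊙ (r j <ᵇ t) ⊙ left t j)
    arrived t c = Σq jobs (λ j → (c ≤ᵇ cl j) ⊙ (t ≡ᵇ r j) ⊙ P j)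

    dense-arrival : ∀ t c → dense t c ≤ dense⁻ t c + arrived t c
    dense-arrival t c = Σ-≤-+ jobs _ _ (λ j → go j (acc j) (c ≤ᵇ cl j) (ℕP.<-cmp t (r j)))
      where
      go : ∀ j a d → Tri (t ℕ.< r j) (t ≡ r j) (r j ℕ.< t) →
        (a ∧ (r j ≤ᵇ t)) ⊙ d ⊙ q t j ≤ (a ∧ (r j <ᵇ t)) ⊙ d ⊙ q t j + d ⊙ (t ≡ᵇ r j) ⊙ P j
      go j false d _ = +-mono-≤ (≤-refl {0ℚ}) (⊙-nonneg d (⊙-nonneg (t ≡ᵇ r j) (0≤P j)))
      go j true d (tri< lt ne _) rewrite ≤ᵇ-false lt | <ᵇ-false (ℕP.<⇒≤ lt) =
        +-mono-≤ (≤-refl {0ℚ}) (⊙-nonneg d (⊙-nonneg (t ≡ᵇ r j) (0≤P j)))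
      go j true d (tri≈ _ refl _) rewrite ≤ᵇ-true (ℕP.≤-refl {r j}) | <ᵇ-false (ℕP.≤-refl {r j}) | ≡ᵇ-refl (r j) | q-unreleased (r j) j ℕP.≤-refl =
        ≤-reflexive (sym (+-identityˡ (d ⊙ P j)))
      go j true d (tri> _ ne gt) rewrite ≤ᵇ-true (ℕP.<⇒≤ gt) | <ᵇ-true gt =
        ≤-slack (d ⊙ (t ≡ᵇ r j) ⊙ P j) (⊙-nonneg d (⊙-nonneg (t ≡ᵇ r j) (0≤P j))) refl

    denseO-arrival : ∀ t c → denseO t c ≡ denseO⁻ t c + arrived t c
    denseO-arrival t c = trans (Σ-cong jobs (λ j → go j (c ≤ᵇ cl j))) (Σ-+ jobs _ _)
      where
      go : ∀ j d → d ⊙ (r j ≤ᵇ t) ⊙ left t j ≡ d ⊙ (r j <ᵇ t) ⊙ left t j + d ⊙ (t ≡ᵇ r j) ⊙ P j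
      go j false = refl
      go j true = trans (cong (_⊙ left t j) (≤ᵇ≡<ᵇsuc (r j) t)) (trans (<ᵇ-split (r j) t (left t j))
        (cong ((r j <ᵇ t) ⊙ left t j +_) (⊙-cong (t ≡ᵇ r j) (λ e → left-unreleased t j (ℕP.≤-reflexive (≡ᵇ-true⁻¹ {t} e))))))

    denseO-served : ∀ t c → denseO t c ≤ denseO⁻ (suc t) c + 1ℚ
    denseO-served t c = ≤-trans (Σ-≤-+ jobs (λ j → (c ≤ᵇ cl j) ⊙ (r j <ᵇ suc t) ⊙ left (suc t) j) (x t)
      (λ j → subst (λ b → (c ≤ᵇ cl j) ⊙ (r j ≤ᵇ t) ⊙ left t j ≤ (c ≤ᵇ cl j) ⊙ b ⊙ left (suc t) j + x t j)
        (≤ᵇ≡<ᵇsuc (r j) t) (go j (c ≤ᵇ cl j) (r j ≤ᵇ t)))) (+-monoʳ-≤ (denseO⁻ (suc t) c) (x-rate t))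
      where
      open Offline offline using (x-rate; x-nonneg)
      identity : ∀ a b → a ≡ a - b + b
      identity = solve-∀ ℚ-ring

      go : ∀ j d b → d ⊙ b ⊙ left t j ≤ d ⊙ b ⊙ left (suc t) j + x t j
      go j true true = ≤-reflexive (trans (identity (left t j) (x t j)) (cong (_+ x t j) (sym (left-suc t j))))
      go j true false = +-mono-≤ (≤-refl {0ℚ}) (x-nonneg t j)
      go j false b = +-mono-≤ (≤-refl {0ℚ}) (x-nonneg t j)

    denseO⁻-nonneg : ∀ t c → 0ℚ ≤ denseO⁻ t c
    denseO⁻-nonneg t c = Σ-nonneg jobs (λ j → ⊙-nonneg (c ≤ᵇ cl j) (⊙-nonneg (r j <ᵇ t) (left-nonneg t j)))

    -- The surplus e of the run over the offline schedule, kept together with a bound on g_c e², the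
    -- form in which it is later summed over the classes.
    Excess : ℕ → ℚ → ℚ → Set
    Excess c a b = ∃[ e ] (0ℚ ≤ e × g c * (e * e) ≤ blocking c × a ≤ b + e)

    dense⁻-suc-≡ : ∀ t c → dense⁻ (suc t) c ≡ Σq jobs (λ j → on t j ⊙ (c ≤ᵇ cl j) ⊙ q (suc t) j)
    dense⁻-suc-≡ t c = Σ-cong jobs (λ j → cong (λ b → (acc j ∧ b) ⊙ (c ≤ᵇ cl j) ⊙ q (suc t) j) (sym (≤ᵇ≡<ᵇsuc (r j) t)))

    no-excess : ∀ c {a b} → a ≤ b → Excess c a b
    no-excess c {a} {b} a≤b = 0ℚ , ≤-refl , ≤-trans (≤-reflexive (*-zeroʳ (g c))) (blocking-nonneg c) ,
      ≤-trans a≤b (≤-reflexive (sym (+-identityʳ b)))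

    -- Every job of class c or higher is strictly denser than h, so it belongs to the late work
    -- behind h, and each unit of it weighs at least g_c.
    dense-blocked : ∀ t c h → cl h ℕ.< c →
      Σq jobs (λ i → (acc i ∧ (r i ≤ᵇ t)) ⊙ (ρ h <ᵇq ρ i) ⊙ (ρ i * q t i)) ≤ K * w h → dense t c ≤ g⁻¹ c * (K * w h)
    dense-blocked t c h ch late = ≤-trans (≤-trans (Σ-mono jobs (λ i → pointwise i (on t i) (c ≤ᵇ cl i) refl))
      (≤-reflexive (Σ-*ˡ jobs (g⁻¹ c) _))) (*-mono-≤ˡ (g⁻¹ c) (0≤g⁻¹ c) late)
      where
      pointwise : ∀ i b d → (c ≤ᵇ cl i) ≡ d → b ⊙ d ⊙ q t i ≤ g⁻¹ c * b ⊙ (ρ h <ᵇq ρ i) ⊙ (ρ i * q t i)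
      pointwise i false d _ = ≤-reflexive (sym (*-zeroʳ (g⁻¹ c)))
      pointwise i true false _ = *-nonneg (0≤g⁻¹ c) (⊙-nonneg (ρ h <ᵇq ρ i) (*-nonneg (0≤ρ i) (q-nonneg t i)))
      pointwise i true true e = ≤-trans (≤-trans (≤-reflexive (trans (sym (*-identityˡ (q t i))) (cong (_* q t i) (sym (g⁻¹*g≡1 c)))))
        (*-mono-≤ʳ (q t i) (q-nonneg t i) (*-mono-≤ˡ (g⁻¹ c) (0≤g⁻¹ c) (≤-trans (g-mono c≤) (g≤ρ i)))))
        (≤-reflexive (trans (*-assoc (g⁻¹ c) (ρ i) (q t i)) (cong (λ b → g⁻¹ c * b ⊙ (ρ i * q t i)) (sym denser))))
        where
        c≤ : c ℕ.≤ cl i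
        c≤ = ≤ᵇ-true⁻¹ e
        denser : (ρ h <ᵇq ρ i) ≡ true
        denser = <ᵇq-true (class-< h i (ℕP.<-≤-trans ch c≤))
          where
          <ᵇq-true : ∀ {a b} → a < b → (a <ᵇq b) ≡ true
          <ᵇq-true {a} {b} a<b = cong not (¬T⇒false {b ℚ.≤ᵇ a} (λ t → <⇒≱ a<b (≤ᵇ⇒≤ t)))
            where
            <⇒≱ : ∀ {a b} → a < b → b ≤ a → ⊥
            <⇒≱ a<b b≤a = <-irrefl refl (<-≤-trans a<b b≤a)

    -- The surplus is kept while a job of class c or higher is served: the run loses one unit and
    -- the offline schedule at most one. It is reset whenever the run does something else: to 0 in
    -- an idle slot, where no accepted job is pending, and to K w_h / g_c when a sparser h is
    -- served. No surplus accumulates over time.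
    dense-≤ : ∀ t c → Excess c (dense⁻ t c) (denseO⁻ t c)
    dense-after : ∀ t c → Excess c (dense t c) (denseO t c)

    dense-after t c = go (dense-≤ t c)
      where
      identity : ∀ a b c → a + b + c ≡ a + c + b
      identity = solve-∀ ℚ-ring
      go : Excess c (dense⁻ t c) (denseO⁻ t c) → Excess c (dense t c) (denseO t c)
      go (e , 0≤e , small , le) = e , 0≤e , small , ≤-trans (dense-arrival t c) (≤-trans (+-monoˡ-≤ (arrived t c) le)
        (≤-reflexive (trans (identity (denseO⁻ t c) e (arrived t c)) (cong (_+ e) (sym (denseO-arrival t c))))))

    dense-≤ zero c = no-excess c (≤-trans (≤-reflexive (trans (Σ-cong jobs (λ j → lemma (acc j) ((c ≤ᵇ cl j) ⊙ q 0 j))) (Σ-zero jobs))) (denseO⁻-nonneg 0 c))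
      where
      lemma : ∀ a y → (a ∧ false) ⊙ y ≡ 0ℚ
      lemma true  y = refl
      lemma false y = refl
    dense-≤ (suc t) c = go (slot t) (dense-after t c)
      where
      go : RunSlot r ρ w K acc q t → Excess c (dense t c) (denseO t c) → Excess c (dense⁻ (suc t) c) (denseO⁻ (suc t) c)
      go (idle done next) _ = no-excess c (≤-trans (≤-reflexive (trans (dense⁻-suc-≡ t c) (trans (Σ-cong jobs (λ j →
        vanish (on t j) (c ≤ᵇ cl j) (λ e → trans (next j) (done j (≤ᵇ-true⁻¹ (proj₂ (∧-true {acc j} e))) (proj₁ (∧-true {acc j} e))))))
        (Σ-zero jobs)))) (denseO⁻-nonneg (suc t) c))
        where
        vanish : ∀ a b {y} → (a ≡ true → y ≡ 0ℚ) → a ⊙ b ⊙ y ≡ 0ℚ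
        vanish true true  h = h refl
        vanish true false h = refl
        vanish false b    h = refl
      go (busy h rh acch next late) (e , 0≤e , small , le) = by-class (c ≤ᵇ cl h) refl
        where
        served : ∀ b → (c ≤ᵇ cl h) ≡ b → dense⁻ (suc t) c + b ⊙ 1ℚ ≤ dense t c
        served b e = ≤-reflexive (trans (cong₂ _+_ (dense⁻-suc-≡ t c) (sym single)) (trans (sym (Σ-+ jobs _ _))
          (Σ-cong jobs (λ j → pointwise j (on t j) (c ≤ᵇ cl j) (j ≡ᵇF h) (next j)))))
          where
          single : Σq jobs (λ j → (j ≡ᵇF h) ⊙ (on t j ⊙ (c ≤ᵇ cl j) ⊙ 1ℚ)) ≡ b ⊙ 1ℚ
          single = trans (Σ-single h (λ j → on t j ⊙ (c ≤ᵇ cl j) ⊙ 1ℚ))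
            (trans (cong₂ (λ a d → a ⊙ d ⊙ 1ℚ) (cong₂ _∧_ acch (≤ᵇ-true rh)) e) refl)

          id₁ : ∀ y → y - 1ℚ + 1ℚ ≡ y
          id₁ = solve-∀ ℚ-ring
          id₂ : ∀ y → y - 0ℚ + 0ℚ ≡ y
          id₂ = solve-∀ ℚ-ring

          pointwise : ∀ j a d s → q (suc t) j ≡ q t j - s ⊙ 1ℚ → a ⊙ d ⊙ q (suc t) j + s ⊙ (a ⊙ d ⊙ 1ℚ) ≡ a ⊙ d ⊙ q t j
          pointwise j true true true e = trans (cong (_+ 1ℚ) e) (id₁ (q t j))
          pointwise j true true false e = trans (cong (_+ 0ℚ) e) (id₂ (q t j))
          pointwise j true false true e = refl
          pointwise j true false false e = refl
          pointwise j false d true e = refl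
          pointwise j false d false e = refl

        by-class : ∀ b → (c ≤ᵇ cl h) ≡ b → Excess c (dense⁻ (suc t) c) (denseO⁻ (suc t) c)
        by-class true eq = e , 0≤e , small , (begin
          dense⁻ (suc t) c ≡⟨ cancel (dense⁻ (suc t) c) ⟩
          dense⁻ (suc t) c + 1ℚ - 1ℚ ≤⟨ +-monoˡ-≤ (- 1ℚ) (≤-trans (served true eq) (≤-trans le (+-monoˡ-≤ e (denseO-served t c)))) ⟩
          denseO⁻ (suc t) c + 1ℚ + e - 1ℚ ≡⟨ cancel₂ (denseO⁻ (suc t) c) e ⟩
          denseO⁻ (suc t) c + e ∎)
          where
          open ≤-Reasoning
          cancel : ∀ a → a ≡ a + 1ℚ - 1ℚ
          cancel = solve-∀ ℚ-ring
          cancel₂ : ∀ a b → a + 1ℚ + b - 1ℚ ≡ a + b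
          cancel₂ = solve-∀ ℚ-ring
        by-class false eq = g⁻¹ c * (K * w h) , *-nonneg (0≤g⁻¹ c) (*-nonneg 0≤K (0≤w h)) , blocked ,
          ≤-trans (≤-trans (≤-reflexive (sym (+-identityʳ (dense⁻ (suc t) c)))) (≤-trans (served false eq) (dense-blocked t c h (≤ᵇ-false⁻¹ eq) late)))
            (≤-slack (denseO⁻ (suc t) c) (denseO⁻-nonneg (suc t) c) (+-comm (denseO⁻ (suc t) c) (g⁻¹ c * (K * w h))))
          where
          identity : ∀ a b k y → a * (b * (k * y) * (b * (k * y))) ≡ b * a * (k * k * (y * y) * b)
          identity = solve-∀ ℚ-ring

          blocked : g c * (g⁻¹ c * (K * w h) * (g⁻¹ c * (K * w h))) ≤ blocking c
          blocked = ≤-trans (≤-reflexive (trans (identity (g c) (g⁻¹ c) K (w h))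
            (trans (cong (_* (K * K * (w h * w h) * g⁻¹ c)) (g⁻¹*g≡1 c)) (trans (*-identityˡ _)
              (cong (_⊙ (K * K * (w h * w h) * g⁻¹ c)) (sym (<ᵇ-true (≤ᵇ-false⁻¹ {c} eq))))))))
            (≤Σ (λ h → (cl h <ᵇ c) ⊙ (K * K * (w h * w h) * g⁻¹ c)) (λ h → ⊙-nonneg (cl h <ᵇ c)
              (*-nonneg (*-nonneg (*-nonneg 0≤K 0≤K) (*-nonneg (0≤w h) (0≤w h))) (0≤g⁻¹ c))) h)

    own : ℕ → ℕ → ℚ
    own t c = pending (λ j → c ≡ᵇ cl j) t

    ownFlow : ℕ → ℚ
    ownFlow c = Σq jobs (λ j → (c ≡ᵇ cl j) ⊙ (ρ j * Σq (upTo T) (λ s → (r j ≤ᵇ s) ⊙ left s j)))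

    area-nonneg : ∀ j → 0ℚ ≤ Σq (upTo T) (λ s → (r j ≤ᵇ s) ⊙ left s j)
    area-nonneg j = Σ-nonneg (upTo T) (λ s → ⊙-nonneg (r j ≤ᵇ s) (left-nonneg s j))

    ownFlow-nonneg : ∀ c → 0ℚ ≤ ownFlow c
    ownFlow-nonneg c = Σ-nonneg jobs (λ j → ⊙-nonneg (c ≡ᵇ cl j) (*-nonneg (0≤ρ j) (area-nonneg j)))

    ΣownFlow : Σq (upTo N) ownFlow ≡ flow
    ΣownFlow = trans (Σ-swap (upTo N) jobs _) (trans (Σ-cong jobs (λ j →
      Σ-upTo-single N (cl j) (λ _ → ρ j * Σq (upTo T) (λ s → (r j ≤ᵇ s) ⊙ left s j)) (cl<N j))) (sym flow-by-job))

    own² : ∀ t c → g c * (own t c * own t c) ≤ 2ℚ * ownFlow c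
    own² t c = ≤-trans (*-mono-≤ˡ (g c) (0≤g c) (pending² (λ j → c ≡ᵇ cl j) t))
      (≤-trans (≤-reflexive (comm (g c) (Σq (upTo T) (pending (λ j → c ≡ᵇ cl j))))) (*-mono-≤ˡ 2ℚ 0≤2ℚ
        (≤-trans (≤-reflexive (cong (g c *_) (trans (Σ-swap (upTo T) jobs (λ s j → (c ≡ᵇ cl j) ⊙ (r j ≤ᵇ s) ⊙ left s j))
          (Σ-cong jobs (λ j → Σ-⊙ (upTo T) (c ≡ᵇ cl j) (λ s → (r j ≤ᵇ s) ⊙ left s j))))))
        (≤-trans (≤-reflexive (sym (Σ-*ˡ jobs (g c) _))) (Σ-mono jobs (λ j → pointwise j (c ≡ᵇ cl j) refl))))))
      where
      comm : ∀ a b → a * (2ℚ * b) ≡ 2ℚ * (a * b)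
      comm = solve-∀ ℚ-ring

      pointwise : ∀ j b → (c ≡ᵇ cl j) ≡ b →
        g c * b ⊙ Σq (upTo T) (λ s → (r j ≤ᵇ s) ⊙ left s j) ≤ b ⊙ (ρ j * Σq (upTo T) (λ s → (r j ≤ᵇ s) ⊙ left s j))
      pointwise j false _ = ≤-reflexive (*-zeroʳ (g c))
      pointwise j true e = *-mono-≤ʳ _ (area-nonneg j) (subst (λ c → g c ≤ ρ j) (sym (≡ᵇ-true⁻¹ {c} e)) (g≤ρ j))

    3/2-step : ∀ γ a b → 0ℚ ≤ γ → γ * ((a + b) * (a + b)) ≤ ¾ * (2ℚ * γ * (a * a)) + 3ℚ * (γ * (b * b))
    3/2-step γ a b 0≤γ = ≤-trans (*-mono-≤ˡ γ 0≤γ (square-sum a b)) (≤-reflexive (identity γ a b))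
      where
      identity : ∀ γ a b → γ * ((1ℚ + ½) * (a * a) + 3ℚ * (b * b)) ≡ ¾ * (2ℚ * γ * (a * a)) + 3ℚ * (γ * (b * b))
      identity = solve-∀ ℚ-ring

    -- Indexed by N ∸ c: the bound at class c accumulates the classes above it.
    module D = Contraction (λ d → 3ℚ * (2ℚ * ownFlow (N ∸ suc d)))

    D-term-nonneg : ∀ d → 0ℚ ≤ 3ℚ * (2ℚ * ownFlow (N ∸ suc d))
    D-term-nonneg d = *-nonneg (nonNegative⁻¹ 3ℚ) (*-nonneg 0≤2ℚ (ownFlow-nonneg (N ∸ suc d)))

    -- Induction downwards from the empty class N. The inductive hypothesis carries the weight g
    -- (suc c) = 2 g c, so the factor 3/2 on the denser part becomes 3/4 relative to it.
    denseO² : ∀ d c t → c ℕ.+ d ≡ N → g c * (denseO t c * denseO t c) ≤ D.seq d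
    denseO² zero c t e = ≤-reflexive (trans (cong (λ z → g c * (z * z)) vanish) (*-zeroʳ (g c)))
      where
      vanish : denseO t c ≡ 0ℚ
      vanish = trans (Σ-cong jobs (λ j → cong (_⊙ ((r j ≤ᵇ t) ⊙ left t j))
        (≤ᵇ-false (subst (cl j ℕ.<_) (trans (sym e) (ℕP.+-identityʳ c)) (cl<N j))))) (Σ-zero jobs)
    denseO² (suc d) c t e = ≤-trans (≤-reflexive (cong (λ z → g c * (z * z)) split))
      (≤-trans (3/2-step (g c) (denseO t (suc c)) (own t c) (0≤g c)) (+-mono-≤
        (*-mono-≤ˡ ¾ (nonNegative⁻¹ ¾) (≤-trans (≤-reflexive (cong (_* (denseO t (suc c) * denseO t (suc c))) (sym (g-suc c))))
          (denseO² d (suc c) t (trans (sym (ℕP.+-suc c d)) e))))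
        (*-mono-≤ˡ 3ℚ (nonNegative⁻¹ 3ℚ) (subst (λ z → g c * (own t c * own t c) ≤ 2ℚ * ownFlow z) c≡ (own² t c)))))
      where
      split : denseO t c ≡ denseO t (suc c) + own t c
      split = trans (Σ-cong jobs (λ j → ≤ᵇ-split c (cl j) ((r j ≤ᵇ t) ⊙ left t j))) (Σ-+ jobs _ _)

      c≡ : c ≡ N ∸ suc d
      c≡ = sym (trans (cong (_∸ suc d) (sym e)) (ℕP.m+n∸n≡m c (suc d)))

    dense-nonneg : ∀ t c → 0ℚ ≤ dense t c
    dense-nonneg t c = Σ-nonneg jobs (λ j → ⊙-nonneg (on t j) (⊙-nonneg (c ≤ᵇ cl j) (q-nonneg t j)))

    dense² : ∀ t c → c ℕ.≤ N → g c * (dense t c * dense t c) ≤ 2ℚ * D.seq (N ∸ c) + 2ℚ * blocking c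
    dense² t c c≤N = go (dense-after t c)
      where
      identity : ∀ γ a b → γ * (2ℚ * (a * a) + 2ℚ * (b * b)) ≡ 2ℚ * (γ * (a * a)) + 2ℚ * (γ * (b * b))
      identity = solve-∀ ℚ-ring

      go : Excess c (dense t c) (denseO t c) → g c * (dense t c * dense t c) ≤ 2ℚ * D.seq (N ∸ c) + 2ℚ * blocking c
      go (e , 0≤e , small , le) = ≤-trans (*-mono-≤ˡ (g c) (0≤g c) (≤-trans
          (*-mono-≤² (dense-nonneg t c) (≤-trans (dense-nonneg t c) le) le le) (square-sum₂ (denseO t c) e)))
        (≤-trans (≤-reflexive (identity (g c) (denseO t c) e)) (+-mono-≤
          (*-mono-≤ˡ 2ℚ 0≤2ℚ (denseO² (N ∸ c) c t (ℕP.m+[n∸m]≡n c≤N))) (*-mono-≤ˡ 2ℚ 0≤2ℚ small)))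

    module F = Contraction (λ c → 12ℚ * D.seq (N ∸ c) + 12ℚ * blocking c)

    F-term-nonneg : ∀ c → 0ℚ ≤ 12ℚ * D.seq (N ∸ c) + 12ℚ * blocking c
    F-term-nonneg c = +-nonneg (*-nonneg (nonNegative⁻¹ 12ℚ) (D.seq-nonneg D-term-nonneg (N ∸ c)))
      (*-nonneg (nonNegative⁻¹ 12ℚ) (blocking-nonneg c))

    sparse-nonneg : ∀ t c → 0ℚ ≤ sparse t c
    sparse-nonneg t c = Σ-nonneg jobs (λ j → ⊙-nonneg (on t j) (⊙-nonneg (cl j <ᵇ c) (*-nonneg (0≤ρ j) (q-nonneg t j))))

    -- The volume of class c is replaced by the volume of all classes from c on. The overestimate is
    -- deliberate, since only these upper volumes are compared with the offline schedule.
    sparse-suc : ∀ t c → sparse t (suc c) ≤ sparse t c + 2ℚ * g c * dense t c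
    sparse-suc t c = ≤-trans (Σ-≤-+ jobs (λ j → on t j ⊙ (cl j <ᵇ c) ⊙ (ρ j * q t j)) (λ j → 2ℚ * g c * on t j ⊙ (c ≤ᵇ cl j) ⊙ q t j)
      (λ j → pointwise j (on t j))) (≤-reflexive (cong (sparse t c +_) (Σ-*ˡ jobs (2ℚ * g c) _)))
      where
      equal-class : ∀ j b → (c ≡ᵇ cl j) ≡ b → b ⊙ (ρ j * q t j) ≤ 2ℚ * g c * (c ≤ᵇ cl j) ⊙ q t j
      equal-class j false _ = *-nonneg (*-nonneg 0≤2ℚ (0≤g c)) (⊙-nonneg (c ≤ᵇ cl j) (q-nonneg t j))
      equal-class j true e = ≤-trans (*-mono-≤ʳ (q t j) (q-nonneg t j) (subst (λ c → ρ j ≤ 2ℚ * g c) (sym c≡) (<⇒≤ (ρ<2g j))))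
        (≤-reflexive (cong (λ b → 2ℚ * g c * b ⊙ q t j) (sym (≤ᵇ-true (ℕP.≤-reflexive c≡)))))
        where
        c≡ : c ≡ cl j
        c≡ = ≡ᵇ-true⁻¹ {c} e

      pointwise : ∀ j b → b ⊙ (cl j <ᵇ suc c) ⊙ (ρ j * q t j) ≤ b ⊙ (cl j <ᵇ c) ⊙ (ρ j * q t j) + 2ℚ * g c * b ⊙ (c ≤ᵇ cl j) ⊙ q t j
      pointwise j false = ≤-reflexive (sym (trans (+-identityˡ _) (*-zeroʳ (2ℚ * g c))))
      pointwise j true = ≤-trans (≤-reflexive (<ᵇ-split (cl j) c (ρ j * q t j)))
        (+-monoʳ-≤ ((cl j <ᵇ c) ⊙ (ρ j * q t j)) (equal-class j (c ≡ᵇ cl j) refl))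

    -- Induction upwards, dual to `denseO²`: the bound is normalised by g_c, which doubles at each
    -- step and again turns 3/2 into 3/4. The 12 is 3 times the square of the 2 in `sparse-suc`.
    sparse² : ∀ c t → c ℕ.≤ N → sparse t c * sparse t c ≤ g c * F.seq c
    sparse² zero t _ = ≤-reflexive (trans (cong (λ z → z * z) (trans (Σ-cong jobs (λ j → vanish (on t j))) (Σ-zero jobs))) (sym (*-zeroʳ (g 0))))
      where
      vanish : ∀ b → b ⊙ 0ℚ ≡ 0ℚ
      vanish true  = refl
      vanish false = refl
    sparse² (suc c) t c<N = begin
      sparse t (suc c) * sparse t (suc c) ≤⟨ *-mono-≤² (sparse-nonneg t (suc c)) (≤-trans (sparse-nonneg t (suc c)) (sparse-suc t c)) (sparse-suc t c) (sparse-suc t c) ⟩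
      (sparse t c + 2ℚ * g c * dense t c) * (sparse t c + 2ℚ * g c * dense t c) ≤⟨ square-sum (sparse t c) (2ℚ * g c * dense t c) ⟩
      (1ℚ + ½) * (sparse t c * sparse t c) + 3ℚ * (2ℚ * g c * dense t c * (2ℚ * g c * dense t c)) ≡⟨ id₁ (sparse t c * sparse t c) (g c) (dense t c) ⟩
      (1ℚ + ½) * (sparse t c * sparse t c) + 12ℚ * g c * (g c * (dense t c * dense t c)) ≤⟨ +-mono-≤
        (*-mono-≤ˡ (1ℚ + ½) (nonNegative⁻¹ (1ℚ + ½)) (sparse² c t (ℕP.<⇒≤ c<N)))
        (*-mono-≤ˡ (12ℚ * g c) (*-nonneg (nonNegative⁻¹ 12ℚ) (0≤g c)) (dense² t c (ℕP.<⇒≤ c<N))) ⟩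
      (1ℚ + ½) * (g c * F.seq c) + 12ℚ * g c * (2ℚ * D.seq (N ∸ c) + 2ℚ * blocking c) ≡⟨ id₂ (g c) (F.seq c) (D.seq (N ∸ c)) (blocking c) ⟩
      2ℚ * g c * F.seq (suc c) ≡⟨ cong (_* F.seq (suc c)) (sym (g-suc c)) ⟩
      g (suc c) * F.seq (suc c) ∎
      where
      open ≤-Reasoning
      id₁ : ∀ s γ d → (1ℚ + ½) * s + 3ℚ * (2ℚ * γ * d * (2ℚ * γ * d)) ≡ (1ℚ + ½) * s + 12ℚ * γ * (γ * (d * d))
      id₁ = solve-∀ ℚ-ring
      id₂ : ∀ γ f d b → (1ℚ + ½) * (γ * f) + 12ℚ * γ * (2ℚ * d + 2ℚ * b) ≡ 2ℚ * γ * (¾ * f + (12ℚ * d + 12ℚ * b))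
      id₂ = solve-∀ ℚ-ring

    g⁻¹-suc : ∀ i → 2ℚ * g⁻¹ (suc i) ≡ g⁻¹ i
    g⁻¹-suc i = trans (sym (*-identityʳ _)) (trans (cong (2ℚ * g⁻¹ (suc i) *_) (sym (g⁻¹*g≡1 i)))
      (trans (identity (g⁻¹ (suc i)) (g⁻¹ i) (g i)) (trans (cong (λ z → g⁻¹ i * (g⁻¹ (suc i) * z)) (sym (g-suc i)))
      (trans (cong (g⁻¹ i *_) (g⁻¹*g≡1 (suc i))) (*-identityʳ (g⁻¹ i))))))
      where
      identity : ∀ a b c → 2ℚ * a * (b * c) ≡ b * (a * (2ℚ * c))
      identity = solve-∀ ℚ-ring

    Σg⁻¹-above : ∀ a M → Σq (upTo M) (λ c → (a <ᵇ c) ⊙ g⁻¹ c) ≤ g⁻¹ a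
    Σg⁻¹-above a M = by-size (ℕP.≤-total M (suc a))
      where
      S : ℕ → ℚ
      S M = Σq (upTo M) (λ c → (a <ᵇ c) ⊙ g⁻¹ c)

      low : ∀ M → M ℕ.≤ suc a → S M ≡ 0ℚ
      low zero _ = refl
      low (suc M) h = trans (Σ-upTo-suc M (λ c → (a <ᵇ c) ⊙ g⁻¹ c)) (cong₂ _+_ (low M (ℕP.<⇒≤ h)) (cong (_⊙ g⁻¹ M) (<ᵇ-false (ℕP.≤-pred h))))

      double : ∀ y → y + y ≡ 2ℚ * y
      double = solve-∀ ℚ-ring

      high : ∀ d → S (d ℕ.+ suc a) + g⁻¹ (d ℕ.+ a) ≡ g⁻¹ a
      high zero = trans (cong (_+ g⁻¹ a) (low (suc a) ℕP.≤-refl)) (+-identityˡ (g⁻¹ a))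
      high (suc d) = trans (cong (_+ g⁻¹ (suc d ℕ.+ a)) (trans (Σ-upTo-suc (d ℕ.+ suc a) (λ c → (a <ᵇ c) ⊙ g⁻¹ c))
          (cong (S (d ℕ.+ suc a) +_) (trans (cong (_⊙ g⁻¹ (d ℕ.+ suc a)) (<ᵇ-true (ℕP.m≤n+m (suc a) d))) (cong g⁻¹ (ℕP.+-suc d a))))))
        (trans (+-assoc (S (d ℕ.+ suc a)) _ _) (trans (cong (S (d ℕ.+ suc a) +_) (trans (double (g⁻¹ (suc (d ℕ.+ a)))) (g⁻¹-suc (d ℕ.+ a)))) (high d)))

      by-size : M ℕ.≤ suc a ⊎ suc a ℕ.≤ M → S M ≤ g⁻¹ a
      by-size (inj₁ h) = ≤-trans (≤-reflexive (low M h)) (0≤g⁻¹ a)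
      by-size (inj₂ h) = subst (λ M → S M ≤ g⁻¹ a) (ℕP.m∸n+n≡m h)
        (≤-slack (g⁻¹ (M ∸ suc a ℕ.+ a)) (0≤g⁻¹ (M ∸ suc a ℕ.+ a)) (sym (high (M ∸ suc a))))

    -- For fixed h the terms are geometric in c, and those above the class of h add up to at most 1
    -- / g (cl h). One factor w_h then becomes at most 2 P_h, because its density is below 2 g (cl
    -- h).
    Σblocking : Σq (upTo N) blocking ≤ 2ℚ * (K * K * Σq jobs (λ j → w j * P j))
    Σblocking = ≤-trans (≤-reflexive (Σ-swap (upTo N) jobs (λ c h → (cl h <ᵇ c) ⊙ (K * K * (w h * w h) * g⁻¹ c))))
      (≤-trans (Σ-mono jobs each) (≤-reflexive (trans (Σ-cong jobs (λ j → comm (K * K) (w j) (P j)))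
        (trans (Σ-*ˡ jobs 2ℚ _) (cong (2ℚ *_) (Σ-*ˡ jobs (K * K) (λ j → w j * P j)))))))
      where
      comm : ∀ k a b → k * (a * (2ℚ * b)) ≡ 2ℚ * (k * (a * b))
      comm = solve-∀ ℚ-ring

      identity : ∀ k a y → k * (a * a) * y ≡ k * (a * (a * y))
      identity = solve-∀ ℚ-ring

      w*g⁻¹ : ∀ h → w h * g⁻¹ (cl h) ≤ 2ℚ * P h
      w*g⁻¹ h = ≤-trans (*-mono-≤ʳ (g⁻¹ (cl h)) (0≤g⁻¹ (cl h)) (≤-trans (≤-reflexive (w≡ρP h)) (*-mono-≤ʳ (P h) (0≤P h) (<⇒≤ (ρ<2g h)))))
        (≤-reflexive (trans (rearrange (g (cl h)) (P h) (g⁻¹ (cl h))) (trans (cong (λ z → 2ℚ * P h * z) (g⁻¹*g≡1 (cl h))) (*-identityʳ _))))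
        where
        rearrange : ∀ a b c → 2ℚ * a * b * c ≡ 2ℚ * b * (c * a)
        rearrange = solve-∀ ℚ-ring

      each : ∀ h → Σq (upTo N) (λ c → (cl h <ᵇ c) ⊙ (K * K * (w h * w h) * g⁻¹ c)) ≤ K * K * (w h * (2ℚ * P h))
      each h = ≤-trans (≤-reflexive (trans (Σ-cong (upTo N) (λ c → ⊙-*ˡ (cl h <ᵇ c) (K * K * (w h * w h)) (g⁻¹ c))) (Σ-*ˡ (upTo N) (K * K * (w h * w h)) _)))
        (≤-trans (*-mono-≤ˡ (K * K * (w h * w h)) (*-nonneg (*-nonneg 0≤K 0≤K) (*-nonneg (0≤w h) (0≤w h))) (Σg⁻¹-above (cl h) N))
        (≤-trans (≤-reflexive (identity (K * K) (w h) (g⁻¹ (cl h))))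
          (*-mono-≤ˡ (K * K) (*-nonneg 0≤K 0≤K) (*-mono-≤ˡ (w h) (0≤w h) (w*g⁻¹ h)))))

    ΣD : Σq (upTo N) (λ c → D.seq (N ∸ c)) ≤ 4ℚ * (3ℚ * (2ℚ * flow))
    ΣD = begin
      Σq (upTo N) (λ c → D.seq (N ∸ c)) ≡⟨ sym (Σ-upTo-reverse N (λ c → D.seq (N ∸ c))) ⟩
      Σq (upTo N) (λ d → D.seq (N ∸ (N ∸ suc d))) ≤⟨ Σ-upTo-mono N (λ d d<N → ≤-reflexive (cong D.seq (ℕP.m∸[m∸n]≡n d<N))) ⟩
      Σq (upTo N) (D.seq ∘ suc) ≤⟨ D.Σseq-suc-≤ D-term-nonneg N ⟩
      4ℚ * Σq (upTo N) (λ d → 3ℚ * (2ℚ * ownFlow (N ∸ suc d))) ≡⟨ cong (4ℚ *_) (trans (Σ-*ˡ (upTo N) 3ℚ _) (cong (3ℚ *_)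
        (trans (Σ-*ˡ (upTo N) 2ℚ _) (cong (2ℚ *_) (trans (Σ-upTo-reverse N ownFlow) ΣownFlow))))) ⟩
      4ℚ * (3ℚ * (2ℚ * flow)) ∎
      where open ≤-Reasoning

    Σsparse-bound : Σq (upTo N) F.seq ≤ 4ℚ * (12ℚ * (4ℚ * (3ℚ * (2ℚ * flow))) + 12ℚ * (2ℚ * (K * K * Σq jobs (λ j → w j * P j))))
    Σsparse-bound = ≤-trans (F.Σseq-≤ F-term-nonneg N) (*-mono-≤ˡ 4ℚ (nonNegative⁻¹ 4ℚ)
      (≤-trans (≤-reflexive (trans (Σ-+ (upTo N) _ _) (cong₂ _+_ (Σ-*ˡ (upTo N) 12ℚ _) (Σ-*ˡ (upTo N) 12ℚ blocking))))
        (+-mono-≤ (*-mono-≤ˡ 12ℚ (nonNegative⁻¹ 12ℚ) ΣD) (*-mono-≤ˡ 12ℚ (nonNegative⁻¹ 12ℚ) Σblocking))))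

  -- Summation over buckets

  Σ-++ : ∀ {A : Set} (xs ys : List A) f → Σq (xs ++ ys) f ≡ Σq xs f + Σq ys f
  Σ-++ [] ys f = sym (+-identityˡ _)
  Σ-++ (x ∷ xs) ys f = trans (cong (f x +_) (Σ-++ xs ys f)) (sym (+-assoc (f x) _ _))

  Σ-map : ∀ {A B : Set} (h : A → B) xs f → Σq (map h xs) f ≡ Σq xs (f ∘ h)
  Σ-map h [] f = refl
  Σ-map h (x ∷ xs) f = cong (f (h x) +_) (Σ-map h xs f)

  Σ-cartesianProduct : ∀ {A B : Set} (xs : List A) (ys : List B) f →
    Σq (cartesianProduct xs ys) f ≡ Σq xs (λ x → Σq ys (λ y → f (x , y)))
  Σ-cartesianProduct [] ys f = refl
  Σ-cartesianProduct (x ∷ xs) ys f = trans (Σ-++ (map (x ,_) ys) (cartesianProduct xs ys) f)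
    (cong₂ _+_ (Σ-map (x ,_) ys f) (Σ-cartesianProduct xs ys f))

  -- Only the largest term of a doubling sequence below the threshold X matters.
  Σ-doubling : (s : ℕ → ℚ) → (∀ i → 0ℚ ≤ s i) → (∀ i → s (suc i) ≡ 2ℚ * s i) → ∀ X → 0ℚ ≤ X → ∀ N →
    Σq (upTo N) (λ i → (s i ℚ.≤ᵇ X) ⊙ s i) ≤ 2ℚ * X
  Σ-doubling s 0≤s s-suc X 0≤X N = proj₂ (both N)
    where
    double : ∀ y → y + y ≡ 2ℚ * y
    double = solve-∀ ℚ-ring

    term : ℕ → ℚ
    term i = (s i ℚ.≤ᵇ X) ⊙ s i

    both : ∀ N → Σq (upTo N) term ≤ s N × Σq (upTo N) term ≤ 2ℚ * X
    both zero = 0≤s 0 , *-nonneg 0≤2ℚ 0≤X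
    both (suc N) = ≤-trans (≤-reflexive (Σ-upTo-suc N term)) (≤-trans (+-mono-≤ (proj₁ (both N)) (⊙-≤ (s N ℚ.≤ᵇ X) (0≤s N)))
        (≤-reflexive (trans (double (s N)) (sym (s-suc N))))) ,
      ≤-trans (≤-reflexive (Σ-upTo-suc N term)) (go (s N ℚ.≤ᵇ X) refl)
      where
      go : ∀ b → (s N ℚ.≤ᵇ X) ≡ b → Σq (upTo N) term + b ⊙ s N ≤ 2ℚ * X
      go true e = ≤-trans (+-monoˡ-≤ (s N) (proj₁ (both N))) (≤-trans (≤-reflexive (double (s N)))
        (*-mono-≤ˡ 2ℚ 0≤2ℚ (≤ᵇq-true⁻¹ {s N} {X} e)))
      go false e = ≤-trans (≤-reflexive (+-identityʳ _)) (proj₂ (both N))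

  -- `δ` assigns each job to exactly one bucket, and within a bucket all values of α lie between
  -- `lo b` and φ times it. A count of jobs therefore converts into a sum of α, from above for the
  -- assigned jobs and from below for the rejected ones, at the loss of one factor φ.
  bucket-sum : ∀ {n} {B : Set} (grid : List B) (δ : B → Fin n → Bool) →
    (∀ j y → Σq grid (λ b → δ b j ⊙ y) ≡ y) →
    (inT rejT : Fin n → Bool) (α : Fin n → ℚ) (lo extra : B → ℚ) (φ K : ℚ) →
    (∀ b → 0ℚ ≤ lo b) → 0ℚ ≤ φ → 0ℚ ≤ K →
    (∀ j → rejT j ≡ true → inT j ≡ true) →
    (∀ b j → δ b j ≡ true → inT j ≡ true → lo b ≤ α j × α j ≤ φ * lo b) →
    (∀ b → Σq (allFin n) (λ j → δ b j ⊙ inT j ⊙ 1ℚ) ≤ K * Σq (allFin n) (λ j → δ b j ⊙ rejT j ⊙ 1ℚ) + extra b) →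
    Σq (allFin n) (λ j → inT j ⊙ α j) ≤
      φ * (K * Σq (allFin n) (λ j → rejT j ⊙ α j)) + φ * Σq grid (λ b → lo b * extra b)
  bucket-sum {n} {B} grid δ δ-sum inT rejT α lo extra φ K 0≤lo 0≤φ 0≤K rej⇒in bounds count = begin
    Σq jobs (λ j → inT j ⊙ α j) ≡⟨ by-bucket inT α ⟩
    Σq grid (λ b → Σq jobs (λ j → δ b j ⊙ inT j ⊙ α j)) ≤⟨ Σ-≤-+ grid _ _ per-bucket ⟩
    Σq grid (λ b → φ * (K * Σq jobs (λ j → δ b j ⊙ rejT j ⊙ α j))) + Σq grid (λ b → φ * (lo b * extra b)) ≡⟨ cong₂ _+_
      (trans (Σ-*ˡ grid φ _) (cong (φ *_) (trans (Σ-*ˡ grid K _) (cong (K *_) (sym (by-bucket rejT α)))))) (Σ-*ˡ grid φ _) ⟩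
    φ * (K * Σq jobs (λ j → rejT j ⊙ α j)) + φ * Σq grid (λ b → lo b * extra b) ∎
    where
    open ≤-Reasoning
    jobs = allFin n

    by-bucket : ∀ (c : Fin n → Bool) (f : Fin n → ℚ) → Σq jobs (λ j → c j ⊙ f j) ≡ Σq grid (λ b → Σq jobs (λ j → δ b j ⊙ c j ⊙ f j))
    by-bucket c f = trans (Σ-cong jobs (λ j → sym (δ-sum j (c j ⊙ f j)))) (Σ-swap jobs grid (λ j b → δ b j ⊙ c j ⊙ f j))

    upper : ∀ b j d i → δ b j ≡ d → inT j ≡ i → d ⊙ i ⊙ α j ≤ φ * lo b * d ⊙ i ⊙ 1ℚ
    upper b j true true e e' = ≤-trans (proj₂ (bounds b j e e')) (≤-reflexive (sym (*-identityʳ _)))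
    upper b j true false e e' = ≤-reflexive (sym (*-zeroʳ (φ * lo b)))
    upper b j false i e e' = ≤-reflexive (sym (*-zeroʳ (φ * lo b)))

    lower : ∀ b j d i → δ b j ≡ d → rejT j ≡ i → lo b * d ⊙ i ⊙ 1ℚ ≤ d ⊙ i ⊙ α j
    lower b j true true e e' = ≤-trans (≤-reflexive (*-identityʳ (lo b))) (proj₁ (bounds b j e (rej⇒in j e')))
    lower b j true false e e' = ≤-reflexive (*-zeroʳ (lo b))
    lower b j false i e e' = ≤-reflexive (*-zeroʳ (lo b))

    rearrange : ∀ φ l k s x → φ * l * (k * s + x) ≡ φ * (k * (l * s)) + φ * (l * x)
    rearrange = solve-∀ ℚ-ring

    per-bucket : ∀ b → Σq jobs (λ j → δ b j ⊙ inT j ⊙ α j) ≤ φ * (K * Σq jobs (λ j → δ b j ⊙ rejT j ⊙ α j)) + φ * (lo b * extra b)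
    per-bucket b = begin
      Σq jobs (λ j → δ b j ⊙ inT j ⊙ α j) ≤⟨ Σ-mono jobs (λ j → upper b j (δ b j) (inT j) refl refl) ⟩
      Σq jobs (λ j → φ * lo b * δ b j ⊙ inT j ⊙ 1ℚ) ≡⟨ Σ-*ˡ jobs (φ * lo b) _ ⟩
      φ * lo b * Σq jobs (λ j → δ b j ⊙ inT j ⊙ 1ℚ) ≤⟨ *-mono-≤ˡ (φ * lo b) (*-nonneg 0≤φ (0≤lo b)) (count b) ⟩
      φ * lo b * (K * R + extra b) ≡⟨ rearrange φ (lo b) K R (extra b) ⟩
      φ * (K * (lo b * R)) + φ * (lo b * extra b) ≤⟨ +-monoˡ-≤ (φ * (lo b * extra b)) (*-mono-≤ˡ φ 0≤φ (*-mono-≤ˡ K 0≤K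
        (≤-trans (≤-reflexive (sym (Σ-*ˡ jobs (lo b) _))) (Σ-mono jobs (λ j → lower b j (δ b j) (rejT j) refl refl))))) ⟩
      φ * (K * Σq jobs (λ j → δ b j ⊙ rejT j ⊙ α j)) + φ * (lo b * extra b) ∎
      where
      R : ℚ
      R = Σq jobs (λ j → δ b j ⊙ rejT j ⊙ 1ℚ)

  grid² : ℕ → List (ℕ × ℕ)
  grid² N = cartesianProduct (upTo N) (upTo N)

  grid³ : ℕ → List (ℕ × ℕ × ℕ)
  grid³ N = cartesianProduct (upTo N) (grid² N)

  grid²-sum : ∀ N a b y → a ℕ.< N → b ℕ.< N → Σq (grid² N) (λ (i , k) → ((i ≡ᵇ a) ∧ (k ≡ᵇ b)) ⊙ y) ≡ y
  grid²-sum N a b y a<N b<N = trans (Σ-cartesianProduct (upTo N) (upTo N) _)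
    (trans (Σ-cong (upTo N) (λ i → trans (Σ-cong (upTo N) (λ k → ⊙-∧ (i ≡ᵇ a) (k ≡ᵇ b) y)) (Σ-⊙ (upTo N) (i ≡ᵇ a) _)))
    (trans (Σ-upTo-single N a (λ i → Σq (upTo N) (λ k → (k ≡ᵇ b) ⊙ y)) a<N) (Σ-upTo-single N b (λ _ → y) b<N)))

  grid³-sum : ∀ N a b c y → a ℕ.< N → b ℕ.< N → c ℕ.< N →
    Σq (grid³ N) (λ (i , k , l) → ((i ≡ᵇ a) ∧ (k ≡ᵇ b) ∧ (l ≡ᵇ c)) ⊙ y) ≡ y
  grid³-sum N a b c y a<N b<N c<N = trans (Σ-cartesianProduct (upTo N) (grid² N) _)
    (trans (Σ-cong (upTo N) (λ i → trans (Σ-cong (grid² N) (λ (k , l) → ⊙-∧ (i ≡ᵇ a) ((k ≡ᵇ b) ∧ (l ≡ᵇ c)) y)) (Σ-⊙ (grid² N) (i ≡ᵇ a) _)))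
    (trans (Σ-upTo-single N a (λ i → Σq (grid² N) (λ (k , l) → ((k ≡ᵇ b) ∧ (l ≡ᵇ c)) ⊙ y)) a<N) (grid²-sum N b c y b<N c<N)))

  -- Cost of the incomplete groups of one density class c: a bucket (a , b) can be nonempty only if
  -- g a ≤ 2 g b X and K g c g b ≤ X, where X bounds the weight of the lower classes.
  leftover-class : (g : ℕ → ℚ) → (∀ i → 0ℚ < g i) → (∀ i → g (suc i) ≡ 2ℚ * g i) →
    (K : ℚ) → 0ℚ ≤ K → ∀ X → 0ℚ ≤ X → ∀ f c → X * X ≤ g c * f → ∀ N (used : ℕ → ℕ → Bool) →
    (∀ a b → used a b ≡ true → g a ≤ 2ℚ * g b * X × K * g c * g b ≤ X) →
    Σq (upTo N) (λ b → Σq (upTo N) (λ a → g a * used a b ⊙ K)) ≤ 2ℚ * (4ℚ * f)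
  leftover-class g 0<g g-suc K 0≤K X 0≤X f c X² N used small = *-cancel-≤ (g c) (0<g c) (begin
    g c * Σq (upTo N) (λ b → Σq (upTo N) (λ a → g a * used a b ⊙ K)) ≡⟨ sym (Σ-*ˡ (upTo N) (g c) _) ⟩
    Σq (upTo N) (λ b → g c * Σq (upTo N) (λ a → g a * used a b ⊙ K)) ≤⟨ Σ-mono (upTo N) row ⟩
    Σq (upTo N) (λ b → 4ℚ * X * (s b ℚ.≤ᵇ X) ⊙ s b) ≡⟨ Σ-*ˡ (upTo N) (4ℚ * X) _ ⟩
    4ℚ * X * Σq (upTo N) (λ b → (s b ℚ.≤ᵇ X) ⊙ s b) ≤⟨ *-mono-≤ˡ (4ℚ * X) (*-nonneg (nonNegative⁻¹ 4ℚ) 0≤X)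
      (Σ-doubling s 0≤s s-suc X 0≤X N) ⟩
    4ℚ * X * (2ℚ * X) ≡⟨ id₁ X ⟩
    2ℚ * (4ℚ * (X * X)) ≤⟨ *-mono-≤ˡ 2ℚ 0≤2ℚ (*-mono-≤ˡ 4ℚ (nonNegative⁻¹ 4ℚ) X²) ⟩
    2ℚ * (4ℚ * (g c * f)) ≡⟨ id₂ (g c) f ⟩
    g c * (2ℚ * (4ℚ * f)) ∎)
    where
    open ≤-Reasoning
    id₁ : ∀ x → 4ℚ * x * (2ℚ * x) ≡ 2ℚ * (4ℚ * (x * x))
    id₁ = solve-∀ ℚ-ring
    id₂ : ∀ a b → 2ℚ * (4ℚ * (a * b)) ≡ a * (2ℚ * (4ℚ * b))
    id₂ = solve-∀ ℚ-ring
    id₃ : ∀ k a b → k * a * (2ℚ * b) ≡ 2ℚ * (k * a * b)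
    id₃ = solve-∀ ℚ-ring
    id₄ : ∀ k c b x → k * c * (2ℚ * (2ℚ * b * x)) ≡ 4ℚ * x * (k * c * b)
    id₄ = solve-∀ ℚ-ring

    0≤g : ∀ i → 0ℚ ≤ g i
    0≤g i = <⇒≤ (0<g i)

    s : ℕ → ℚ
    s b = K * g c * g b

    0≤Kg : 0ℚ ≤ K * g c
    0≤Kg = *-nonneg 0≤K (0≤g c)

    0≤s : ∀ b → 0ℚ ≤ s b
    0≤s b = *-nonneg 0≤Kg (0≤g b)

    s-suc : ∀ b → s (suc b) ≡ 2ℚ * s b
    s-suc b = trans (cong (K * g c *_) (g-suc b)) (id₃ K (g c) (g b))

    0≤Y : ∀ b → 0ℚ ≤ 2ℚ * g b * X
    0≤Y b = *-nonneg (*-nonneg 0≤2ℚ (0≤g b)) 0≤X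

    entry : ∀ b a u → used a b ≡ u → g c * (g a * u ⊙ K) ≤ (s b ℚ.≤ᵇ X) ⊙ (K * g c * (g a ℚ.≤ᵇ (2ℚ * g b * X)) ⊙ g a)
    entry b a false _ = ≤-trans (≤-reflexive (trans (cong (g c *_) (*-zeroʳ (g a))) (*-zeroʳ (g c))))
      (⊙-nonneg (s b ℚ.≤ᵇ X) (*-nonneg 0≤Kg (⊙-nonneg (g a ℚ.≤ᵇ (2ℚ * g b * X)) (0≤g a))))
    entry b a true e = ≤-reflexive (trans (comm (g c) (g a) K) (sym (cong₂ (λ d e → d ⊙ (K * g c * e ⊙ g a))
      (≤ᵇq-true (proj₂ (small a b e))) (≤ᵇq-true (proj₁ (small a b e))))))
      where
      comm : ∀ x y z → x * (y * z) ≡ z * x * y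
      comm = solve-∀ ℚ-ring

    row : ∀ b → g c * Σq (upTo N) (λ a → g a * used a b ⊙ K) ≤ 4ℚ * X * (s b ℚ.≤ᵇ X) ⊙ s b
    row b = begin
      g c * Σq (upTo N) (λ a → g a * used a b ⊙ K) ≡⟨ sym (Σ-*ˡ (upTo N) (g c) _) ⟩
      Σq (upTo N) (λ a → g c * (g a * used a b ⊙ K)) ≤⟨ Σ-mono (upTo N) (λ a → entry b a (used a b) refl) ⟩
      Σq (upTo N) (λ a → (s b ℚ.≤ᵇ X) ⊙ (K * g c * (g a ℚ.≤ᵇ (2ℚ * g b * X)) ⊙ g a)) ≡⟨ trans (Σ-⊙ (upTo N) (s b ℚ.≤ᵇ X) _)
        (cong ((s b ℚ.≤ᵇ X) ⊙_) (Σ-*ˡ (upTo N) (K * g c) _)) ⟩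
      (s b ℚ.≤ᵇ X) ⊙ (K * g c * Σq (upTo N) (λ a → (g a ℚ.≤ᵇ (2ℚ * g b * X)) ⊙ g a)) ≤⟨ ⊙-mono (s b ℚ.≤ᵇ X) (λ _ →
        *-mono-≤ˡ (K * g c) 0≤Kg (Σ-doubling g 0≤g g-suc (2ℚ * g b * X) (0≤Y b) N)) ⟩
      (s b ℚ.≤ᵇ X) ⊙ (K * g c * (2ℚ * (2ℚ * g b * X))) ≡⟨ cong ((s b ℚ.≤ᵇ X) ⊙_) (id₄ K (g c) (g b) X) ⟩
      (s b ℚ.≤ᵇ X) ⊙ (4ℚ * X * s b) ≡⟨ ⊙-*ˡ (s b ℚ.≤ᵇ X) (4ℚ * X) (s b) ⟩
      4ℚ * X * (s b ℚ.≤ᵇ X) ⊙ s b ∎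

  -- The maximum over a decidable subset, with 0 as value when the subset is empty. As X is 0 or
  -- attained, the bound on the individual squares passes to X * X.
  bounded-max : ∀ {n} (f : Fin n → ℚ) (c : Fin n → Bool) B → 0ℚ ≤ B → (∀ j → c j ≡ true → 0ℚ ≤ f j × f j * f j ≤ B) →
    ∃[ X ] (0ℚ ≤ X × X * X ≤ B × (∀ j → c j ≡ true → f j ≤ X))
  bounded-max {zero} f c B 0≤B h = 0ℚ , ≤-refl , 0≤B , λ ()
  bounded-max {suc n} f c B 0≤B h = go (bounded-max (f ∘ suc) (c ∘ suc) B 0≤B (h ∘ suc)) (c zero) refl
    where
    go : ∃[ X ] (0ℚ ≤ X × X * X ≤ B × (∀ j → c (suc j) ≡ true → f (suc j) ≤ X)) → ∀ b → c zero ≡ b →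
      ∃[ X ] (0ℚ ≤ X × X * X ≤ B × (∀ j → c j ≡ true → f j ≤ X))
    go (X , 0≤X , X²≤B , max) false e = X , 0≤X , X²≤B , λ { zero e' → contradiction e e' ; (suc j) → max j }
      where
      contradiction : ∀ {b} {A : Set} → b ≡ false → b ≡ true → A
      contradiction refl ()
    go (X , 0≤X , X²≤B , max) true e = choose (≤-total (f zero) X)
      where
      choose : f zero ≤ X ⊎ X ≤ f zero → ∃[ X ] (0ℚ ≤ X × X * X ≤ B × (∀ j → c j ≡ true → f j ≤ X))
      choose (inj₁ f≤X) = X , 0≤X , X²≤B , λ { zero _ → f≤X ; (suc j) → max j }
      choose (inj₂ X≤f) = f zero , proj₁ (h zero e) , proj₂ (h zero e) , λ { zero _ → ≤-refl ; (suc j) e' → ≤-trans (max j e') X≤f }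

  -- The tables T⁺ and T⁻

  1/n*n≡1 : ∀ m → ((ℤ.+ 1) ℚ./ suc m) * ℚof (suc m) ≡ 1ℚ
  1/n*n≡1 m = toℚᵘ-injective (ℚᵘP.≃-trans (toℚᵘ-homo-* ((ℤ.+ 1) ℚ./ suc m) (ℚof (suc m)))
    (ℚᵘP.≃-trans (ℚᵘP.*-cong (toℚᵘ-fromℚᵘ (ℚᵘ.mkℚᵘ (ℤ.+ 1) m)) (toℚᵘ-fromℚᵘ (ℚᵘ.mkℚᵘ (ℤ.+ suc m) 0)))
      (ℚᵘ.*≡* lemma)))
    where
    lemma : (ℤ.+ 1 ℤ.* ℤ.+ suc m) ℤ.* ℤ.+ 1 ≡ ℤ.+ 1 ℤ.* ℤ.+ (suc m ℕ.* 1)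
    lemma = trans (ℤP.*-identityʳ _) (cong (λ z → ℤ.+ 1 ℤ.* ℤ.+ z) (sym (ℕP.*-identityʳ (suc m))))

  pow2-mono : ∀ {z z'} → z ℤ.≤ z' → pow2 z ≤ pow2 z'
  pow2-mono {z} {z'} z≤z' = subst₂ (λ a b → pow2 a ≤ pow2 b) (level-index M z (ℕP.m≤m+n _ _)) (level-index M z' (ℕP.m≤n+m _ _))
    (subst (λ b → pow2 (level M a) ≤ pow2 (level M b)) (ℕP.m∸n+n≡m a≤b) (go (b ∸ a)))
    where
    M a b : ℕ
    M = ℤ.∣ z ∣ ℕ.+ ℤ.∣ z' ∣
    a = index M z
    b = index M z'

    a≤b : a ℕ.≤ b
    a≤b = index-mono-≤ M (ℕP.m≤m+n _ _) (ℕP.m≤n+m _ _) z≤z'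

    double : ∀ y → 2ℚ * y ≡ y + y
    double = solve-∀ ℚ-ring

    go : ∀ d → pow2 (level M a) ≤ pow2 (level M (d ℕ.+ a))
    go zero = ≤-refl
    go (suc d) = ≤-trans (go d) (≤-slack (pow2 (level M (d ℕ.+ a))) (<⇒≤ (pow2-positive (level M (d ℕ.+ a))))
      (trans (pow2-level-suc M (d ℕ.+ a)) (double (pow2 (level M (d ℕ.+ a))))))

  flog2-<⇒< : ∀ {x y} → 0ℚ < x → 0ℚ < y → flog2 x ℤ.< flog2 y → x < y
  flog2-<⇒< {x} {y} 0<x 0<y lt = <-≤-trans (proj₂ (flog2-bounds x 0<x))
    (≤-trans (≤-reflexive (sym (pow2-suc (flog2 x)))) (≤-trans (pow2-mono (ℤP.i<j⇒suc[i]≤j lt)) (proj₁ (flog2-bounds y 0<y))))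

  ≤ᵇℤ-false⁻¹ : ∀ {a b} → (a ℤ.≤ᵇ b) ≡ false → b ℤ.< a
  ≤ᵇℤ-false⁻¹ e = ℤP.≰⇒> (λ h → false⇒¬T e (ℤP.≤⇒≤ᵇ h))

  module Rejection {n : ℕ} (k : ℕ) (I : Instance n) (sel : ℕ → (Fin n → Bool) → Fin n)
    (0<w : ∀ j → 0ℚ < Instance.w I j) where
    open Simulation k I sel
    open Scheduling k I sel

    P : Fin n → ℚ
    P j = ℚof (p j)

    0<P : ∀ j → 0ℚ < P j
    0<P j = 0<ℚof-suc (pm1 j)

    w≡ρP : ∀ j → w j ≡ ρ j * P j
    w≡ρP j = sym (trans (*-assoc (w j) _ _) (trans (cong (w j *_) (1/n*n≡1 (pm1 j))) (*-identityʳ (w j))))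

    0<ρ : ∀ j → 0ℚ < ρ j
    0<ρ j = *-cancelʳ-<-nonNeg (P j) {{nonNegative (<⇒≤ (0<P j))}} (subst₂ _<_ (sym (*-zeroˡ (P j))) (w≡ρP j) (0<w j))

    q : ℕ → Fin n → ℚ
    q t i = ℚof (rem (S t) i)

    earlier : Fin n → Fin n → Bool
    earlier j i = bef (r j) (toℕ j) i ∧ not (rejected i)

    module _ (t : ℕ) (s : St n) (j : Fin n) where
      open Arrival t s j

      -- With w_j = ρ_j P_j the coefficient P_j factors out of all three sums. What remains on a job
      -- i is ρ_j if i is at least as dense and ρ_i otherwise; a job of a lower density class is
      -- strictly sparser, so it falls under the second case.
      α-total : α⁺ + α⁻ ≡ P j * Σq jobs (λ i → activeAt t s j i ⊙ ((ρ i ⊓ ρ j) * ℚof (rem s i)))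
      α-total = trans (cong₂ _+_ α⁺-def α⁻-def) (trans (cong (λ z → z * X + P j * Y + P j * Z) (w≡ρP j)) (trans (factor (ρ j) (P j) X Y Z)
        (cong (P j *_) (trans (cong (λ z → z + Y + Z) (sym (Σ-*ˡ jobs (ρ j) _)))
          (trans (cong (_+ Z) (sym (Σ-+ jobs _ _))) (trans (sym (Σ-+ jobs _ _))
            (Σ-cong jobs (λ i → pointwise i (activeAt t s j i) (flog2 (ρ j) ℤ.≤ᵇ flog2 (ρ i)) (ρ j ℚ.≤ᵇ ρ i) refl refl))))))))
        where
        X Y Z : ℚ
        X = Σq jobs (λ i → (D⁺ i ∧ (ρ j ℚ.≤ᵇ ρ i)) ⊙ ℚof (rem s i))
        Y = Σq jobs (λ i → (D⁺ i ∧ (ρ i <ᵇq ρ j)) ⊙ wrem s i)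
        Z = Σq jobs (λ i → D⁻ i ⊙ wrem s i)

        factor : ∀ a b x y z → a * b * x + b * y + b * z ≡ b * (a * x + y + z)
        factor = solve-∀ ℚ-ring

        pointwise : ∀ i A c d → (flog2 (ρ j) ℤ.≤ᵇ flog2 (ρ i)) ≡ c → (ρ j ℚ.≤ᵇ ρ i) ≡ d →
          ρ j * ((A ∧ c) ∧ d) ⊙ ℚof (rem s i) + ((A ∧ c) ∧ not d) ⊙ wrem s i + (A ∧ not c) ⊙ wrem s i
            ≡ A ⊙ ((ρ i ⊓ ρ j) * ℚof (rem s i))
        pointwise i false c d _ _ = cong (λ z → z + 0ℚ + 0ℚ) (*-zeroʳ (ρ j))
        pointwise i true true true _ e = trans (trans (+-identityʳ _) (+-identityʳ _))
          (cong (_* ℚof (rem s i)) (sym (p≥q⇒p⊓q≡q {ρ i} {ρ j} (≤ᵇq-true⁻¹ {ρ j} {ρ i} e))))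
        pointwise i true true false _ e = trans (trans (+-identityʳ _) (cong (_+ wrem s i) (*-zeroʳ (ρ j))))
          (trans (+-identityˡ (wrem s i)) (cong (_* ℚof (rem s i)) (sym (p≤q⇒p⊓q≡p {ρ i} {ρ j} (<⇒≤ (≤ᵇq-false⁻¹ {ρ j} {ρ i} e))))))
        pointwise i true false d e _ = trans (cong (λ z → z + 0ℚ + wrem s i) (*-zeroʳ (ρ j)))
          (trans (+-identityˡ (wrem s i)) (cong (_* ℚof (rem s i))
            (sym (p≤q⇒p⊓q≡p {ρ i} {ρ j} (<⇒≤ (flog2-<⇒< (0<ρ i) (0<ρ j) (≤ᵇℤ-false⁻¹ e)))))))

      α⁻-active : α⁻ ≡ P j * Σq jobs (λ i → activeAt t s j i ⊙ (not (flog2 (ρ j) ℤ.≤ᵇ flog2 (ρ i)) ⊙ ρ i * ℚof (rem s i)))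
      α⁻-active = trans α⁻-def (cong (P j *_) (Σ-cong jobs (λ i → pointwise i (activeAt t s j i) (not (flog2 (ρ j) ℤ.≤ᵇ flog2 (ρ i))))))
        where
        pointwise : ∀ i a c → (a ∧ c) ⊙ wrem s i ≡ a ⊙ (c ⊙ ρ i * ℚof (rem s i))
        pointwise i false c = refl
        pointwise i true false = sym (*-zeroˡ (ℚof (rem s i)))
        pointwise i true true = refl

    rem-sAt : ∀ j i → rem (sAt j) i ≡ rem (S (r j)) i
    rem-sAt j i = trans (cong (λ f → f i) (rem-mid (r j) (toℕ j))) (sym (cong (λ s → rem s i) (S≡state (r j))))

    -- Being unfinished need not be tested, because a finished job contributes a zero factor; being
    -- not rejected is read off from `rej-mid`.
    active-⊙ : ∀ j i y → activeAt (r j) (sAt j) j i ⊙ (y * ℚof (rem (sAt j) i)) ≡ earlier j i ⊙ (y * q (r j) i)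
    active-⊙ j i y = trans (cong (λ z → (bef (r j) (toℕ j) i ∧ (0 <ᵇ rem (sAt j) i) ∧ not z) ⊙ (y * ℚof (rem (sAt j) i)))
        (rej-mid (r j) (toℕ j) (ℕP.<⇒≤ (FinP.toℕ<n j)) i))
      (trans (cong (λ m → (bef (r j) (toℕ j) i ∧ (0 <ᵇ m) ∧ not (bef (r j) (toℕ j) i ∧ rejected i)) ⊙ (y * ℚof m)) (rem-sAt j i))
        (go (bef (r j) (toℕ j) i) (rem (S (r j)) i) (rejected i)))
      where
      go : ∀ b m c → (b ∧ (0 <ᵇ m) ∧ not (b ∧ c)) ⊙ (y * ℚof m) ≡ (b ∧ not c) ⊙ (y * ℚof m)
      go false m c = refl
      go true zero true = refl
      go true zero false = sym (*-zeroʳ y)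
      go true (suc m) c = refl

    α⁺ α⁻ : Fin n → ℚ
    α⁺ j = Arrival.α⁺ (r j) (sAt j) j
    α⁻ j = Arrival.α⁻ (r j) (sAt j) j

    inT⁺ inT⁻ rej⁺ rej⁻ : Fin n → Bool
    inT⁺ j = Arrival.inT⁺ (r j) (sAt j) j
    inT⁻ j = Arrival.inT⁻ (r j) (sAt j) j
    rej⁺ j = Arrival.rej⁺ (r j) (sAt j) j
    rej⁻ j = Arrival.rej⁻ (r j) (sAt j) j

    α-delay : ∀ j → α⁺ j + α⁻ j ≡ P j * Σq jobs (λ i → earlier j i ⊙ ((ρ i ⊓ ρ j) * q (r j) i))
    α-delay j = trans (α-total (r j) (sAt j) j) (cong (P j *_) (Σ-cong jobs (λ i → active-⊙ j i (ρ i ⊓ ρ j))))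

    α⁻-sparse : ∀ j → α⁻ j ≡ P j * Σq jobs (λ i → earlier j i ⊙ (not (flog2 (ρ j) ℤ.≤ᵇ flog2 (ρ i)) ⊙ ρ i * q (r j) i))
    α⁻-sparse j = trans (α⁻-active (r j) (sAt j) j) (cong (P j *_)
      (Σ-cong jobs (λ i → active-⊙ j i (not (flog2 (ρ j) ℤ.≤ᵇ flog2 (ρ i)) ⊙ ρ i))))

    0≤α⁺ : ∀ j → 0ℚ ≤ α⁺ j
    0≤α⁺ j = subst (0ℚ ≤_) (sym (Arrival.α⁺-def (r j) (sAt j) j)) (+-nonneg
      (*-nonneg (<⇒≤ (0<w j)) (Σ-nonneg jobs (λ i → ⊙-nonneg (Arrival.D⁺ (r j) (sAt j) j i ∧ (ρ j ℚ.≤ᵇ ρ i)) (0≤ℚof (rem (sAt j) i)))))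
      (*-nonneg (<⇒≤ (0<P j)) (Σ-nonneg jobs (λ i → ⊙-nonneg (Arrival.D⁺ (r j) (sAt j) j i ∧ (ρ i <ᵇq ρ j))
        (*-nonneg (<⇒≤ (0<ρ i)) (0≤ℚof (rem (sAt j) i)))))))

    0≤α⁻ : ∀ j → 0ℚ ≤ α⁻ j
    0≤α⁻ j = subst (0ℚ ≤_) (sym (Arrival.α⁻-def (r j) (sAt j) j)) (*-nonneg (<⇒≤ (0<P j))
      (Σ-nonneg jobs (λ i → ⊙-nonneg (Arrival.D⁻ (r j) (sAt j) j i)
        (*-nonneg (<⇒≤ (0<ρ i)) (0≤ℚof (rem (sAt j) i))))))

    d : ℕ
    d = suc (k ∸ 1)

    key⁺₁ key⁺₂ key⁻₁ key⁻₂ key⁻₃ : Fin n → ℤ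
    key⁺₁ j = Arrival.key⁺₁ (r j) (sAt j) j
    key⁺₂ j = Arrival.key⁺₂ (r j) (sAt j) j
    key⁻₁ j = Arrival.key⁻₁ (r j) (sAt j) j
    key⁻₂ j = Arrival.key⁻₂ (r j) (sAt j) j
    key⁻₃ j = Arrival.key⁻₃ (r j) (sAt j) j

    bucket⁺ : ℤ → ℤ → Fin n → Bool
    bucket⁺ a b j = (a ≡ᵇℤ key⁺₁ j) ∧ (b ≡ᵇℤ key⁺₂ j)

    bucket⁻ : ℤ → ℤ → ℤ → Fin n → Bool
    bucket⁻ a b c j = (a ≡ᵇℤ key⁻₁ j) ∧ (b ≡ᵇℤ key⁻₂ j) ∧ (c ≡ᵇℤ key⁻₃ j)

    mid-arrive : ∀ {X : Set} (f : St n → X) t j → r j ≡ t → f (mid t (suc (toℕ j))) ≡ f (arrive t (mid t (toℕ j)) j)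
    mid-arrive f t j eq = trans (cong f (mid-suc t j)) (lemma (r j ≡ᵇ t) (trans (cong (_≡ᵇ t) eq) (≡ᵇ-refl t)))
      where
      lemma : ∀ b → b ≡ true → f (if b then arrive t (mid t (toℕ j)) j else mid t (toℕ j)) ≡ f (arrive t (mid t (toℕ j)) j)
      lemma true _ = refl

    mid-skip : ∀ {X : Set} (f : St n → X) t j → (r j ≡ᵇ t) ≡ false → f (mid t (suc (toℕ j))) ≡ f (mid t (toℕ j))
    mid-skip f t j e = trans (cong f (mid-suc t j)) (lemma (r j ≡ᵇ t) e)
      where
      lemma : ∀ b → b ≡ false → f (if b then arrive t (mid t (toℕ j)) j else mid t (toℕ j)) ≡ f (mid t (toℕ j))
      lemma false _ = refl

    mid-next : ∀ {X : Set} (f : St n → X) → (∀ s L m c t → f (record s { inL = L ; rem = m ; cur = c ; start = t }) ≡ f s) →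
      ∀ t → f (mid (suc t) 0) ≡ f (mid t n)
    mid-next f h t = trans (cong f (mid-zero (suc t))) (trans (step-other f h t (arrivals t (state t))) (cong f (sym (mid-n t))))

    -- One bucket of either table, seen as a counter over stages. The offset is 0 for T⁺, which
    -- rejects when the old count is a multiple of d, and 1 for T⁻, which rejects when the new count
    -- is.
    record Counter (off : ℕ) (inB rejB : Fin n → Bool) (cnt : ℕ → ℕ → ℕ) : Set where
      field
        cnt-zero   : cnt 0 0 ≡ 0
        cnt-arrive : ∀ j → cnt (r j) (suc (toℕ j)) ≡ (if inB j then suc (cnt (r j) (toℕ j)) else cnt (r j) (toℕ j))
        cnt-skip   : ∀ t j → (r j ≡ᵇ t) ≡ false → cnt t (suc (toℕ j)) ≡ cnt t (toℕ j)
        cnt-next   : ∀ t → cnt (suc t) 0 ≡ cnt t n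
        rejB-def   : ∀ j → rejB j ≡ inB j ∧ (ℕD._%_ (off ℕ.+ cnt (r j) (toℕ j)) d ≡ᵇ 0)

    cnt⁺ : ℤ → ℤ → ℕ → ℕ → ℕ
    cnt⁺ a b t m = tplus (mid t m) a b

    cnt⁻ : ℤ → ℤ → ℤ → ℕ → ℕ → ℕ
    cnt⁻ a b c t m = tminus (mid t m) a b c

    -- The rule reads the counter at the keys of the arriving job, the bucket argument at fixed
    -- keys. Both readings coincide where the keys match, and elsewhere both sides are false.
    match² : ∀ {a b a' b' : ℤ} (da : Dec (a ≡ a')) (db : Dec (b ≡ b')) i (f : ℤ → ℤ → Bool) →
      (does da ∧ does db) ∧ (i ∧ f a' b') ≡ (i ∧ does da ∧ does db) ∧ f a b
    match² (yes refl) (yes refl) true f = refl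
    match² (yes refl) (yes refl) false f = refl
    match² (yes _) (no _) true f = refl
    match² (yes _) (no _) false f = refl
    match² (no _) _ true f = refl
    match² (no _) _ false f = refl

    match³ : ∀ {a b c a' b' c' : ℤ} (da : Dec (a ≡ a')) (db : Dec (b ≡ b')) (dc : Dec (c ≡ c')) i (f : ℤ → ℤ → ℤ → Bool) →
      (does da ∧ does db ∧ does dc) ∧ (i ∧ f a' b' c') ≡ (i ∧ does da ∧ does db ∧ does dc) ∧ f a b c
    match³ (yes refl) db dc i f = match² db dc i (f _)
    match³ (no _) db dc true f = refl
    match³ (no _) db dc false f = refl

    counter⁺ : ∀ a b → Counter 0 (λ j → inT⁺ j ∧ bucket⁺ a b j) (λ j → bucket⁺ a b j ∧ rej⁺ j) (cnt⁺ a b)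
    counter⁺ a b = record
      { cnt-zero = cong (λ s → tplus s a b) (mid-zero 0)
      ; cnt-arrive = λ j → trans (mid-arrive (λ s → tplus s a b) (r j) j refl) (Arrival.arrive-tplus (r j) (sAt j) j a b)
      ; cnt-skip = mid-skip (λ s → tplus s a b)
      ; cnt-next = mid-next (λ s → tplus s a b) (λ _ _ _ _ _ → refl)
      ; rejB-def = λ j → trans (cong (bucket⁺ a b j ∧_) (Arrival.rej⁺-def (r j) (sAt j) j))
          (match² (a ℤP.≟ key⁺₁ j) (b ℤP.≟ key⁺₂ j) (inT⁺ j) (λ a b → ℕD._%_ (cnt⁺ a b (r j) (toℕ j)) d ≡ᵇ 0))
      }

    counter⁻ : ∀ a b c → Counter 1 (λ j → inT⁻ j ∧ bucket⁻ a b c j) (λ j → bucket⁻ a b c j ∧ rej⁻ j) (cnt⁻ a b c)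
    counter⁻ a b c = record
      { cnt-zero = cong (λ s → tminus s a b c) (mid-zero 0)
      ; cnt-arrive = λ j → trans (mid-arrive (λ s → tminus s a b c) (r j) j refl) (Arrival.arrive-tminus (r j) (sAt j) j a b c)
      ; cnt-skip = mid-skip (λ s → tminus s a b c)
      ; cnt-next = mid-next (λ s → tminus s a b c) (λ _ _ _ _ _ → refl)
      ; rejB-def = λ j → trans (cong (bucket⁻ a b c j ∧_) (Arrival.rej⁻-def (r j) (sAt j) j))
          (match³ (a ℤP.≟ key⁻₁ j) (b ℤP.≟ key⁻₂ j) (c ℤP.≟ key⁻₃ j) (inT⁻ j)
            (λ a b c → ℕD._%_ (suc (cnt⁻ a b c (r j) (toℕ j))) d ≡ᵇ 0))
      }

    upper-bound : ∀ {m} (f : Fin m → ℕ) → ∃[ B ] (∀ i → f i ℕ.≤ B)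
    upper-bound {zero} f = 0 , λ ()
    upper-bound {suc m} f = f zero ℕ.+ proj₁ rest ,
      λ { zero → ℕP.m≤m+n (f zero) _ ; (suc i) → ℕP.≤-trans (proj₂ rest i) (ℕP.m≤n+m _ (f zero)) }
      where
      rest : ∃[ B ] (∀ i → f (suc i) ℕ.≤ B)
      rest = upper-bound (f ∘ suc)

    module _ {off inB rejB cnt} (counter : Counter off inB rejB cnt) where
      open Counter counter

      seen : ℕ → ℕ → (Fin n → Bool) → ℚ
      seen t m c = Σq jobs (λ i → bef t m i ⊙ c i ⊙ 1ℚ)

      seen-step : ∀ t j c → seen t (suc (toℕ j)) c ≡ seen t (toℕ j) c + (r j ≡ᵇ t) ⊙ c j ⊙ 1ℚ
      seen-step t j c = trans (Σ-cong jobs (λ i → pointwise i (i ≡ᵇF j) refl)) (trans (Σ-+ jobs _ _)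
        (cong (seen t (toℕ j) c +_) (Σ-single j (λ i → (r i ≡ᵇ t) ⊙ c i ⊙ 1ℚ))))
        where
        pointwise : ∀ i b → (i ≡ᵇF j) ≡ b →
          bef t (suc (toℕ j)) i ⊙ c i ⊙ 1ℚ ≡ bef t (toℕ j) i ⊙ c i ⊙ 1ℚ + b ⊙ (r i ≡ᵇ t) ⊙ c i ⊙ 1ℚ
        pointwise i false e = trans (cong (_⊙ (c i ⊙ 1ℚ)) (bef-step-≢ t j i (≡ᵇ-false⁻¹ {toℕ i} {toℕ j} e))) (sym (+-identityʳ _))
        pointwise i true e = at-self (FinP.toℕ-injective {i = i} {j} (≡ᵇ-true⁻¹ e))
          where
          at-self : i ≡ j → bef t (suc (toℕ j)) i ⊙ c i ⊙ 1ℚ ≡ bef t (toℕ j) i ⊙ c i ⊙ 1ℚ + (r i ≡ᵇ t) ⊙ c i ⊙ 1ℚ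
          at-self refl = by-release (r i ≡ᵇ t) refl
            where
            by-release : ∀ b → (r i ≡ᵇ t) ≡ b → bef t (suc (toℕ i)) i ⊙ c i ⊙ 1ℚ ≡ bef t (toℕ i) i ⊙ c i ⊙ 1ℚ + b ⊙ c i ⊙ 1ℚ
            by-release false e = trans (cong (_⊙ (c i ⊙ 1ℚ)) (bef-step-idle t i i e)) (sym (+-identityʳ _))
            by-release true e = trans (cong (_⊙ (c i ⊙ 1ℚ)) (trans (cong (λ t → bef t (suc (toℕ i)) i) (sym ri)) (bef-self-after i)))
              (trans (sym (+-identityˡ (c i ⊙ 1ℚ))) (cong (λ b → b ⊙ (c i ⊙ 1ℚ) + c i ⊙ 1ℚ)
                (sym (trans (cong (λ t → bef t (toℕ i) i) (sym ri)) (bef-self-before i)))))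
              where
              ri : r i ≡ t
              ri = ≡ᵇ-true⁻¹ {r i} {t} e

      -- In each group of d jobs of a bucket, the first one (off = 0) or the last one (off = 1) is rejected.
      Counted : ℕ → ℕ → Set
      Counted t m = seen t m inB ≡ ℚof (cnt t m) ×
        ∃[ R ] (seen t m rejB ≡ ℚof R × off ℕ.+ cnt t m ℕ.≤ d ℕ.* (R ℕ.+ off))

      counted : ∀ t m → m ℕ.≤ n → Counted t m
      counted = arrival-induction Counted base arriving next
        where
        nothing-seen : ∀ c → seen 0 0 c ≡ 0ℚ
        nothing-seen c = trans (Σ-cong jobs (λ i → cong (_⊙ (c i ⊙ 1ℚ)) (bef-zero 0 i))) (Σ-zero jobs)

        base : Counted 0 0
        base = trans (nothing-seen inB) (cong ℚof (sym cnt-zero)) , 0 , nothing-seen rejB ,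
          subst (λ c → off ℕ.+ c ℕ.≤ d ℕ.* off) (sym cnt-zero) (ℕP.≤-trans (ℕP.≤-reflexive (ℕP.+-identityʳ off)) (ℕP.m≤n*m off d))

        next : ∀ t → Counted t n → Counted (suc t) 0
        next t (eq , R , eqR , le) = trans (same inB) (trans eq (cong ℚof (sym (cnt-next t)))) , R ,
          trans (same rejB) eqR , subst (λ c → off ℕ.+ c ℕ.≤ d ℕ.* (R ℕ.+ off)) (sym (cnt-next t)) le
          where
          same : ∀ c → seen (suc t) 0 c ≡ seen t n c
          same c = Σ-cong jobs (λ i → cong (_⊙ (c i ⊙ 1ℚ)) (sym (bef-next t i)))

        module _ (t : ℕ) (j : Fin n) (ih : Counted t (toℕ j)) where
          C R : ℕ
          C = cnt t (toℕ j)
          R = proj₁ (proj₂ ih)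

          covered : off ℕ.+ C ℕ.≤ d ℕ.* (R ℕ.+ off)
          covered = proj₂ (proj₂ (proj₂ ih))

          skipped : (r j ≡ᵇ t) ≡ false → Counted t (suc (toℕ j))
          skipped e = trans (same inB) (trans (proj₁ ih) (cong ℚof (sym (cnt-skip t j e)))) , R ,
            trans (same rejB) (proj₁ (proj₂ (proj₂ ih))) , subst (λ c → off ℕ.+ c ℕ.≤ d ℕ.* (R ℕ.+ off)) (sym (cnt-skip t j e)) covered
            where
            same : ∀ c → seen t (suc (toℕ j)) c ≡ seen t (toℕ j) c
            same c = trans (seen-step t j c) (trans (cong (λ b → seen t (toℕ j) c + b ⊙ c j ⊙ 1ℚ) e) (+-identityʳ _))

          taken : r j ≡ t → ∀ ib z → inB j ≡ ib → (ℕD._%_ (off ℕ.+ C) d ≡ᵇ 0) ≡ z → Counted t (suc (toℕ j))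
          taken refl ib z eI eZ = by-case ib z eI (trans (rejB-def j) (cong₂ _∧_ eI eZ)) eZ
            where
            grow : ∀ c b → c j ≡ b → seen (r j) (suc (toℕ j)) c ≡ seen (r j) (toℕ j) c + b ⊙ 1ℚ
            grow c b e = trans (seen-step (r j) j c) (cong (seen (r j) (toℕ j) c +_)
              (cong₂ (λ a b → a ⊙ b ⊙ 1ℚ) (≡ᵇ-refl (r j)) e))

            keep : ∀ {c b N} → c j ≡ false → seen (r j) (toℕ j) c ≡ ℚof N → b ≡ N → seen (r j) (suc (toℕ j)) c ≡ ℚof b
            keep {c} e eq e' = trans (grow c false e) (trans (+-identityʳ _) (trans eq (cong ℚof (sym e'))))

            add : ∀ {c b N} → c j ≡ true → seen (r j) (toℕ j) c ≡ ℚof N → b ≡ suc N → seen (r j) (suc (toℕ j)) c ≡ ℚof b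
            add {c} {b} {N} e eq e' = trans (grow c true e) (trans (cong (_+ 1ℚ) eq) (trans (+-comm (ℚof N) 1ℚ)
              (trans (sym (ℚof-suc N)) (cong ℚof (sym e')))))

            cnt≡ : ∀ {ib} → inB j ≡ ib → cnt (r j) (suc (toℕ j)) ≡ (if ib then suc C else C)
            cnt≡ e = trans (cnt-arrive j) (cong (λ b → if b then suc C else C) e)

            by-case : ∀ ib z → inB j ≡ ib → rejB j ≡ ib ∧ z → (ℕD._%_ (off ℕ.+ C) d ≡ᵇ 0) ≡ z → Counted (r j) (suc (toℕ j))
            by-case false z eI eR _ = keep {inB} eI (proj₁ ih) (cnt≡ eI) , R , keep {rejB} {R} eR (proj₁ (proj₂ (proj₂ ih))) refl ,
              subst (λ c → off ℕ.+ c ℕ.≤ d ℕ.* (R ℕ.+ off)) (sym (cnt≡ eI)) covered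
            by-case true true eI eR _ = add {inB} eI (proj₁ ih) (cnt≡ eI) , suc R , add {rejB} {suc R} eR (proj₁ (proj₂ (proj₂ ih))) refl ,
              subst (λ c → off ℕ.+ c ℕ.≤ d ℕ.* suc (R ℕ.+ off)) (sym (cnt≡ eI))
                (ℕP.≤-trans (ℕP.≤-reflexive (ℕP.+-suc off C)) (ℕP.≤-trans (ℕP.+-mono-≤ (ℕ.s≤s (ℕ.z≤n {k ∸ 1})) covered)
                  (ℕP.≤-reflexive (sym (ℕP.*-suc d (R ℕ.+ off))))))
            by-case true false eI eR eZ = add {inB} eI (proj₁ ih) (cnt≡ eI) , R , keep {rejB} {R} eR (proj₁ (proj₂ (proj₂ ih))) refl ,
              subst (λ c → off ℕ.+ c ℕ.≤ d ℕ.* (R ℕ.+ off)) (sym (cnt≡ eI))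
                (ℕP.≤-trans (ℕP.≤-reflexive (ℕP.+-suc off C)) (ℕP.≤∧≢⇒< covered not-multiple))
              where
              -- An assigned job that is not rejected sees a nonzero remainder. The upper bound is a
              -- multiple of d, so it is not attained, and there is room for one more job.
              not-multiple : off ℕ.+ C ≢ d ℕ.* (R ℕ.+ off)
              not-multiple e = ≡ᵇ-false⁻¹ {ℕD._%_ (off ℕ.+ C) d} {0} eZ
                (trans (cong (λ x → ℕD._%_ x d) (trans e (ℕP.*-comm d (R ℕ.+ off)))) (ℕD.m*n%n≡0 (R ℕ.+ off) d))

        arriving : ∀ t j → Counted t (toℕ j) → Counted t (suc (toℕ j))
        arriving t j ih = by-release (r j ≡ᵇ t) refl
          where
          by-release : ∀ b → (r j ≡ᵇ t) ≡ b → Counted t (suc (toℕ j))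
          by-release false e = skipped t j ih e
          by-release true e = taken t j ih (≡ᵇ-true⁻¹ {r j} e) _ _ refl refl

      -- The counter invariant after the last release. The remainder is nothing for T⁺, where each
      -- group of d opens with its rejected job, and one group for T⁻, where the last group may
      -- still lack one.
      count-≤ : Σq jobs (λ i → inB i ⊙ 1ℚ) ≤ ℚof d * Σq jobs (λ i → rejB i ⊙ 1ℚ) + ℚof d * ℚof off
      count-≤ = go (counted (suc H) 0 ℕ.z≤n)
        where
        H : ℕ
        H = proj₁ (upper-bound r)

        all-seen : ∀ c → seen (suc H) 0 c ≡ Σq jobs (λ i → c i ⊙ 1ℚ)
        all-seen c = Σ-cong jobs (λ i → cong (_⊙ (c i ⊙ 1ℚ)) (bef-< 0 i (ℕ.s≤s (proj₂ (upper-bound r) i))))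

        go : Counted (suc H) 0 → Σq jobs (λ i → inB i ⊙ 1ℚ) ≤ ℚof d * Σq jobs (λ i → rejB i ⊙ 1ℚ) + ℚof d * ℚof off
        go (eq , R , eqR , le) = ≤-trans (≤-reflexive (trans (sym (all-seen inB)) eq))
          (≤-trans (ℚof-mono (ℕP.≤-trans (ℕP.m≤n+m (cnt (suc H) 0) off) le))
          (≤-reflexive (trans (ℚof-* d (R ℕ.+ off)) (trans (cong (ℚof d *_) (ℚof-+ R off))
            (trans (*-distribˡ-+ (ℚof d) (ℚof R) (ℚof off)) (cong (λ z → ℚof d * z + ℚof d * ℚof off) (trans (sym eqR) (all-seen rejB))))))))

  -- The competitive ratio

  8ℚ : ℚ
  8ℚ = 4ℚ + 4ℚ

  -- Pure arithmetic: Z is the sum of w_j P_j, G the charge of the accepted jobs, A and R the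
  -- assigned and rejected parts of the tables, L the cost of the incomplete groups. Only R⁺ carries
  -- the factor 4; R⁻ is raised from 2 to 4 so that the bound on the sum R⁺ + R⁻ applies.
  combine : ∀ K F Z φ G A⁺ A⁻ R⁺ R⁻ R L → 2ℚ ≤ K → 0ℚ ≤ F → Z ≤ 2ℚ * F → 0ℚ ≤ R⁻ →
    φ ≤ K * Z + G → G ≤ A⁺ + A⁻ + 2ℚ * (K * Z) + Z → A⁺ ≤ 4ℚ * (K * R⁺) → A⁻ ≤ 2ℚ * (K * R⁻) + 2ℚ * L →
    R⁺ + R⁻ ≤ R → R ≤ F + K * Z + Z →
    L ≤ 8ℚ * (4ℚ * (12ℚ * (4ℚ * (3ℚ * (2ℚ * F))) + 12ℚ * (2ℚ * (K * K * Z)))) →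
    φ ≤ ℚof 8000 * K * K * F
  combine K F Z φ G A⁺ A⁻ R⁺ R⁻ R L 2≤K 0≤F Z≤ 0≤R⁻ φ≤ G≤ A⁺≤ A⁻≤ R≤ R≤F L≤ = begin
    φ ≤⟨ φ≤ ⟩
    K * Z + G ≤⟨ +-monoʳ-≤ (K * Z) G≤ ⟩
    K * Z + (A⁺ + A⁻ + 2ℚ * (K * Z) + Z) ≤⟨ +-monoʳ-≤ (K * Z) (+-monoˡ-≤ Z (+-monoˡ-≤ (2ℚ * (K * Z)) (+-mono-≤ A⁺≤ A⁻≤))) ⟩
    K * Z + (4ℚ * (K * R⁺) + (2ℚ * (K * R⁻) + 2ℚ * L) + 2ℚ * (K * Z) + Z) ≤⟨ ≤-slack (2ℚ * (K * R⁻)) (*-nonneg 0≤2ℚ (*-nonneg 0≤K 0≤R⁻)) (id₁ K Z R⁺ R⁻ L) ⟩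
    4ℚ * K * (R⁺ + R⁻) + 2ℚ * L + 3ℚ * (K * Z) + Z ≤⟨ +-monoˡ-≤ Z (+-monoˡ-≤ (3ℚ * (K * Z)) (+-mono-≤
      (*-mono-≤ˡ (4ℚ * K) 0≤4K (≤-trans R≤ R≤F)) (*-mono-≤ˡ 2ℚ 0≤2ℚ L≤))) ⟩
    4ℚ * K * (F + K * Z + Z) + 2ℚ * (8ℚ * (4ℚ * (12ℚ * (4ℚ * (3ℚ * (2ℚ * F))) + 12ℚ * (2ℚ * (K * K * Z))))) + 3ℚ * (K * Z) + Z ≡⟨ id₂ K F Z ⟩
    (4ℚ * K + ℚof 18432) * F + (ℚof 1540 * K * K + ℚof 7 * K + 1ℚ) * Z ≤⟨ +-monoʳ-≤ ((4ℚ * K + ℚof 18432) * F) (*-mono-≤ˡ (ℚof 1540 * K * K + ℚof 7 * K + 1ℚ)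
      (+-nonneg (+-nonneg (*-nonneg (*-nonneg (0≤ℚof 1540) 0≤K) 0≤K) (*-nonneg (0≤ℚof 7) 0≤K)) 0≤1ℚ) Z≤) ⟩
    -- The slack is the difference expanded in powers of K - 2, where all coefficients are
    -- nonnegative. At K = 2 the left side is 30790 F, which 8000 K² F exceeds by 1210 F.
    (4ℚ * K + ℚof 18432) * F + (ℚof 1540 * K * K + ℚof 7 * K + 1ℚ) * (2ℚ * F) ≤⟨ ≤-slack
      ((ℚof 1210 + ℚof 19662 * (K - 2ℚ) + ℚof 4920 * (K - 2ℚ) * (K - 2ℚ)) * F)
      (*-nonneg (+-nonneg (+-nonneg (0≤ℚof 1210) (*-nonneg (0≤ℚof 19662) 0≤K-2)) (*-nonneg (*-nonneg (0≤ℚof 4920) 0≤K-2) 0≤K-2)) 0≤F)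
      (id₃ K F) ⟩
    ℚof 8000 * K * K * F ∎
    where
    open ≤-Reasoning
    0≤K : 0ℚ ≤ K
    0≤K = ≤-trans 0≤2ℚ 2≤K

    0≤4K : 0ℚ ≤ 4ℚ * K
    0≤4K = *-nonneg (nonNegative⁻¹ 4ℚ) 0≤K

    0≤K-2 : 0ℚ ≤ K - 2ℚ
    0≤K-2 = p≤q⇒0≤q-p 2≤K

    id₁ : ∀ K Z R⁺ R⁻ L → 4ℚ * K * (R⁺ + R⁻) + 2ℚ * L + 3ℚ * (K * Z) + Z
      ≡ K * Z + (4ℚ * (K * R⁺) + (2ℚ * (K * R⁻) + 2ℚ * L) + 2ℚ * (K * Z) + Z) + 2ℚ * (K * R⁻)
    id₁ = solve-∀ ℚ-ring
    id₂ : ∀ K F Z → 4ℚ * K * (F + K * Z + Z) + 2ℚ * (8ℚ * (4ℚ * (12ℚ * (4ℚ * (3ℚ * (2ℚ * F))) + 12ℚ * (2ℚ * (K * K * Z))))) + 3ℚ * (K * Z) + Z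
      ≡ (4ℚ * K + ℚof 18432) * F + (ℚof 1540 * K * K + ℚof 7 * K + 1ℚ) * Z
    id₂ = solve-∀ ℚ-ring
    id₃ : ∀ K F → ℚof 8000 * K * K * F ≡ (4ℚ * K + ℚof 18432) * F + (ℚof 1540 * K * K + ℚof 7 * K + 1ℚ) * (2ℚ * F)
      + (ℚof 1210 + ℚof 19662 * (K - 2ℚ) + ℚof 4920 * (K - 2ℚ) * (K - 2ℚ)) * F
    id₃ = solve-∀ ℚ-ring

  module Analysis {n : ℕ} (k : ℕ) (2≤k : 2 ℕ.≤ k) (I : Instance n) (sel : ℕ → (Fin n → Bool) → Fin n)
    (0<w : ∀ j → 0ℚ < Instance.w I j) (Sch : Schedule n) (feasible : Feasible I Sch) where
    open Simulation k I sel hiding (jobs)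
    open Scheduling k I sel using (S; S≡state; rem-unreleased; rem≤p; arrivedWeight; Dominates; idle; busy)
    open Rejection k I sel 0<w
    open Schedule Sch renaming (H0 to T₀)

    acc : Fin n → Bool
    acc i = not (rejected i)

    1≤P : ∀ i → 1ℚ ≤ P i
    1≤P i = ℚof-mono {1} {p i} (ℕ.s≤s ℕ.z≤n)

    -- If h is densest at t, nothing denser is pending. Otherwise each denser pending job was
    -- released after the start u of h, and its remaining weight is at most its full weight, so
    -- together they weigh at most what arrived since u.
    late-≤ : ∀ t h → Dominates t t h ⊎ (∃[ u ] (Dominates t u h × arrivedWeight u t ≤ w h * kq)) →
      Σq (allFin n) (λ i → (acc i ∧ (r i ≤ᵇ t)) ⊙ (ρ h <ᵇq ρ i) ⊙ (ρ i * q t i)) ≤ kq * w h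
    late-≤ t h (inj₁ dom) = ≤-trans (≤-reflexive (trans (Σ-cong (allFin n) (λ i → vanish i (rejected i) (r i ≤ᵇ t) (ρ h <ᵇq ρ i) refl refl refl)) (Σ-zero (allFin n))))
      (*-nonneg (0≤ℚof k) (<⇒≤ (0<w h)))
      where
      vanish : ∀ i a b c → rejected i ≡ a → (r i ≤ᵇ t) ≡ b → (ρ h <ᵇq ρ i) ≡ c → (not a ∧ b) ⊙ c ⊙ (ρ i * q t i) ≡ 0ℚ
      vanish i true b c _ _ _ = refl
      vanish i false false c _ _ _ = refl
      vanish i false true false _ _ _ = refl
      vanish i false true true ea eb ec = by-rem (rem (S t) i) refl
        where
        by-rem : ∀ m → rem (S t) i ≡ m → ρ i * ℚof m ≡ 0ℚ
        by-rem zero _ = *-zeroʳ (ρ i)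
        by-rem (suc m) e = ⊥-elim (<-irrefl refl (<-≤-trans (<ᵇq-true⁻¹ {ρ h} {ρ i} ec)
          (dom i (≤ᵇ-true⁻¹ eb) ea (subst (0 ℕ.<_) (sym e) (ℕ.s≤s ℕ.z≤n)))))
    late-≤ t h (inj₂ (u , dom , light)) = ≤-trans (Σ-mono (allFin n) (λ i → bound i (rejected i) (r i ≤ᵇ t) (ρ h <ᵇq ρ i) refl refl refl))
      (≤-trans light (≤-reflexive (*-comm (w h) kq)))
      where
      0≤w : ∀ i → 0ℚ ≤ w i
      0≤w i = <⇒≤ (0<w i)

      bound : ∀ i a b c → rejected i ≡ a → (r i ≤ᵇ t) ≡ b → (ρ h <ᵇq ρ i) ≡ c →
        (not a ∧ b) ⊙ c ⊙ (ρ i * q t i) ≤ ((u <ᵇ r i) ∧ b) ⊙ w i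
      bound i true b c _ _ _ = ⊙-nonneg ((u <ᵇ r i) ∧ b) (0≤w i)
      bound i false false c _ _ _ = ⊙-nonneg ((u <ᵇ r i) ∧ false) (0≤w i)
      bound i false true false _ _ _ = ⊙-nonneg ((u <ᵇ r i) ∧ true) (0≤w i)
      bound i false true true ea eb ec = by-rem (rem (S t) i) refl
        where
        by-rem : ∀ m → rem (S t) i ≡ m → ρ i * ℚof m ≤ ((u <ᵇ r i) ∧ true) ⊙ w i
        by-rem zero _ = ≤-trans (≤-reflexive (*-zeroʳ (ρ i))) (⊙-nonneg ((u <ᵇ r i) ∧ true) (0≤w i))
        by-rem (suc m) e = ≤-trans (≤-trans (*-mono-≤ˡ (ρ i) (<⇒≤ (0<ρ i)) (ℚof-mono (subst (ℕ._≤ p i) e (rem≤p t i)))) (≤-reflexive (sym (w≡ρP i))))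
          (≤-reflexive (cong (λ b → (b ∧ true) ⊙ w i) (sym (<ᵇ-true (ℕP.≰⇒> (λ ri → <-irrefl refl (<-≤-trans (<ᵇq-true⁻¹ {ρ h} {ρ i} ec)
            (dom i ri ea (subst (0 ℕ.<_) (sym e) (ℕ.s≤s ℕ.z≤n))))))))))

    run : Run r ρ P w kq acc q
    run = record
      { 0<ρ = 0<ρ ; 1≤P = 1≤P ; w≡ρP = w≡ρP ; 0≤K = 0≤ℚof k
      ; q-nonneg = λ t i → 0≤ℚof (rem (S t) i)
      ; q-unreleased = λ t i h → cong ℚof (rem-unreleased t i h)
      ; slot = λ t → convert t (Scheduling.slot k I sel t)
      }
      where
      served : ∀ t i b → (b ≡ true → 0 ℕ.< rem (S t) i) → ℚof (if b then rem (S t) i ∸ 1 else rem (S t) i) ≡ q t i - b ⊙ 1ℚ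
      served t i false _ = sym (+-identityʳ (q t i))
      served t i true h = go (rem (S t) i) (h refl)
        where
        cancel : ∀ x → x ≡ 1ℚ + x - 1ℚ
        cancel = solve-∀ ℚ-ring
        go : ∀ m → 0 ℕ.< m → ℚof (m ∸ 1) ≡ ℚof m - 1ℚ
        go (suc m) _ = trans (cancel (ℚof m)) (cong (_- 1ℚ) (sym (ℚof-suc m)))

      convert : ∀ t → Scheduling.Slot k I sel t → RunSlot r ρ w kq acc q t
      convert t (idle done next) = idle (λ i ri a → cong ℚof (done i ri (not-true a))) (λ i → cong ℚof (next i))
      convert t (busy h rh a 0<rem next late) = busy h rh (cong not a)
        (λ i → trans (cong ℚof (next i)) (served t i (i ≡ᵇF h) (λ e →
          subst (λ i → 0 ℕ.< rem (S t) i) (sym (FinP.toℕ-injective {i = i} {h} (≡ᵇ-true⁻¹ e))) 0<rem))) (late-≤ t h late)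

    offline : Offline r P x T₀
    offline = record
      { x-nonneg = proj₁ feasible
      ; x-unreleased = proj₁ (proj₂ feasible)
      ; x-rate = proj₁ (proj₂ (proj₂ feasible))
      ; x-finished = proj₁ (proj₂ (proj₂ (proj₂ feasible)))
      ; x-total = proj₂ (proj₂ (proj₂ (proj₂ feasible)))
      }

    -- Only finitely many keys occur, and a bound on these sums bounds each of the five. One range
    -- of N indices then serves all coordinates of both tables.
    keys : Fin n → ℕ
    keys j = ℤ.∣ key⁺₁ j ∣ ℕ.+ (ℤ.∣ key⁺₂ j ∣ ℕ.+ (ℤ.∣ key⁻₁ j ∣ ℕ.+ (ℤ.∣ key⁻₂ j ∣ ℕ.+ ℤ.∣ key⁻₃ j ∣)))

    M N : ℕ
    M = proj₁ (upper-bound keys)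
    N = suc (M ℕ.+ M)

    ∣key⁺₁∣≤M : ∀ j → ℤ.∣ key⁺₁ j ∣ ℕ.≤ M
    ∣key⁺₁∣≤M j = ℕP.≤-trans (ℕP.m≤m+n _ _) (proj₂ (upper-bound keys) j)

    ∣key⁺₂∣≤M : ∀ j → ℤ.∣ key⁺₂ j ∣ ℕ.≤ M
    ∣key⁺₂∣≤M j = ℕP.≤-trans (ℕP.≤-trans (ℕP.m≤m+n _ _) (ℕP.m≤n+m _ ℤ.∣ key⁺₁ j ∣)) (proj₂ (upper-bound keys) j)

    ∣key⁻₁∣≤M : ∀ j → ℤ.∣ key⁻₁ j ∣ ℕ.≤ M
    ∣key⁻₁∣≤M j = ℕP.≤-trans (ℕP.≤-trans (ℕP.≤-trans (ℕP.m≤m+n _ _) (ℕP.m≤n+m _ ℤ.∣ key⁺₂ j ∣)) (ℕP.m≤n+m _ ℤ.∣ key⁺₁ j ∣)) (proj₂ (upper-bound keys) j)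

    ∣key⁻₂∣≤M : ∀ j → ℤ.∣ key⁻₂ j ∣ ℕ.≤ M
    ∣key⁻₂∣≤M j = ℕP.≤-trans (ℕP.≤-trans (ℕP.≤-trans (ℕP.≤-trans (ℕP.m≤m+n _ _) (ℕP.m≤n+m _ ℤ.∣ key⁻₁ j ∣))
      (ℕP.m≤n+m _ ℤ.∣ key⁺₂ j ∣)) (ℕP.m≤n+m _ ℤ.∣ key⁺₁ j ∣)) (proj₂ (upper-bound keys) j)

    ∣key⁻₃∣≤M : ∀ j → ℤ.∣ key⁻₃ j ∣ ℕ.≤ M
    ∣key⁻₃∣≤M j = ℕP.≤-trans (ℕP.≤-trans (ℕP.≤-trans (ℕP.≤-trans (ℕP.m≤n+m _ ℤ.∣ key⁻₂ j ∣) (ℕP.m≤n+m _ ℤ.∣ key⁻₁ j ∣))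
      (ℕP.m≤n+m _ ℤ.∣ key⁺₂ j ∣)) (ℕP.m≤n+m _ ℤ.∣ key⁺₁ j ∣)) (proj₂ (upper-bound keys) j)

    g g⁻¹ : ℕ → ℚ
    g i = pow2 (level M i)
    g⁻¹ i = recip (g i)

    0<g : ∀ i → 0ℚ < g i
    0<g i = pow2-positive (level M i)

    0≤g⁻¹ : ∀ i → 0ℚ ≤ g⁻¹ i
    0≤g⁻¹ i = *-cancelʳ-≤-pos (g i) {{positive (0<g i)}} (subst₂ _≤_ (sym (*-zeroˡ (g i))) (sym (recip-inverse (g i) (0<g i))) 0≤1ℚ)

    g-index : ∀ z → ℤ.∣ z ∣ ℕ.≤ M → g (index M z) ≡ pow2 z
    g-index z h = cong pow2 (level-index M z h)

    cl : Fin n → ℕ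
    cl j = index M (key⁻₂ j)

    g≤ρ : ∀ j → g (cl j) ≤ ρ j
    g≤ρ j = ≤-trans (≤-reflexive (g-index (key⁻₂ j) (∣key⁻₂∣≤M j))) (proj₁ (flog2-bounds (ρ j) (0<ρ j)))

    ρ<2g : ∀ j → ρ j < 2ℚ * g (cl j)
    ρ<2g j = <-≤-trans (proj₂ (flog2-bounds (ρ j) (0<ρ j))) (≤-reflexive (cong (2ℚ *_) (sym (g-index (key⁻₂ j) (∣key⁻₂∣≤M j)))))

    open RunBounds run using (jobs; before⇒≤; W; delay; delay-nonneg; charge; flow-≤-charges)
    open OfflineBounds {ρ = ρ} (λ i → <⇒≤ (0<ρ i)) offline using (flow; weak-duality; ΣwP≤2flow; left-nonneg)

    cl<N : ∀ j → cl j ℕ.< N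
    cl<N j = index-< M (key⁻₂ j) (∣key⁻₂∣≤M j)

    module B = Backlog run offline N cl cl<N g g⁻¹ 0<g 0≤g⁻¹ (λ i → recip-inverse (g i) (0<g i)) (pow2-level-suc M) g≤ρ ρ<2g

    0≤g : ∀ i → 0ℚ ≤ g i
    0≤g i = <⇒≤ (0<g i)

    0≤P : ∀ i → 0ℚ ≤ P i
    0≤P i = <⇒≤ (0<P i)

    0≤wP : ∀ j → 0ℚ ≤ w j * P j
    0≤wP j = *-nonneg (<⇒≤ (0<w j)) (0≤P j)

    0≤kq : 0ℚ ≤ kq
    0≤kq = 0≤ℚof k

    0<kq : 0ℚ < kq
    0<kq = <-≤-trans (positive⁻¹ 1ℚ) (ℚof-mono {1} {k} (ℕP.≤-trans (ℕ.s≤s ℕ.z≤n) 2≤k))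

    d≡k : d ≡ k
    d≡k = ℕP.m+[n∸m]≡n {1} {k} (ℕP.≤-trans (ℕ.s≤s ℕ.z≤n) 2≤k)

    0<thr : ∀ j → 0ℚ < w j * P j * kq
    0<thr j = *-positive (*-positive (0<w j) (0<P j)) 0<kq

    inT⁺-true : ∀ j → inT⁺ j ≡ true → w j * P j * kq ≤ α⁺ j
    inT⁺-true j e = ≤ᵇq-true⁻¹ {w j * P j * kq} {α⁺ j} (trans (sym (Arrival.inT⁺-def (r j) (sAt j) j)) e)

    inT⁺-false : ∀ j → inT⁺ j ≡ false → α⁺ j ≤ w j * P j * kq
    inT⁺-false j e = <⇒≤ (≤ᵇq-false⁻¹ {w j * P j * kq} {α⁺ j} (trans (sym (Arrival.inT⁺-def (r j) (sAt j) j)) e))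

    inT⁻-true : ∀ j → inT⁻ j ≡ true → w j * P j * kq < α⁻ j
    inT⁻-true j e = <ᵇq-true⁻¹ {w j * P j * kq} {α⁻ j} (trans (sym (Arrival.inT⁻-def (r j) (sAt j) j)) e)

    inT⁻-false : ∀ j → inT⁻ j ≡ false → α⁻ j ≤ w j * P j * kq
    inT⁻-false j e = <ᵇq-false⁻¹ {w j * P j * kq} {α⁻ j} (trans (sym (Arrival.inT⁻-def (r j) (sAt j) j)) e)

    rej⁺⇒inT⁺ : ∀ j → rej⁺ j ≡ true → inT⁺ j ≡ true
    rej⁺⇒inT⁺ j e = proj₁ (∧-true {inT⁺ j} (trans (sym (Arrival.rej⁺-def (r j) (sAt j) j)) e))

    rej⁻⇒inT⁻ : ∀ j → rej⁻ j ≡ true → inT⁻ j ≡ true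
    rej⁻⇒inT⁻ j e = proj₁ (∧-true {inT⁻ j} (trans (sym (Arrival.rej⁻-def (r j) (sAt j) j)) e))

    δ⁺ : ℕ × ℕ → Fin n → Bool
    δ⁺ (a , b) j = (a ≡ᵇ index M (key⁺₁ j)) ∧ (b ≡ᵇ index M (key⁺₂ j))

    bucket⁺-δ : ∀ a b j → bucket⁺ (level M a) (level M b) j ≡ δ⁺ (a , b) j
    bucket⁺-δ a b j = cong₂ _∧_ (level-≡ᵇ M a (key⁺₁ j) (∣key⁺₁∣≤M j)) (level-≡ᵇ M b (key⁺₂ j) (∣key⁺₂∣≤M j))

    reorder : ∀ c b b' → b ≡ b' → (c ∧ b) ⊙ 1ℚ ≡ b' ⊙ c ⊙ 1ℚ
    reorder c b b' refl = trans (⊙-∧ c b 1ℚ) (⊙-comm c b 1ℚ)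

    reorder' : ∀ c b b' → b ≡ b' → (b ∧ c) ⊙ 1ℚ ≡ b' ⊙ c ⊙ 1ℚ
    reorder' c b b' refl = ⊙-∧ b c 1ℚ

    count⁺ : ∀ B → Σq (allFin n) (λ j → δ⁺ B j ⊙ inT⁺ j ⊙ 1ℚ) ≤ kq * Σq (allFin n) (λ j → δ⁺ B j ⊙ rej⁺ j ⊙ 1ℚ) + 0ℚ
    count⁺ (a , b) = subst₂ _≤_ (Σ-cong jobs (λ j → reorder (inT⁺ j) _ _ (bucket⁺-δ a b j)))
      (cong₂ _+_ (cong₂ _*_ (cong ℚof d≡k) (Σ-cong jobs (λ j → reorder' (rej⁺ j) _ _ (bucket⁺-δ a b j)))) (*-zeroʳ (ℚof d)))
      (count-≤ (counter⁺ (level M a) (level M b)))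

    -- The spread is 4, not 2, because T⁺ rounds the two factors α⁺_j / w_j and w_j separately.
    bounds⁺ : ∀ (B : ℕ × ℕ) j → δ⁺ B j ≡ true → inT⁺ j ≡ true →
      g (proj₁ B) * g (proj₂ B) ≤ α⁺ j × α⁺ j ≤ 4ℚ * (g (proj₁ B) * g (proj₂ B))
    bounds⁺ (a , b) j e inT = subst₂ (λ x y → x * y ≤ α⁺ j × α⁺ j ≤ 4ℚ * (x * y)) (sym ga) (sym gb)
      ( ≤-trans (*-mono-≤² (<⇒≤ (pow2-positive (key⁺₁ j))) (<⇒≤ (0<w j)) (proj₁ y-bounds) (proj₁ w-bounds)) (≤-reflexive y*w)
      , ≤-trans (≤-reflexive (sym y*w)) (≤-trans (*-mono-≤² (<⇒≤ 0<y) (*-nonneg 0≤2ℚ (<⇒≤ (pow2-positive (key⁺₂ j))))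
          (<⇒≤ (proj₂ y-bounds)) (<⇒≤ (proj₂ w-bounds))) (≤-reflexive (four (pow2 (key⁺₁ j)) (pow2 (key⁺₂ j))))))
      where
      four : ∀ x y → 2ℚ * x * (2ℚ * y) ≡ 4ℚ * (x * y)
      four = solve-∀ ℚ-ring

      y : ℚ
      y = α⁺ j * recip (w j)

      y*w : y * w j ≡ α⁺ j
      y*w = trans (*-assoc (α⁺ j) (recip (w j)) (w j)) (trans (cong (α⁺ j *_) (recip-inverse (w j) (0<w j))) (*-identityʳ (α⁺ j)))

      0<y : 0ℚ < y
      0<y = *-cancelʳ-<-nonNeg (w j) {{nonNegative (<⇒≤ (0<w j))}} (subst₂ _<_ (sym (*-zeroˡ (w j))) (sym y*w)
        (<-≤-trans (0<thr j) (inT⁺-true j inT)))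

      y-bounds : pow2 (key⁺₁ j) ≤ y × y < 2ℚ * pow2 (key⁺₁ j)
      y-bounds = flog2-bounds y 0<y

      w-bounds : pow2 (key⁺₂ j) ≤ w j × w j < 2ℚ * pow2 (key⁺₂ j)
      w-bounds = flog2-bounds (w j) (0<w j)

      ga : g a ≡ pow2 (key⁺₁ j)
      ga = trans (cong g (≡ᵇ-true⁻¹ {a} (proj₁ (∧-true {a ≡ᵇ index M (key⁺₁ j)} e)))) (g-index (key⁺₁ j) (∣key⁺₁∣≤M j))

      gb : g b ≡ pow2 (key⁺₂ j)
      gb = trans (cong g (≡ᵇ-true⁻¹ {b} (proj₂ (∧-true {a ≡ᵇ index M (key⁺₁ j)} e)))) (g-index (key⁺₂ j) (∣key⁺₂∣≤M j))

    A⁺ A⁻ R⁺ R⁻ Z : ℚ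
    A⁺ = Σq (allFin n) (λ j → inT⁺ j ⊙ α⁺ j)
    A⁻ = Σq (allFin n) (λ j → inT⁻ j ⊙ α⁻ j)
    R⁺ = Σq (allFin n) (λ j → rej⁺ j ⊙ α⁺ j)
    R⁻ = Σq (allFin n) (λ j → rej⁻ j ⊙ α⁻ j)
    Z  = Σq (allFin n) (λ j → w j * P j)

    A⁺≤ : A⁺ ≤ 4ℚ * (kq * R⁺)
    A⁺≤ = ≤-trans (bucket-sum (grid² N) δ⁺
        (λ j y → grid²-sum N (index M (key⁺₁ j)) (index M (key⁺₂ j)) y (index-< M (key⁺₁ j) (∣key⁺₁∣≤M j)) (index-< M (key⁺₂ j) (∣key⁺₂∣≤M j)))
        inT⁺ rej⁺ α⁺ (λ B → g (proj₁ B) * g (proj₂ B)) (λ _ → 0ℚ) 4ℚ kq (λ B → *-nonneg (0≤g (proj₁ B)) (0≤g (proj₂ B)))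
        (nonNegative⁻¹ 4ℚ) 0≤kq rej⁺⇒inT⁺ bounds⁺ count⁺)
      (≤-reflexive (trans (cong (λ z → 4ℚ * (kq * R⁺) + 4ℚ * z)
        (trans (Σ-cong (grid² N) (λ B → *-zeroʳ (g (proj₁ B) * g (proj₂ B)))) (Σ-zero (grid² N)))) (+-identityʳ _)))

    δ⁻ : ℕ × ℕ × ℕ → Fin n → Bool
    δ⁻ (c , b , a) j = (c ≡ᵇ index M (key⁻₂ j)) ∧ (b ≡ᵇ index M (key⁻₃ j)) ∧ (a ≡ᵇ index M (key⁻₁ j))

    bucket⁻-δ : ∀ c b a j → bucket⁻ (level M a) (level M c) (level M b) j ≡ δ⁻ (c , b , a) j
    bucket⁻-δ c b a j = trans (cong₂ _∧_ (level-≡ᵇ M a (key⁻₁ j) (∣key⁻₁∣≤M j))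
        (cong₂ _∧_ (level-≡ᵇ M c (key⁻₂ j) (∣key⁻₂∣≤M j)) (level-≡ᵇ M b (key⁻₃ j) (∣key⁻₃∣≤M j))))
      (rotate (a ≡ᵇ index M (key⁻₁ j)) (c ≡ᵇ index M (key⁻₂ j)) (b ≡ᵇ index M (key⁻₃ j)))
      where
      rotate : ∀ x y z → x ∧ y ∧ z ≡ y ∧ z ∧ x
      rotate x y z = trans (BoolP.∧-comm x (y ∧ z)) (BoolP.∧-assoc y z x)

    -- An empty bucket must contribute no incomplete group, since the leftover sum runs over the
    -- whole grid. A job found in the bucket also witnesses the inequalities that restrict its
    -- indices.
    occupied : ∀ B → Dec (∃[ j ] inT⁻ j ∧ δ⁻ B j ≡ true)
    occupied B = FinP.any? (λ j → (inT⁻ j ∧ δ⁻ B j) BoolP.≟ true)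

    used : ℕ × ℕ × ℕ → Bool
    used B = does (occupied B)

    count⁻ : ∀ B → Σq (allFin n) (λ j → δ⁻ B j ⊙ inT⁻ j ⊙ 1ℚ) ≤ kq * Σq (allFin n) (λ j → δ⁻ B j ⊙ rej⁻ j ⊙ 1ℚ) + used B ⊙ kq
    count⁻ B@(c , b , a) = go (occupied B)
      where
      go : (o : Dec (∃[ j ] inT⁻ j ∧ δ⁻ B j ≡ true)) →
        Σq (allFin n) (λ j → δ⁻ B j ⊙ inT⁻ j ⊙ 1ℚ) ≤ kq * Σq (allFin n) (λ j → δ⁻ B j ⊙ rej⁻ j ⊙ 1ℚ) + does o ⊙ kq
      go (yes _) = subst₂ _≤_ (Σ-cong jobs (λ j → reorder (inT⁻ j) _ _ (bucket⁻-δ c b a j)))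
        (cong₂ _+_ (cong₂ _*_ (cong ℚof d≡k) (Σ-cong jobs (λ j → reorder' (rej⁻ j) _ _ (bucket⁻-δ c b a j))))
          (trans (*-identityʳ (ℚof d)) (cong ℚof d≡k)))
        (count-≤ (counter⁻ (level M a) (level M c) (level M b)))
      go (no empty) = ≤-trans (≤-reflexive (trans (Σ-cong jobs (λ j → vanish (δ⁻ B j) (inT⁻ j) (λ e → empty (j , e)))) (Σ-zero jobs)))
        (+-nonneg (*-nonneg 0≤kq (Σ-nonneg jobs (λ j → ⊙-nonneg (δ⁻ B j) (⊙-nonneg (rej⁻ j) 0≤1ℚ)))) (≤-refl {0ℚ}))
        where
        vanish : ∀ x y → (y ∧ x ≡ true → ⊥) → x ⊙ y ⊙ 1ℚ ≡ 0ℚ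
        vanish true true  h = ⊥-elim (h refl)
        vanish true false h = refl
        vanish false y    h = refl

    δ⁻-keys : ∀ {c b a j} → δ⁻ (c , b , a) j ≡ true → c ≡ cl j × g b ≡ pow2 (key⁻₃ j) × g a ≡ pow2 (key⁻₁ j)
    δ⁻-keys {c} {b} {a} {j} e = ≡ᵇ-true⁻¹ {c} (proj₁ e₁) ,
      trans (cong g (≡ᵇ-true⁻¹ {b} (proj₁ e₂))) (g-index (key⁻₃ j) (∣key⁻₃∣≤M j)) ,
      trans (cong g (≡ᵇ-true⁻¹ {a} (proj₂ e₂))) (g-index (key⁻₁ j) (∣key⁻₁∣≤M j))
      where
      e₁ : (c ≡ᵇ index M (key⁻₂ j)) ≡ true × ((b ≡ᵇ index M (key⁻₃ j)) ∧ (a ≡ᵇ index M (key⁻₁ j))) ≡ true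
      e₁ = ∧-true {c ≡ᵇ index M (key⁻₂ j)} e
      e₂ : (b ≡ᵇ index M (key⁻₃ j)) ≡ true × (a ≡ᵇ index M (key⁻₁ j)) ≡ true
      e₂ = ∧-true {b ≡ᵇ index M (key⁻₃ j)} (proj₂ e₁)

    α⁻-bounds : ∀ j → inT⁻ j ≡ true → pow2 (key⁻₁ j) ≤ α⁻ j × α⁻ j < 2ℚ * pow2 (key⁻₁ j)
    α⁻-bounds j e = flog2-bounds (α⁻ j) (<-trans (0<thr j) (inT⁻-true j e))

    -- A job in a lower density class than j has a smaller class index, and jobs considered before j
    -- are released by r_j. So every term of α⁻ occurs in the sparse pending weight at r_j.
    α⁻≤P*sparse : ∀ j → α⁻ j ≤ P j * B.sparse (r j) (cl j)
    α⁻≤P*sparse j = ≤-trans (≤-reflexive (α⁻-sparse j)) (*-mono-≤ˡ (P j) (0≤P j)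
      (Σ-mono jobs (λ i → pointwise i (bef (r j) (toℕ j) i) (acc i) (flog2 (ρ j) ℤ.≤ᵇ flog2 (ρ i)) refl refl refl)))
      where
      pointwise : ∀ i x y z → bef (r j) (toℕ j) i ≡ x → acc i ≡ y → (flog2 (ρ j) ℤ.≤ᵇ flog2 (ρ i)) ≡ z →
        (x ∧ y) ⊙ (not z ⊙ ρ i * q (r j) i) ≤ (acc i ∧ (r i ≤ᵇ r j)) ⊙ (cl i <ᵇ cl j) ⊙ (ρ i * q (r j) i)
      pointwise i x y z ex ey ez = go x y z ex ey ez
        where
        nonneg : 0ℚ ≤ (acc i ∧ (r i ≤ᵇ r j)) ⊙ (cl i <ᵇ cl j) ⊙ (ρ i * q (r j) i)
        nonneg = ⊙-nonneg (acc i ∧ (r i ≤ᵇ r j)) (⊙-nonneg (cl i <ᵇ cl j) (*-nonneg (<⇒≤ (0<ρ i)) (0≤ℚof (rem (S (r j)) i))))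

        go : ∀ x y z → bef (r j) (toℕ j) i ≡ x → acc i ≡ y → (flog2 (ρ j) ℤ.≤ᵇ flog2 (ρ i)) ≡ z →
          (x ∧ y) ⊙ (not z ⊙ ρ i * q (r j) i) ≤ (acc i ∧ (r i ≤ᵇ r j)) ⊙ (cl i <ᵇ cl j) ⊙ (ρ i * q (r j) i)
        go false y z _ _ _ = nonneg
        go true false z _ _ _ = nonneg
        go true true true _ _ _ = ≤-trans (≤-reflexive (*-zeroˡ (q (r j) i))) nonneg
        go true true false ex ey ez = ≤-reflexive (sym (cong₂ (λ a b → a ⊙ b ⊙ (ρ i * q (r j) i))
          (cong₂ _∧_ ey (≤ᵇ-true (before⇒≤ {i} {j} ex)))
          (<ᵇ-true (index-mono-< M (∣key⁻₂∣≤M i) (∣key⁻₂∣≤M j) (≤ᵇℤ-false⁻¹ {flog2 (ρ j)} {flog2 (ρ i)} ez)))))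

    Λ : ℚ
    Λ = Σq (grid³ N) (λ B → g (proj₂ (proj₂ B)) * used B ⊙ kq)

    A⁻≤ : A⁻ ≤ 2ℚ * (kq * R⁻) + 2ℚ * Λ
    A⁻≤ = bucket-sum (grid³ N) δ⁻
      (λ j y → grid³-sum N (index M (key⁻₂ j)) (index M (key⁻₃ j)) (index M (key⁻₁ j)) y (index-< M (key⁻₂ j) (∣key⁻₂∣≤M j))
        (index-< M (key⁻₃ j) (∣key⁻₃∣≤M j)) (index-< M (key⁻₁ j) (∣key⁻₁∣≤M j)))
      inT⁻ rej⁻ α⁻ (λ B → g (proj₂ (proj₂ B))) (λ B → used B ⊙ kq) 2ℚ kq (λ B → 0≤g (proj₂ (proj₂ B))) 0≤2ℚ 0≤kq rej⁻⇒inT⁻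
      bounds count⁻
      where
      bounds : ∀ B j → δ⁻ B j ≡ true → inT⁻ j ≡ true → g (proj₂ (proj₂ B)) ≤ α⁻ j × α⁻ j ≤ 2ℚ * g (proj₂ (proj₂ B))
      bounds (c , b , a) j e inT = ≤-trans (≤-reflexive ga) (proj₁ (α⁻-bounds j inT)) ,
        ≤-trans (<⇒≤ (proj₂ (α⁻-bounds j inT))) (≤-reflexive (cong (2ℚ *_) (sym ga)))
        where
        ga : g a ≡ pow2 (key⁻₁ j)
        ga = proj₂ (proj₂ (δ⁻-keys {c} {b} {a} {j} e))

    Λ-class : ∀ c → c ℕ.< N → Σq (upTo N) (λ b → Σq (upTo N) (λ a → g a * used (c , b , a) ⊙ kq)) ≤ 2ℚ * (4ℚ * B.F.seq c)
    Λ-class c c<N = go (bounded-max (λ j → B.sparse (r j) (cl j)) (λ j → c ≡ᵇ cl j) (g c * B.F.seq c)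
        (*-nonneg (0≤g c) (B.F.seq-nonneg B.F-term-nonneg c))
        (λ j e → B.sparse-nonneg (r j) (cl j) , subst (λ x → B.sparse (r j) x * B.sparse (r j) x ≤ g c * B.F.seq c)
          (≡ᵇ-true⁻¹ {c} e) (B.sparse² c (r j) (ℕP.<⇒≤ c<N))))
      where
      go : ∃[ X ] (0ℚ ≤ X × X * X ≤ g c * B.F.seq c × (∀ j → (c ≡ᵇ cl j) ≡ true → B.sparse (r j) (cl j) ≤ X)) →
        Σq (upTo N) (λ b → Σq (upTo N) (λ a → g a * used (c , b , a) ⊙ kq)) ≤ 2ℚ * (4ℚ * B.F.seq c)
      go (X , 0≤X , X² , max) = leftover-class g 0<g (pow2-level-suc M) kq 0≤kq X 0≤X (B.F.seq c) c X² N
        (λ a b → used (c , b , a)) (λ a b → small a b (occupied (c , b , a)))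
        where
        small : ∀ a b (o : Dec (∃[ j ] inT⁻ j ∧ δ⁻ (c , b , a) j ≡ true)) → does o ≡ true → g a ≤ 2ℚ * g b * X × kq * g c * g b ≤ X
        small a b (yes (j , e)) _ =
          ( ≤-trans (≤-reflexive ga) (≤-trans (proj₁ (α⁻-bounds j inT)) (≤-trans α⁻≤ (*-mono-≤ʳ X 0≤X
              (≤-trans (<⇒≤ (proj₂ P-bounds)) (≤-reflexive (cong (2ℚ *_) (sym gb)))))))
          , ≤-trans (≤-trans (*-mono-≤² (*-nonneg 0≤kq (0≤g c)) (0≤P j) (*-mono-≤ˡ kq 0≤kq gc≤ρ) (≤-trans (≤-reflexive gb) (proj₁ P-bounds)))
              (≤-reflexive (trans (*-assoc kq (ρ j) (P j)) (cong (kq *_) (sym (w≡ρP j)))))) kw≤X )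
          where
          inT : inT⁻ j ≡ true
          inT = proj₁ (∧-true {inT⁻ j} e)

          c≡ : c ≡ cl j
          c≡ = proj₁ (δ⁻-keys {c} {b} {a} {j} (proj₂ (∧-true {inT⁻ j} e)))

          gb : g b ≡ pow2 (key⁻₃ j)
          gb = proj₁ (proj₂ (δ⁻-keys {c} {b} {a} {j} (proj₂ (∧-true {inT⁻ j} e))))

          ga : g a ≡ pow2 (key⁻₁ j)
          ga = proj₂ (proj₂ (δ⁻-keys {c} {b} {a} {j} (proj₂ (∧-true {inT⁻ j} e))))

          P-bounds : pow2 (key⁻₃ j) ≤ P j × P j < 2ℚ * pow2 (key⁻₃ j)
          P-bounds = flog2-bounds (P j) (0<P j)

          gc≤ρ : g c ≤ ρ j
          gc≤ρ = subst (λ c → g c ≤ ρ j) (sym c≡) (g≤ρ j)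

          α⁻≤ : α⁻ j ≤ P j * X
          α⁻≤ = ≤-trans (α⁻≤P*sparse j) (*-mono-≤ˡ (P j) (0≤P j) (max j (trans (cong (_≡ᵇ cl j) c≡) (≡ᵇ-refl (cl j)))))

          comm : ∀ x y z → x * y * z ≡ y * (z * x)
          comm = solve-∀ ℚ-ring

          -- Membership in T⁻ means k w_j P_j < α⁻_j, and α⁻_j ≤ P_j X; dividing by P_j gives the
          -- claim.
          kw≤X : kq * w j ≤ X
          kw≤X = *-cancel-≤ (P j) (0<P j) (≤-trans (≤-reflexive (sym (comm (w j) (P j) kq))) (≤-trans (<⇒≤ (inT⁻-true j inT)) α⁻≤))

    Λ≤ : Λ ≤ 8ℚ * (4ℚ * (12ℚ * (4ℚ * (3ℚ * (2ℚ * flow))) + 12ℚ * (2ℚ * (kq * kq * Z))))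
    Λ≤ = begin
      Λ ≡⟨ trans (Σ-cartesianProduct (upTo N) (grid² N) (λ B → g (proj₂ (proj₂ B)) * used B ⊙ kq))
        (Σ-cong (upTo N) (λ c → Σ-cartesianProduct (upTo N) (upTo N) (λ B → g (proj₂ B) * used (c , B) ⊙ kq))) ⟩
      Σq (upTo N) (λ c → Σq (upTo N) (λ b → Σq (upTo N) (λ a → g a * used (c , b , a) ⊙ kq))) ≤⟨ Σ-upTo-mono N Λ-class ⟩
      Σq (upTo N) (λ c → 2ℚ * (4ℚ * B.F.seq c)) ≡⟨ trans (Σ-cong (upTo N) (λ c → eight (B.F.seq c))) (Σ-*ˡ (upTo N) 8ℚ B.F.seq) ⟩
      8ℚ * Σq (upTo N) B.F.seq ≤⟨ *-mono-≤ˡ 8ℚ (nonNegative⁻¹ 8ℚ) B.Σsparse-bound ⟩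
      8ℚ * (4ℚ * (12ℚ * (4ℚ * (3ℚ * (2ℚ * flow))) + 12ℚ * (2ℚ * (kq * kq * Z)))) ∎
      where
      open ≤-Reasoning
      eight : ∀ x → 2ℚ * (4ℚ * x) ≡ 8ℚ * x
      eight = solve-∀ ℚ-ring

    -- The delay of the potential argument is the quantity the rejection rule measures; after
    -- `α-delay` the two sides agree by computation, `earlier` being `before` together with `acc`.
    P*delay : ∀ j → P j * delay j ≡ α⁺ j + α⁻ j
    P*delay j = sym (α-delay j)

    -- A job outside a table has the corresponding α at most k w_j P_j, which goes into the 2 k Z
    -- term, one k Z for each table.
    G≤ : Σq (allFin n) (λ j → acc j ⊙ charge j) ≤ A⁺ + A⁻ + 2ℚ * (kq * Z) + Z
    G≤ = ≤-trans (Σ-mono jobs each) (≤-reflexive (trans (Σ-+ jobs _ _) (cong (_+ Z) (trans (Σ-+ jobs _ _)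
      (cong₂ _+_ (Σ-+ jobs _ _) (trans (Σ-*ˡ jobs 2ℚ _) (cong (2ℚ *_) (Σ-*ˡ jobs kq _))))))))
      where
      rearrange : ∀ a b k z → a + k + (b + k) + z ≡ a + b + 2ℚ * k + z
      rearrange = solve-∀ ℚ-ring

      comm : ∀ a b c → a * b * c ≡ c * (a * b)
      comm = solve-∀ ℚ-ring

      assigned : ∀ j b {x} → (b ≡ false → x ≤ w j * P j * kq) → x ≤ b ⊙ x + kq * (w j * P j)
      assigned j true h = ≤-slack (kq * (w j * P j)) (*-nonneg 0≤kq (0≤wP j)) refl
      assigned j false h = ≤-trans (h refl) (≤-reflexive (trans (comm (w j) (P j) kq) (sym (+-identityˡ _))))

      each : ∀ j → acc j ⊙ charge j ≤ inT⁺ j ⊙ α⁺ j + inT⁻ j ⊙ α⁻ j + 2ℚ * (kq * (w j * P j)) + w j * P j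
      each j = ≤-trans (⊙-≤ (acc j) (+-nonneg (*-nonneg (0≤P j) (delay-nonneg j)) (0≤wP j)))
        (≤-trans (+-monoˡ-≤ (w j * P j) (≤-trans (≤-reflexive (P*delay j))
          (+-mono-≤ (assigned j (inT⁺ j) (inT⁺-false j)) (assigned j (inT⁻ j) (inT⁻-false j)))))
          (≤-reflexive (rearrange (inT⁺ j ⊙ α⁺ j) (inT⁻ j ⊙ α⁻ j) (kq * (w j * P j)) (w j * P j))))

    R : ℚ
    R = Σq (allFin n) (λ j → rejected j ⊙ (α⁺ j + α⁻ j))

    R⁺+R⁻≤R : R⁺ + R⁻ ≤ R
    R⁺+R⁻≤R = ≤-trans (≤-reflexive (sym (Σ-+ jobs _ _))) (Σ-mono jobs (λ j → pointwise (rej⁺ j) (rej⁻ j) (0≤α⁺ j) (0≤α⁻ j)))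
      where
      pointwise : ∀ a b {x y} → 0ℚ ≤ x → 0ℚ ≤ y → a ⊙ x + b ⊙ y ≤ (a ∨ b) ⊙ (x + y)
      pointwise true true  0≤x 0≤y = ≤-refl
      pointwise true false {x} 0≤x 0≤y = +-monoʳ-≤ x 0≤y
      pointwise false true {x} {y} 0≤x 0≤y = +-monoˡ-≤ y 0≤x
      pointwise false false 0≤x 0≤y = ≤-refl

    -- The dual solution that charges every job its delay, rejected ones included: what the accepted jobs
    -- pay cancels against the flow of the run, and the delay of the rejected jobs remains.
    R≤ : R ≤ flow + kq * Z + Z
    R≤ = begin
      R ≡⟨ cancel R E ⟩
      E + R - E ≡⟨ cong (_- E) (trans (sym (Σ-+ jobs _ _)) (Σ-cong jobs (λ j → trans (either (rejected j) (α⁺ j + α⁻ j)) (sym (P*delay j))))) ⟩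
      Σq jobs (λ j → P j * delay j) - E ≤⟨ +-monoˡ-≤ (- E) (weak-duality delay W W-nonneg (DelayBound.delay-≤ run)) ⟩
      flow + Σq (upTo T₀) W - E ≤⟨ +-monoˡ-≤ (- E) (+-monoʳ-≤ flow (flow-≤-charges T₀)) ⟩
      flow + (kq * Z + Σq jobs (λ j → acc j ⊙ charge j)) - E ≡⟨ cong (λ z → flow + (kq * Z + z) - E) (trans
        (Σ-cong jobs (λ j → trans (cong (λ z → acc j ⊙ (z + w j * P j)) (P*delay j)) (⊙-+ (acc j) (α⁺ j + α⁻ j) (w j * P j)))) (Σ-+ jobs _ _)) ⟩
      flow + (kq * Z + (E + Σq jobs (λ j → acc j ⊙ (w j * P j)))) - E ≡⟨ regroup flow (kq * Z) E (Σq jobs (λ j → acc j ⊙ (w j * P j))) ⟩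
      flow + kq * Z + Σq jobs (λ j → acc j ⊙ (w j * P j)) ≤⟨ +-monoʳ-≤ (flow + kq * Z) (Σ-mono jobs (λ j → ⊙-≤ (acc j) (0≤wP j))) ⟩
      flow + kq * Z + Z ∎
      where
      open ≤-Reasoning
      E : ℚ
      E = Σq jobs (λ j → acc j ⊙ (α⁺ j + α⁻ j))

      cancel : ∀ a b → a ≡ b + a - b
      cancel = solve-∀ ℚ-ring
      regroup : ∀ a b c d → a + (b + (c + d)) - c ≡ a + b + d
      regroup = solve-∀ ℚ-ring

      either : ∀ b x → not b ⊙ x + b ⊙ x ≡ x
      either true x = +-identityˡ x
      either false x = +-identityʳ x

      W-nonneg : ∀ s → 0ℚ ≤ W s
      W-nonneg s = Σ-nonneg jobs (λ i → ⊙-nonneg (acc i ∧ (r i ≤ᵇ s)) (*-nonneg (<⇒≤ (0<ρ i)) (0≤ℚof (rem (S s) i))))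

    flowA≡ : ∀ H → flowA H ≡ Σq (upTo H) W
    flowA≡ H = Σ-cong (upTo H) (λ t → Σ-cong (allFin n) (λ j → cong₂ (λ b s → (not b ∧ (r j ≤ᵇ t)) ⊙ (ρ j * ℚof (rem s j)))
      (immRejected≡rejected j) (sym (S≡state t))))

    flow-nonneg : 0ℚ ≤ flow
    flow-nonneg = Σ-nonneg (upTo T₀) (λ t → Σ-nonneg jobs (λ j → ⊙-nonneg (r j ≤ᵇ t) (*-nonneg (<⇒≤ (0<ρ j)) (left-nonneg t j))))

    competitive : ∀ H → flowA H ≤ ℚof 8000 * kq * kq * flow
    competitive H = ≤-trans (≤-reflexive (flowA≡ H)) (combine kq flow Z (Σq (upTo H) W) (Σq jobs (λ j → acc j ⊙ charge j))
      A⁺ A⁻ R⁺ R⁻ R Λ (ℚof-mono {2} {k} 2≤k) flow-nonneg (ΣwP≤2flow w w≡ρP)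
      (Σ-nonneg jobs (λ j → ⊙-nonneg (rej⁻ j) (0≤α⁻ j)))
      (flow-≤-charges H) G≤ A⁺≤ A⁻≤ R⁺+R⁻≤R R≤ Λ≤)

open import Defs
open import Data.Nat using (ℕ; _≤_; _*_)
open import Data.Fin using (Fin)
open import Data.Bool using (Bool)
open import Data.Product using (∃-syntax; _,_)
open import Data.Rational as ℚ using (ℚ; 0ℚ)
open import Data.Rational.Properties using (≤-trans; ≤-reflexive)
open import Relation.Binary.PropositionalEquality using (cong; sym; trans)

theorem4p8 : ∃[ C ] ((k : ℕ) → 2 ≤ k → (n : ℕ) → (I : Instance n)
    → ((j : Fin n) → 0ℚ ℚ.< Instance.w I j)
    → (sel : ℕ → (Fin n → Bool) → Fin n)
    → (S : Schedule n) → Feasible I S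
    → (H : ℕ) → Algorithm.flowA k I sel H ℚ.≤ ℚof (C * k * k) ℚ.* flowS I S)
theorem4p8 = 8000 , λ k 2≤k n I 0<w sel S feasible H →
  ≤-trans (Analysis.competitive k 2≤k I sel 0<w S feasible H)
    (≤-reflexive (cong (ℚ._* flowS I S) (sym (trans (ℚof-* (8000 * k) k) (cong (ℚ._* ℚof k) (ℚof-* 8000 k))))))
  where open CompetitiveAnalysis using (module Analysis; ℚof-*)
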